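{- There is an absolute constant $c>0$ such that for every latin square $\mathsf{L}\subset X\times Y\times Z$ of order $n$ and every integer $1\le m\le cn$, \[\sum_{A\subset[n],\,|A|=m}\Lambda\bigl(|P_A1_{S_X}|,|P_A1_{S_Y}|,|P_A1_{S_Z}|\bigr)\le\Bigl(\frac{n!}{n^n}\Bigr)^3 O(1)^{m+n/m}(m/n)^{m/8},\] where the $O(1)$ is an absolute constant.
   Context: A latin square of order $n$ is $\mathsf{L}\subset X\times Y\times Z$ with $|X|=|Y|=|Z|=n$ such that every pair in $X\times Y$, $Y\times Z$, $Z\times X$ lies in exactly one triple. $\Lambda(f,g,h)=\mathbf{E}_{(x,y,z)\in\mathsf{L}^n}f(x)g(y)h(z)$, where $\mathsf{L}^n$ is the set of $(x,y,z)\in X^n\times Y^n\times Z^n$ with $(x_i,y_i,z_i)\in\mathsf{L}$ for all $i$. Functions on $X^n$ carry the inner product $\mathbf{E}_{x\in X^n}f\bar g$. For $A\subset[n]$, $Q_A$ is the orthogonal projection onto functions depending only on $(x_i:i\in A)$ and $P_A=\sum_{B\subset A}(-1)^{|A\setminus B|}Q_B$ (similarly on $Y^n,Z^n$). $S_X\subset X^n$ is the set of bijections $[n]\to X$, similarly $S_Y,S_Z$; $|F|$ denotes the pointwise absolute value of a function $F$. -}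

module Defs where

open import Data.Nat as ℕ using (ℕ; zero; suc)
open import Data.Bool using (Bool; true; false; if_then_else_; _∧_)
open import Data.Fin using (Fin; zero; suc; _≟_)
open import Data.Fin.Subset using (Subset; _∈_; _⊆_; ∣_∣)
open import Data.Fin.Subset.Properties using (_∈?_; _⊆?_)
open import Data.List using (List; []; _∷_; map; concatMap; filter; length; foldr; allFin; cartesianProduct)
open import Data.Vec using (Vec; []; _∷_)
open import Data.Product using (Σ; _×_; _,_)
open import Data.Integer using (+_)
open import Relation.Binary.PropositionalEquality using (_≡_)
open import Relation.Nullary using (yes; no; does)
open import Relation.Nullary.Decidable using (⌊_⌋)
open import Data.Rational as ℚ using (ℚ; 0ℚ; 1ℚ; _+_; _*_; -_; _/_)

_^ℚ_ : ℚ → ℕ → ℚ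
q ^ℚ zero = 1ℚ
q ^ℚ suc k = q * (q ^ℚ k)

sumℚ : List ℚ → ℚ
sumℚ = foldr _+_ 0ℚ

avg : List ℚ → ℚ
avg [] = 0ℚ
avg (q ∷ qs) = sumℚ (q ∷ qs) * (+ 1 / suc (length qs))

ℕtoℚ : ℕ → ℚ
ℕtoℚ k = + k / 1

allFuns : {A : Set} → List A → (k : ℕ) → List (Fin k → A)
allFuns as zero = (λ ()) ∷ []
allFuns as (suc k) =
  concatMap (λ a → map (λ f → λ { zero → a ; (suc i) → f i }) (allFuns as k)) as

allSubsets : (k : ℕ) → List (Subset k)
allSubsets zero = [] ∷ []
allSubsets (suc k) = concatMap (λ s → (true ∷ s) ∷ (false ∷ s) ∷ []) (allSubsets k)

∃!Fin : (n : ℕ) → (Fin n → Set) → Set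
∃!Fin n P = Σ (Fin n) λ a → P a × (∀ b → P b → b ≡ a)

record LatinSquare (n : ℕ) : Set where
  field
    L  : Fin n → Fin n → Fin n → Bool
    xy : ∀ x y → ∃!Fin n λ z → L x y z ≡ true
    yz : ∀ y z → ∃!Fin n λ x → L x y z ≡ true
    zx : ∀ z x → ∃!Fin n λ y → L x y z ≡ true

-- the space X^n (also used for Y^n, Z^n)
Pt : ℕ → Set
Pt n = Fin n → Fin n

allPts : (n : ℕ) → List (Pt n)
allPts n = allFuns (allFin n) n

Fn : ℕ → Set
Fn n = Pt n → ℚ

mix : {n : ℕ} → Subset n → Pt n → Pt n → Pt n
mix A x y i = if does (i ∈? A) then x i else y i

-- Q_A: orthogonal projection (w.r.t. E_{x∈X^n} f ḡ) onto functions depending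
-- only on (x_i : i ∈ A), i.e. averaging over the coordinates outside A
Q : {n : ℕ} → Subset n → Fn n → Fn n
Q {n} A f x = avg (map (λ y → f (mix A x y)) (allPts n))

sign : ℕ → ℚ
sign zero = 1ℚ
sign (suc k) = - sign k

-- P_A = Σ_{B ⊆ A} (-1)^{|A \ B|} Q_B   (|A \ B| = |A| - |B| for B ⊆ A)
P : {n : ℕ} → Subset n → Fn n → Fn n
P {n} A f x =
  sumℚ (map (λ B → sign (∣ A ∣ ℕ.∸ ∣ B ∣) * Q B f x)
            (filter (λ B → B ⊆? A) (allSubsets n)))

absF : {n : ℕ} → Fn n → Fn n
absF f x = ℚ.∣ f x ∣

-- is the point x : [n] → Fin n injective (equivalently a bijection)?
isBij : {n : ℕ} → Pt n → Bool
isBij {n} x =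
  foldr _∧_ true
    (map (λ i → foldr _∧_ true
           (map (λ j → if ⌊ i ≟ j ⌋ then true else (if ⌊ x i ≟ x j ⌋ then false else true))
                (allFin n)))
         (allFin n))

1S : {n : ℕ} → Fn n
1S x = if isBij x then 1ℚ else 0ℚ

inLn : {n : ℕ} → LatinSquare n → Pt n → Pt n → Pt n → Bool
inLn {n} ℒ x y z = foldr _∧_ true (map (λ i → LatinSquare.L ℒ (x i) (y i) (z i)) (allFin n))

Ln : {n : ℕ} → LatinSquare n → List (Pt n × Pt n × Pt n)
Ln {n} ℒ =
  concatMap (λ x → concatMap (λ y → concatMap (λ z →
      if inLn ℒ x y z then (x , y , z) ∷ [] else [])
    (allPts n)) (allPts n)) (allPts n)

Λ : {n : ℕ} → LatinSquare n → Fn n → Fn n → Fn n → ℚ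
Λ ℒ f g h = avg (map (λ { (x , y , z) → f x * g y * h z }) (Ln ℒ))

LHS : {n : ℕ} → LatinSquare n → ℕ → ℚ
LHS {n} ℒ m =
  sumℚ (map (λ A → Λ ℒ (absF (P A 1S)) (absF (P A 1S)) (absF (P A 1S)))
            (filter (λ A → ∣ A ∣ ℕ.≟ m) (allSubsets n)))

{-# OPTIONS --safe #-}
-- Let m = |A| and θ = √(m/n); t is an integer with t / n comparable to θ.
--
-- Pointwise, (nⁿ / n!) |P_A 1_S (x)| ≤ O(1)ᵐ θˢ, where s is the number of i ∈ A such that xᵢ differs from all other
-- coordinates in A: summing over B ⊆ A, each such i contributes a finite difference of b ↦ nᵇ (n - b)!,
-- and s differences gain θˢ by the recurrence n d(s+1, r) = r d(s, r+1) + s d(s-1, r+2).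
--
-- It remains to bound the number of points of Lⁿ weighted by θ^(-u), where u counts the coordinates of x, y, z in A
-- that are repeated.  A point is encoded by saying, for each i ∈ A, which of xᵢ, yᵢ, zᵢ are copied from other positions;
-- two copied entries determine the cell, so at most two are used, unless the whole cell is copied.
-- In a suitable order of the positions the code can be decoded, and the copies in it (each worth θ⁻²) account
-- for θ^(-u) up to a factor θ^(-3m/4), whence
-- Σ θ^(-u) ≤ θ^(-3m/4) n^(2n) (7 + n/m²)ᵐ.  The last factor is O(1)^(m + n/m), and
-- (n choose m) θ^(3m) θ^(-3m/4) = O(1)ᵐ (m/n)^(m/8).

module Submission where

open import Defs
open import Data.Nat using (ℕ; _≤_; _*_; _+_; _!; zero; suc; _<_; _∸_; _^_; z≤n; s≤s; NonZero; _≤?_)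
open import Data.Rational using (ℚ) renaming (_≤_ to _≤ℚ_; _*_ to _*ℚ_)
open import Data.Product using (Σ; _×_; _,_; proj₁; proj₂)
import Data.Nat as ℕ
import Data.Nat.Properties as ℕ
import Data.Nat.DivMod as ℕ
open import Data.Nat.Tactic.RingSolver using (solve-∀)
import Data.Integer as ℤ
import Data.Integer.Properties as ℤ
import Data.Integer.Tactic.RingSolver as ℤR
import Data.Rational as ℚ
import Data.Rational.Properties as ℚ
open import Data.Rational.Solver using (module +-*-Solver)
import Data.Rational.Unnormalised as ℚᵘ
import Data.Rational.Unnormalised.Properties as ℚᵘ
open import Data.Integer using (ℤ)
open import Agda.Builtin.Int using (pos)
open import Data.Bool using (Bool; true; false; if_then_else_; _∧_; _∨_; not)
open import Data.Fin using (Fin; zero; suc; _≟_; fromℕ<)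
import Data.Fin.Properties as Fin
open import Data.Fin.Subset using (Subset; ∣_∣)
open import Data.Fin.Subset.Properties using (_∈?_; _⊆?_; p⊆q⇒∣p∣≤∣q∣; ∣p∣≤n)
open import Data.List using (List; []; _∷_; _++_; map; concatMap; filter; length; foldr; allFin)
import Data.List.Properties as List
open import Data.List.Membership.Propositional using (_∈_; _∉_)
open import Data.List.Membership.Propositional.Properties using (∈-map⁺; ∈-map⁻; ∈-allFin; ∈-++⁺ˡ; ∈-++⁺ʳ; ∈-∃++; ∈-filter⁻)
open import Data.List.Relation.Unary.Any using (here; there)
open import Data.List.Relation.Unary.All as All using (All; []; _∷_)
open import Data.List.Relation.Unary.AllPairs using ([]; _∷_)
open import Data.List.Relation.Unary.Unique.Propositional using (Unique)
import Data.List.Relation.Unary.Unique.Propositional.Properties as Unique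
open import Data.List.Relation.Binary.Permutation.Propositional using (_↭_; ↭-sym; prep; swap)
import Data.List.Relation.Binary.Permutation.Propositional as Perm
import Data.List.Relation.Binary.Permutation.Propositional.Properties as Perm
import Data.List.Relation.Binary.Permutation.Setoid.Properties as PermSetoid
open import Data.Vec using ([]; _∷_)
open import Function using (_∘_; id; case_of_)
open import Relation.Nullary using (yes; no; does; contradiction)
open import Relation.Nullary.Decidable using (⌊_⌋; dec-true; dec-false)
open import Relation.Binary.PropositionalEquality
  using (_≡_; _≢_; setoid; _≗_; refl; sym; trans; cong; cong₂; subst; subst₂; module ≡-Reasoning)

-- Sums, and rational numbers with a common denominator

-- The theorem states the 8m-th power of the inequality, with the powers of n moved to the left:
-- this clears the exponents n/m and m/8. For the same reason θ itself never occurs. It is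
-- represented by t / n, and a power of θ by a monomial in t and n of fixed degree, which can only
-- grow when a factor t is replaced by n.
--
-- The exponent 1/8 comes from a narrow budget. Of the gain θ^(3m) the choice of A uses up θ^(2m),
-- so that on average a position must lose less than one factor 1/θ beyond the credit of the copies.
-- The dangerous position lies in three coincidences: it adds up to 6 to u, but as two coordinates
-- determine its cell, the copies are credited with 4 only. If two of its partners are distinct,
-- they can be encoded before it without any loss, and the loss 2 spread over three positions is
-- 2/3. Rounding this up to 3/4 leaves (1 - 3/4)/2 = 1/8 as the exponent of m/n.

∑ : {A : Set} → List A → (A → ℕ) → ℕ
∑ [] f = 0
∑ (x ∷ xs) f = f x + ∑ xs f

𝟙 : Bool → ℕ
𝟙 true = 1
𝟙 false = 0

∑-cong : {A : Set} {f g : A → ℕ} (xs : List A) → (∀ x → f x ≡ g x) → ∑ xs f ≡ ∑ xs g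
∑-cong [] e = refl
∑-cong (x ∷ xs) e = cong₂ _+_ (e x) (∑-cong xs e)

∑-mono∈ : {A : Set} {f g : A → ℕ} (xs : List A) → (∀ {x} → x ∈ xs → f x ≤ g x) → ∑ xs f ≤ ∑ xs g
∑-mono∈ [] e = z≤n
∑-mono∈ (x ∷ xs) e = ℕ.+-mono-≤ (e (here refl)) (∑-mono∈ xs (e ∘ there))

∑-mono : {A : Set} {f g : A → ℕ} (xs : List A) → (∀ x → f x ≤ g x) → ∑ xs f ≤ ∑ xs g
∑-mono xs e = ∑-mono∈ xs (λ {x} _ → e x)

∑-0 : {A : Set} (xs : List A) → ∑ xs (λ _ → 0) ≡ 0
∑-0 [] = refl
∑-0 (x ∷ xs) = ∑-0 xs

∑-++ : {A : Set} {f : A → ℕ} (xs ys : List A) → ∑ (xs ++ ys) f ≡ ∑ xs f + ∑ ys f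
∑-++ [] ys = refl
∑-++ {f = f} (x ∷ xs) ys rewrite ∑-++ {f = f} xs ys = sym (ℕ.+-assoc (f x) _ _)

∑-concatMap : {A B : Set} {f : B → ℕ} (h : A → List B) (xs : List A) →
  ∑ (concatMap h xs) f ≡ ∑ xs (λ x → ∑ (h x) f)
∑-concatMap h [] = refl
∑-concatMap {f = f} h (x ∷ xs) =
  trans (∑-++ (h x) (concatMap h xs)) (cong (∑ (h x) f +_) (∑-concatMap h xs))

∑-map : {A B : Set} {f : B → ℕ} (h : A → B) (xs : List A) → ∑ (map h xs) f ≡ ∑ xs (f ∘ h)
∑-map h [] = refl
∑-map {f = f} h (x ∷ xs) = cong (f (h x) +_) (∑-map h xs)

∑-*ˡ : {A : Set} {f : A → ℕ} (c : ℕ) (xs : List A) → ∑ xs (λ x → c * f x) ≡ c * ∑ xs f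
∑-*ˡ c [] = sym (ℕ.*-zeroʳ c)
∑-*ˡ {f = f} c (x ∷ xs) =
  trans (cong (c * f x +_) (∑-*ˡ c xs)) (sym (ℕ.*-distribˡ-+ c (f x) _))

∑-*ʳ : {A : Set} {f : A → ℕ} (c : ℕ) (xs : List A) → ∑ xs (λ x → f x * c) ≡ ∑ xs f * c
∑-*ʳ {f = f} c xs =
  trans (∑-cong xs (λ x → ℕ.*-comm (f x) c)) (trans (∑-*ˡ c xs) (ℕ.*-comm c _))

∑-+ : {A : Set} {f g : A → ℕ} (xs : List A) → ∑ xs (λ x → f x + g x) ≡ ∑ xs f + ∑ xs g
∑-+ [] = refl
∑-+ {f = f} {g} (x ∷ xs) rewrite ∑-+ {f = f} {g} xs = interchange (f x) (g x) (∑ xs f) (∑ xs g)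
  where
  interchange : ∀ a b c d → a + b + (c + d) ≡ a + c + (b + d)
  interchange = solve-∀

∑-swap : {A B : Set} {f : A → B → ℕ} (xs : List A) (ys : List B) →
  ∑ xs (λ x → ∑ ys (f x)) ≡ ∑ ys (λ y → ∑ xs (λ x → f x y))
∑-swap [] ys = sym (∑-0 ys)
∑-swap {f = f} (x ∷ xs) ys =
  trans (cong (∑ ys (f x) +_) (∑-swap xs ys)) (sym (∑-+ {f = f x} ys))

∑-const : {A : Set} (c : ℕ) (xs : List A) → ∑ xs (λ _ → c) ≡ length xs * c
∑-const c [] = refl
∑-const c (x ∷ xs) = cong (c +_) (∑-const c xs)

∑-∈ : {A : Set} {f : A → ℕ} {x : A} {xs : List A} → x ∈ xs → f x ≤ ∑ xs f
∑-∈ (here refl) = ℕ.m≤m+n _ _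
∑-∈ {f = f} (there {y} i) = ℕ.≤-trans (∑-∈ i) (ℕ.m≤n+m _ (f y))

𝟙-∧ : ∀ a b → 𝟙 (a ∧ b) ≡ 𝟙 a * 𝟙 b
𝟙-∧ true b = sym (ℕ.+-identityʳ _)
𝟙-∧ false b = refl

∑ℤ : {A : Set} → List A → (A → ℤ) → ℤ
∑ℤ [] f = ℤ.0ℤ
∑ℤ (x ∷ xs) f = f x ℤ.+ ∑ℤ xs f

ι : ℤ → ℚ
ι z = z ℚ./ 1

private
  toℚᵘ-ι : ∀ z → ℚ.toℚᵘ (ι z) ℚᵘ.≃ ℚᵘ.mkℚᵘ z 0
  toℚᵘ-ι z = ℚ.toℚᵘ-fromℚᵘ (ℚᵘ.mkℚᵘ z 0)

ι-+ : ∀ a b → ι a ℚ.+ ι b ≡ ι (a ℤ.+ b)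
ι-+ a b = ℚ.toℚᵘ-injective
  (ℚᵘ.≃-trans (ℚ.toℚᵘ-homo-+ (ι a) (ι b))
  (ℚᵘ.≃-trans (ℚᵘ.+-cong (toℚᵘ-ι a) (toℚᵘ-ι b))
  (ℚᵘ.≃-trans (ℚᵘ.*≡* (cong₂ (λ u v → (u ℤ.+ v) ℤ.* pos 1) (ℤ.*-identityʳ a) (ℤ.*-identityʳ b)))
   (ℚᵘ.≃-sym (toℚᵘ-ι (a ℤ.+ b))))))

ι-* : ∀ a b → ι a ℚ.* ι b ≡ ι (a ℤ.* b)
ι-* a b = ℚ.toℚᵘ-injective
  (ℚᵘ.≃-trans (ℚ.toℚᵘ-homo-* (ι a) (ι b))
  (ℚᵘ.≃-trans (ℚᵘ.*-cong (toℚᵘ-ι a) (toℚᵘ-ι b))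
  (ℚᵘ.≃-trans (ℚᵘ.*≡* refl)
   (ℚᵘ.≃-sym (toℚᵘ-ι (a ℤ.* b))))))

ι-neg : ∀ a → ℚ.- ι a ≡ ι (ℤ.- a)
ι-neg a = ℚ.toℚᵘ-injective
  (ℚᵘ.≃-trans (ℚ.toℚᵘ-homo‿- (ι a))
  (ℚᵘ.≃-trans (ℚᵘ.-‿cong (toℚᵘ-ι a)) (ℚᵘ.≃-sym (toℚᵘ-ι (ℤ.- a)))))

ι-∣∣ : ∀ a → ℚ.∣ ι a ∣ ≡ ℕtoℚ ℤ.∣ a ∣
ι-∣∣ a = ℚ.toℚᵘ-injective
  (ℚᵘ.≃-trans (ℚ.toℚᵘ-homo-∣-∣ (ι a))
  (ℚᵘ.≃-trans (ℚᵘ.∣-∣-cong (toℚᵘ-ι a)) (ℚᵘ.≃-sym (toℚᵘ-ι (pos ℤ.∣ a ∣)))))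

ι-mono : ∀ {a b} → a ℤ.≤ b → ι a ℚ.≤ ι b
ι-mono {a} {b} a≤b = ℚ.toℚᵘ-cancel-≤
  (ℚᵘ.≤-respʳ-≃ (ℚᵘ.≃-sym (toℚᵘ-ι b)) (ℚᵘ.≤-respˡ-≃ (ℚᵘ.≃-sym (toℚᵘ-ι a))
    (ℚᵘ.*≤* (ℤ.*-monoʳ-≤-nonNeg (pos 1) a≤b))))

ℕtoℚ-* : ∀ a b → ℕtoℚ a ℚ.* ℕtoℚ b ≡ ℕtoℚ (a * b)
ℕtoℚ-* a b = trans (ι-* (pos a) (pos b)) (cong ι (sym (ℤ.pos-* a b)))

ℕtoℚ-^ : ∀ a k → ℕtoℚ a ^ℚ k ≡ ℕtoℚ (a ^ k)
ℕtoℚ-^ a zero = refl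
ℕtoℚ-^ a (suc k) = trans (cong (ℕtoℚ a ℚ.*_) (ℕtoℚ-^ a k)) (ℕtoℚ-* a (a ^ k))

^ℚ-distrib-* : ∀ p q k → (p ℚ.* q) ^ℚ k ≡ (p ^ℚ k) ℚ.* (q ^ℚ k)
^ℚ-distrib-* p q zero = refl
^ℚ-distrib-* p q (suc k) = trans (cong ((p ℚ.* q) ℚ.*_) (^ℚ-distrib-* p q k))
  (ℚ-interchange p q (p ^ℚ k) (q ^ℚ k))
  where
  ℚ-interchange : ∀ a b c d → (a ℚ.* b) ℚ.* (c ℚ.* d) ≡ (a ℚ.* c) ℚ.* (b ℚ.* d)
  ℚ-interchange a b c d = begin
    (a ℚ.* b) ℚ.* (c ℚ.* d) ≡⟨ ℚ.*-assoc a b _ ⟩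
    a ℚ.* (b ℚ.* (c ℚ.* d)) ≡⟨ cong (a ℚ.*_) (sym (ℚ.*-assoc b c d)) ⟩
    a ℚ.* ((b ℚ.* c) ℚ.* d) ≡⟨ cong (λ u → a ℚ.* (u ℚ.* d)) (ℚ.*-comm b c) ⟩
    a ℚ.* ((c ℚ.* b) ℚ.* d) ≡⟨ cong (a ℚ.*_) (ℚ.*-assoc c b d) ⟩
    a ℚ.* (c ℚ.* (b ℚ.* d)) ≡⟨ sym (ℚ.*-assoc a c _) ⟩
    (a ℚ.* c) ℚ.* (b ℚ.* d) ∎
    where open ≡-Reasoning

-- Averages are accessible only through their product with a common denominator c; this carries such
-- knowledge through a sum without computing any fraction.
sumℚ-scale : {A : Set} (c : ℚ) (f : A → ℚ) (h : A → ℤ) (xs : List A) →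
  (∀ {x} → x ∈ xs → f x ℚ.* c ≡ ι (h x)) → sumℚ (map f xs) ℚ.* c ≡ ι (∑ℤ xs h)
sumℚ-scale c f h [] e = ℚ.*-zeroˡ c
sumℚ-scale c f h (x ∷ xs) e = begin
  (f x ℚ.+ sumℚ (map f xs)) ℚ.* c         ≡⟨ ℚ.*-distribʳ-+ c (f x) _ ⟩
  f x ℚ.* c ℚ.+ sumℚ (map f xs) ℚ.* c     ≡⟨ cong₂ ℚ._+_ (e (here refl)) (sumℚ-scale c f h xs (e ∘ there)) ⟩
  ι (h x) ℚ.+ ι (∑ℤ xs h)                 ≡⟨ ι-+ (h x) _ ⟩
  ι (h x ℤ.+ ∑ℤ xs h)                     ∎
  where open ≡-Reasoning

∑ℤ-pos : {A : Set} (h : A → ℕ) (xs : List A) → ∑ℤ xs (pos ∘ h) ≡ pos (∑ xs h)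
∑ℤ-pos h [] = refl
∑ℤ-pos h (x ∷ xs) = trans (cong (λ u → pos (h x) ℤ.+ u) (∑ℤ-pos h xs)) (sym (ℤ.pos-+ (h x) _))

sumℚ-scaleℕ : {A : Set} (c : ℚ) (f : A → ℚ) (h : A → ℕ) (xs : List A) →
  (∀ {x} → x ∈ xs → f x ℚ.* c ≡ ℕtoℚ (h x)) → sumℚ (map f xs) ℚ.* c ≡ ℕtoℚ (∑ xs h)
sumℚ-scaleℕ c f h xs e = trans (sumℚ-scale c f (pos ∘ h) xs e) (cong ι (∑ℤ-pos h xs))

avg-length : (qs : List ℚ) → avg qs ℚ.* ℕtoℚ (length qs) ≡ sumℚ qs
avg-length [] = refl
avg-length (q ∷ qs) = begin
  (s ℚ.* r) ℚ.* ℕtoℚ k ≡⟨ ℚ.*-assoc s r _ ⟩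
  s ℚ.* (r ℚ.* ℕtoℚ k) ≡⟨ cong (s ℚ.*_) r*k ⟩
  s ℚ.* ℚ.1ℚ           ≡⟨ ℚ.*-identityʳ s ⟩
  s                    ∎
  where
  open ≡-Reasoning
  k = suc (length qs)
  s = sumℚ (q ∷ qs)
  r = pos 1 ℚ./ k
  r*k : r ℚ.* ℕtoℚ k ≡ ℚ.1ℚ
  r*k = ℚ.toℚᵘ-injective
    (ℚᵘ.≃-trans (ℚ.toℚᵘ-homo-* r (ℕtoℚ k))
    (ℚᵘ.≃-trans (ℚᵘ.*-cong (ℚ.toℚᵘ-fromℚᵘ (ℚᵘ.mkℚᵘ (pos 1) (length qs))) (toℚᵘ-ι (pos k)))
      (ℚᵘ.*≡* (trans (ℤ.*-identityʳ (pos 1 ℤ.* pos k)) (cong (λ u → pos 1 ℤ.* pos u) (sym (ℕ.*-identityʳ k)))))))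

-- Counting bijections with prescribed values

infixr 5 _∷ᶠ_
_∷ᶠ_ : {A : Set} {k : ℕ} → A → (Fin k → A) → Fin (suc k) → A
(a ∷ᶠ f) zero = a
(a ∷ᶠ f) (suc i) = f i

-- `allFuns` builds its members by a pattern-matching lambda that agrees with `a ∷ᶠ f` only
-- pointwise. Without function extensionality g must be assumed to respect `≗`.
∑-allFuns : {A : Set} (as : List A) (k : ℕ) (g : (Fin (suc k) → A) → ℕ) →
  (∀ f f′ → f ≗ f′ → g f ≡ g f′) →
  ∑ (allFuns as (suc k)) g ≡ ∑ as (λ a → ∑ (allFuns as k) (λ f → g (a ∷ᶠ f)))
∑-allFuns as k g ext =
  trans (∑-concatMap _ as)
    (∑-cong as (λ a → trans (∑-map _ (allFuns as k))
      (∑-cong (allFuns as k) (λ f → ext _ _ (λ { zero → refl ; (suc i) → refl })))))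

length-∑ : {A : Set} (xs : List A) → ∑ xs (λ _ → 1) ≡ length xs
length-∑ xs = trans (∑-const 1 xs) (ℕ.*-identityʳ _)

length-allFuns : {A : Set} (as : List A) (k : ℕ) → length (allFuns as k) ≡ length as ^ k
length-allFuns as zero = refl
length-allFuns as (suc k) = begin
  length (allFuns as (suc k))                  ≡⟨ sym (length-∑ (allFuns as (suc k))) ⟩
  ∑ (allFuns as (suc k)) (λ _ → 1)             ≡⟨ ∑-allFuns as k (λ _ → 1) (λ _ _ _ → refl) ⟩
  ∑ as (λ _ → ∑ (allFuns as k) (λ _ → 1))      ≡⟨ ∑-const _ as ⟩
  length as * ∑ (allFuns as k) (λ _ → 1)       ≡⟨ cong (length as *_) (length-∑ (allFuns as k)) ⟩
  length as * length (allFuns as k)            ≡⟨ cong (length as *_) (length-allFuns as k) ⟩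
  length as * length as ^ k                    ∎
  where open ≡-Reasoning

length-allFin : ∀ n → length (allFin n) ≡ n
length-allFin n = List.length-tabulate {n = n} id

∑-allFin-suc : {n : ℕ} (f : Fin (suc n) → ℕ) → ∑ (allFin (suc n)) f ≡ f zero + ∑ (allFin n) (f ∘ suc)
∑-allFin-suc {n} f = cong (f zero +_)
  (trans (cong (λ xs → ∑ xs f) (sym (List.map-tabulate id suc))) (∑-map suc (allFin n)))

∑-point : {n : ℕ} (v : Fin n) (g : Fin n → ℕ) → ∑ (allFin n) (λ a → 𝟙 (does (a ≟ v)) * g a) ≡ g v
∑-point {suc n} zero g = begin
  ∑ (allFin (suc n)) (λ a → 𝟙 (does (a ≟ zero)) * g a) ≡⟨ ∑-allFin-suc (λ a → 𝟙 (does (a ≟ zero)) * g a) ⟩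
  g zero + 0 + ∑ (allFin n) (λ _ → 0)                  ≡⟨ cong₂ _+_ (ℕ.+-identityʳ _) (∑-0 (allFin n)) ⟩
  g zero + 0                                           ≡⟨ ℕ.+-identityʳ _ ⟩
  g zero                                               ∎
  where open ≡-Reasoning
∑-point {suc n} (suc v) g =
  trans (∑-allFin-suc (λ a → 𝟙 (does (a ≟ suc v)) * g a)) (∑-point v (g ∘ suc))

infixr 5 _▸_
_▸_ : {n : ℕ} → Fin n → (Fin n → Bool) → Fin n → Bool
(v ▸ F) a = does (a ≟ v) ∨ F a

∅ : {n : ℕ} → Fin n → Bool
∅ _ = false

▸-comm : {n : ℕ} (a b : Fin n) (F : Fin n → Bool) → (a ▸ b ▸ F) ≗ (b ▸ a ▸ F)
▸-comm a b F c with does (c ≟ a) | does (c ≟ b)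
... | true | true = refl
... | true | false = refl
... | false | true = refl
... | false | false = refl

▸-cong : {n : ℕ} (a : Fin n) {F F′ : Fin n → Bool} → F ≗ F′ → (a ▸ F) ≗ (a ▸ F′)
▸-cong a e c = cong (does (c ≟ a) ∨_) (e c)

free# : {n : ℕ} → (Fin n → Bool) → ℕ
free# {n} F = ∑ (allFin n) (λ a → 𝟙 (not (F a)))

free#-∅ : {n : ℕ} → free# {n} ∅ ≡ n
free#-∅ {n} = trans (length-∑ (allFin n)) (length-allFin n)

free#-▸ : {n : ℕ} (v : Fin n) (F : Fin n → Bool) → F v ≡ false → suc (free# (v ▸ F)) ≡ free# F
free#-▸ {n} v F Fv = sym (begin
  free# F                                                              ≡⟨ ∑-cong (allFin n) pointwise ⟩
  ∑ (allFin n) (λ a → 𝟙 (does (a ≟ v)) * 1 + 𝟙 (not ((v ▸ F) a)))      ≡⟨ ∑-+ (allFin n) ⟩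
  ∑ (allFin n) (λ a → 𝟙 (does (a ≟ v)) * 1) + free# (v ▸ F)            ≡⟨ cong (_+ free# (v ▸ F)) (∑-point v (λ _ → 1)) ⟩
  suc (free# (v ▸ F))                                                  ∎)
  where
  open ≡-Reasoning
  pointwise : ∀ a → 𝟙 (not (F a)) ≡ 𝟙 (does (a ≟ v)) * 1 + 𝟙 (not ((v ▸ F) a))
  pointwise a with a ≟ v
  ... | yes refl rewrite Fv = refl
  ... | no _ = refl

-- F holds the values that are already taken. Carrying it along turns injectivity on B into a scan
-- of the coordinates, which suits induction on k.
injOn : {n k : ℕ} → (Fin n → Bool) → Subset k → (Fin k → Fin n) → Bool
injOn F [] x = true
injOn F (true ∷ B) x = not (F (x zero)) ∧ injOn (x zero ▸ F) B (x ∘ suc)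
injOn F (false ∷ B) x = injOn F B (x ∘ suc)

injOn-cong : {n k : ℕ} {F F′ : Fin n → Bool} (B : Subset k) (x : Fin k → Fin n) →
  F ≗ F′ → injOn F B x ≡ injOn F′ B x
injOn-cong [] x e = refl
injOn-cong (true ∷ B) x e = cong₂ (λ a b → not a ∧ b) (e (x zero)) (injOn-cong B (x ∘ suc) (▸-cong (x zero) e))
injOn-cong (false ∷ B) x e = injOn-cong B (x ∘ suc) e

-- If x is injective on B and avoids F, then a is admissible when it lies neither in F nor among the
-- `∣ B ∣` distinct values of x on B. Otherwise both sides vanish.
∑-injOn-▸ : {n k : ℕ} (F : Fin n → Bool) (B : Subset k) (x : Fin k → Fin n) →
  ∑ (allFin n) (λ a → 𝟙 (not (F a)) * 𝟙 (injOn (a ▸ F) B x)) ≡ 𝟙 (injOn F B x) * (free# F ∸ ∣ B ∣)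
∑-injOn-▸ {n} F [] x = trans (∑-cong (allFin n) (λ a → ℕ.*-identityʳ _)) (sym (ℕ.+-identityʳ _))
∑-injOn-▸ F (false ∷ B) x = ∑-injOn-▸ F B (x ∘ suc)
∑-injOn-▸ {n} F (true ∷ B) x = trans (∑-cong (allFin n) pointwise)
  (trans (∑-*ˡ (𝟙 (not (F v))) (allFin n)) (trans (cong (𝟙 (not (F v)) *_) (∑-injOn-▸ (v ▸ F) B (x ∘ suc))) finish))
  where
  v = x zero
  J = λ a → 𝟙 (injOn (a ▸ v ▸ F) B (x ∘ suc))
  pointwise : ∀ a → 𝟙 (not (F a)) * 𝟙 (injOn (a ▸ F) (true ∷ B) x) ≡ 𝟙 (not (F v)) * (𝟙 (not ((v ▸ F) a)) * J a)
  pointwise a rewrite injOn-cong B (x ∘ suc) (▸-comm v a F) with a ≟ v | v ≟ a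
  ... | yes refl | yes _ = trans (ℕ.*-zeroʳ (𝟙 (not (F v)))) (sym (ℕ.*-zeroʳ (𝟙 (not (F v)))))
  ... | yes refl | no ¬e = contradiction refl ¬e
  ... | no ¬e | yes refl = contradiction refl ¬e
  ... | no _ | no _ rewrite 𝟙-∧ (not (F v)) (injOn (a ▸ v ▸ F) B (x ∘ suc)) =
    swap-mul (𝟙 (not (F a))) (𝟙 (not (F v))) (J a)
    where
    swap-mul : ∀ p q r → p * (q * r) ≡ q * (p * r)
    swap-mul = solve-∀
  finish : 𝟙 (not (F v)) * (𝟙 (injOn (v ▸ F) B (x ∘ suc)) * (free# (v ▸ F) ∸ ∣ B ∣))
    ≡ 𝟙 (injOn F (true ∷ B) x) * (free# F ∸ suc ∣ B ∣)
  finish with F v in eq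
  ... | true = refl
  ... | false = trans (ℕ.+-identityʳ _)
    (cong (λ u → 𝟙 (injOn (v ▸ F) B (x ∘ suc)) * (u ∸ suc ∣ B ∣)) (free#-▸ v F eq))

inj? : {n k : ℕ} → (Fin n → Bool) → (Fin k → Fin n) → Bool
inj? {k = zero} F f = true
inj? {k = suc k} F f = not (F (f zero)) ∧ inj? (f zero ▸ F) (f ∘ suc)

inj?-cong : {n k : ℕ} {F : Fin n → Bool} {f f′ : Fin k → Fin n} → f ≗ f′ → inj? F f ≡ inj? F f′
inj?-cong {k = zero} e = refl
inj?-cong {k = suc k} {F} {f} {f′} e rewrite e zero = cong (not (F (f′ zero)) ∧_) (inj?-cong (e ∘ suc))

mixₖ : {n k : ℕ} → Subset k → (Fin k → Fin n) → (Fin k → Fin n) → Fin k → Fin n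
mixₖ A x y i = if does (i ∈? A) then x i else y i

mixₖ-cong : {n k : ℕ} (B : Subset k) (x : Fin k → Fin n) {y y′ : Fin k → Fin n} → y ≗ y′ → mixₖ B x y ≗ mixₖ B x y′
mixₖ-cong B x e i with does (i ∈? B)
... | true = refl
... | false = e i

falling : ℕ → ℕ → ℕ
falling N zero = 1
falling N (suc j) = N * falling (N ∸ 1) j

falling-self : ∀ N → falling N N ≡ N !
falling-self zero = refl
falling-self (suc N) = cong (suc N *_) (falling-self N)

-- The mixture ignores y on B, whence n ^ `∣ B ∣`. The other values of y are chosen one after
-- another outside F, the earlier values and also the values of x on B that come later in the scan;
-- `∑-injOn-▸` accounts for the last condition.
∑-inj?-mix : {n k : ℕ} (F : Fin n → Bool) (B : Subset k) (x : Fin k → Fin n) →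
  ∑ (allFuns (allFin n) k) (λ y → 𝟙 (inj? F (mixₖ B x y)))
    ≡ 𝟙 (injOn F B x) * (n ^ ∣ B ∣ * falling (free# F ∸ ∣ B ∣) (k ∸ ∣ B ∣))
∑-inj?-mix F [] x = refl
∑-inj?-mix {n} {suc k} F (true ∷ B) x = begin
  ∑ (allFuns (allFin n) (suc k)) (λ y → 𝟙 (inj? F (mixₖ (true ∷ B) x y)))
    ≡⟨ ∑-allFuns (allFin n) k _ (λ f f′ e → cong 𝟙 (inj?-cong (mixₖ-cong (true ∷ B) x e))) ⟩
  ∑ (allFin n) (λ a → ∑ (allFuns (allFin n) k) (λ y → 𝟙 (not (F v) ∧ inj? (v ▸ F) (mixₖ B (x ∘ suc) y))))
    ≡⟨ ∑-const _ (allFin n) ⟩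
  length (allFin n) * ∑ (allFuns (allFin n) k) (λ y → 𝟙 (not (F v) ∧ inj? (v ▸ F) (mixₖ B (x ∘ suc) y)))
    ≡⟨ cong₂ _*_ (length-allFin n) (∑-cong (allFuns (allFin n) k) (λ y → 𝟙-∧ (not (F v)) (inj? (v ▸ F) (mixₖ B (x ∘ suc) y)))) ⟩
  n * ∑ (allFuns (allFin n) k) (λ y → 𝟙 (not (F v)) * 𝟙 (inj? (v ▸ F) (mixₖ B (x ∘ suc) y)))
    ≡⟨ cong (n *_) (∑-*ˡ (𝟙 (not (F v))) (allFuns (allFin n) k)) ⟩
  n * (𝟙 (not (F v)) * ∑ (allFuns (allFin n) k) (λ y → 𝟙 (inj? (v ▸ F) (mixₖ B (x ∘ suc) y))))
    ≡⟨ cong (λ u → n * (𝟙 (not (F v)) * u)) (∑-inj?-mix (v ▸ F) B (x ∘ suc)) ⟩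
  n * (𝟙 (not (F v)) * (J * (n ^ ∣ B ∣ * falling (free# (v ▸ F) ∸ ∣ B ∣) (k ∸ ∣ B ∣))))
    ≡⟨ finish ⟩
  𝟙 (injOn F (true ∷ B) x) * (n * n ^ ∣ B ∣ * falling (free# F ∸ suc ∣ B ∣) (k ∸ ∣ B ∣)) ∎
  where
  open ≡-Reasoning
  v = x zero
  J = 𝟙 (injOn (v ▸ F) B (x ∘ suc))
  rearrange : ∀ a j p q → a * (1 * (j * (p * q))) ≡ j * (a * p * q)
  rearrange = solve-∀
  finish : n * (𝟙 (not (F v)) * (J * (n ^ ∣ B ∣ * falling (free# (v ▸ F) ∸ ∣ B ∣) (k ∸ ∣ B ∣))))
    ≡ 𝟙 (injOn F (true ∷ B) x) * (n * n ^ ∣ B ∣ * falling (free# F ∸ suc ∣ B ∣) (k ∸ ∣ B ∣))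
  finish with F v in eq
  ... | true = ℕ.*-zeroʳ n
  ... | false rewrite sym (free#-▸ v F eq) = rearrange n J (n ^ ∣ B ∣) _
∑-inj?-mix {n} {suc k} F (false ∷ B) x = begin
  ∑ (allFuns (allFin n) (suc k)) (λ y → 𝟙 (inj? F (mixₖ (false ∷ B) x y)))
    ≡⟨ ∑-allFuns (allFin n) k _ (λ f f′ e → cong 𝟙 (inj?-cong (mixₖ-cong (false ∷ B) x e))) ⟩
  ∑ (allFin n) (λ a → ∑ (allFuns (allFin n) k) (λ y → 𝟙 (not (F a) ∧ inj? (a ▸ F) (mixₖ B (x ∘ suc) y))))
    ≡⟨ ∑-cong (allFin n) pointwise ⟩
  ∑ (allFin n) (λ a → 𝟙 (not (F a)) * 𝟙 (injOn (a ▸ F) B (x ∘ suc)) * c)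
    ≡⟨ ∑-*ʳ c (allFin n) ⟩
  ∑ (allFin n) (λ a → 𝟙 (not (F a)) * 𝟙 (injOn (a ▸ F) B (x ∘ suc))) * c
    ≡⟨ cong (_* c) (∑-injOn-▸ F B (x ∘ suc)) ⟩
  𝟙 (injOn F B (x ∘ suc)) * (free# F ∸ ∣ B ∣) * c
    ≡⟨ rearrange (𝟙 (injOn F B (x ∘ suc))) (free# F ∸ ∣ B ∣) (n ^ ∣ B ∣) _ ⟩
  𝟙 (injOn F B (x ∘ suc)) * (n ^ ∣ B ∣ * falling (free# F ∸ ∣ B ∣) (suc (k ∸ ∣ B ∣)))
    ≡⟨ cong (λ u → 𝟙 (injOn F B (x ∘ suc)) * (n ^ ∣ B ∣ * falling (free# F ∸ ∣ B ∣) u))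
         (sym (ℕ.+-∸-assoc 1 (∣p∣≤n B))) ⟩
  𝟙 (injOn F B (x ∘ suc)) * (n ^ ∣ B ∣ * falling (free# F ∸ ∣ B ∣) (suc k ∸ ∣ B ∣)) ∎
  where
  open ≡-Reasoning
  c = n ^ ∣ B ∣ * falling (free# F ∸ ∣ B ∣ ∸ 1) (k ∸ ∣ B ∣)
  rearrange : ∀ j a p q → j * a * (p * q) ≡ j * (p * (a * q))
  rearrange = solve-∀
  pred-∸ : ∀ a b → a ∸ b ≡ suc a ∸ b ∸ 1
  pred-∸ a b = trans (sym (ℕ.∸-+-assoc (suc a) 1 b)) (trans (cong (suc a ∸_) (ℕ.+-comm 1 b)) (sym (ℕ.∸-+-assoc (suc a) b 1)))
  pointwise : ∀ a → ∑ (allFuns (allFin n) k) (λ y → 𝟙 (not (F a) ∧ inj? (a ▸ F) (mixₖ B (x ∘ suc) y)))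
    ≡ 𝟙 (not (F a)) * 𝟙 (injOn (a ▸ F) B (x ∘ suc)) * c
  pointwise a with F a in eq
  ... | true = ∑-0 (allFuns (allFin n) k)
  ... | false = trans (∑-inj?-mix (a ▸ F) B (x ∘ suc))
    (cong₂ (λ u w → u * (n ^ ∣ B ∣ * falling w (k ∸ ∣ B ∣)))
      (sym (ℕ.+-identityʳ (𝟙 (injOn (a ▸ F) B (x ∘ suc)))))
      (trans (pred-∸ (free# (a ▸ F)) ∣ B ∣) (cong (λ u → u ∸ ∣ B ∣ ∸ 1) (free#-▸ a F eq))))

-- P_A 1_S as an alternating sum of integers

true-iff : {a b : Bool} → (a ≡ true → b ≡ true) → (b ≡ true → a ≡ true) → a ≡ b
true-iff {true} {b} f g = sym (f refl)
true-iff {false} {true} f g = g refl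
true-iff {false} {false} f g = refl

∧-true : {a b : Bool} → a ∧ b ≡ true → a ≡ true × b ≡ true
∧-true {true} e = refl , e

foldr-∧⇒ : {A : Set} (p : A → Bool) (xs : List A) → foldr _∧_ true (map p xs) ≡ true → ∀ {x} → x ∈ xs → p x ≡ true
foldr-∧⇒ p (x ∷ xs) e (here refl) = proj₁ (∧-true {p x} e)
foldr-∧⇒ p (x ∷ xs) e (there i) = foldr-∧⇒ p xs (proj₂ (∧-true {p x} e)) i

foldr-∧⇐ : {A : Set} (p : A → Bool) (xs : List A) → (∀ {x} → x ∈ xs → p x ≡ true) → foldr _∧_ true (map p xs) ≡ true
foldr-∧⇐ p [] h = refl
foldr-∧⇐ p (x ∷ xs) h rewrite h {x} (here refl) = foldr-∧⇐ p xs (h ∘ there)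

Inj : {A B : Set} → (A → B) → Set
Inj f = ∀ i j → f i ≡ f j → i ≡ j

isBij⇒Inj : {n : ℕ} (f : Pt n) → isBij f ≡ true → Inj f
isBij⇒Inj f e i j fi≡fj
  with foldr-∧⇒ _ (allFin _) (foldr-∧⇒ _ (allFin _) e (∈-allFin i)) (∈-allFin j)
... | r with i ≟ j | f i ≟ f j
...   | yes i≡j | _ = i≡j
...   | no _ | no ne = contradiction fi≡fj ne
isBij⇒Inj f e i j fi≡fj | () | no _ | yes _

Inj⇒isBij : {n : ℕ} (f : Pt n) → Inj f → isBij f ≡ true
Inj⇒isBij f inj = foldr-∧⇐ _ (allFin _) (λ {i} _ → foldr-∧⇐ _ (allFin _) (λ {j} _ → entry i j))
  where
  entry : ∀ i j → (if ⌊ i ≟ j ⌋ then true else (if ⌊ f i ≟ f j ⌋ then false else true)) ≡ true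
  entry i j with i ≟ j | f i ≟ f j
  ... | yes _ | _ = refl
  ... | no ne | yes e = contradiction (inj i j e) ne
  ... | no _ | no _ = refl

inj?⇒Inj : {n k : ℕ} (F : Fin n → Bool) (f : Fin k → Fin n) → inj? F f ≡ true → (∀ i → F (f i) ≡ false) × Inj f
inj?⇒Inj {k = zero} F f e = (λ ()) , λ ()
inj?⇒Inj {k = suc k} F f e with F (f zero) in F0
... | false with inj?⇒Inj (f zero ▸ F) (f ∘ suc) e
...   | avoid , inj = avoid′ , inj′
  where
  avoid′ : ∀ i → F (f i) ≡ false
  avoid′ zero = F0
  avoid′ (suc i) with does (f (suc i) ≟ f zero) | avoid i
  ... | false | r = r
  fresh : ∀ i → f (suc i) ≢ f zero
  fresh i q with f (suc i) ≟ f zero | avoid i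
  ... | no ne | _ = ne q
  inj′ : Inj f
  inj′ zero zero q = refl
  inj′ zero (suc j) q = contradiction (sym q) (fresh j)
  inj′ (suc i) zero q = contradiction q (fresh i)
  inj′ (suc i) (suc j) q = cong suc (inj i j q)

Inj⇒inj? : {n k : ℕ} (F : Fin n → Bool) (f : Fin k → Fin n) → (∀ i → F (f i) ≡ false) → Inj f → inj? F f ≡ true
Inj⇒inj? {k = zero} F f avoid inj = refl
Inj⇒inj? {k = suc k} F f avoid inj rewrite avoid zero =
  Inj⇒inj? (f zero ▸ F) (f ∘ suc) avoid′ (λ i j q → Fin.suc-injective (inj (suc i) (suc j) q))
  where
  avoid′ : ∀ i → (f zero ▸ F) (f (suc i)) ≡ false
  avoid′ i with f (suc i) ≟ f zero
  ... | yes q = case inj (suc i) zero q of λ ()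
  ... | no _ = avoid (suc i)

isBij≡inj? : {n : ℕ} (f : Pt n) → isBij f ≡ inj? ∅ f
isBij≡inj? f = true-iff
  (λ e → Inj⇒inj? ∅ f (λ _ → refl) (isBij⇒Inj f e))
  (λ e → Inj⇒isBij f (proj₂ (inj?⇒Inj ∅ f e)))

1S≡ : {n : ℕ} (f : Pt n) → 1S f ≡ ℕtoℚ (𝟙 (inj? ∅ f))
1S≡ f rewrite isBij≡inj? f with inj? ∅ f
... | true = refl
... | false = refl

length-allPts : ∀ n → length (allPts n) ≡ n ^ n
length-allPts n = trans (length-allFuns (allFin n) n) (cong (_^ n) (length-allFin n))

-- This is nⁿ times the value of Q_B 1_S at a point that is injective on a set B of size b: the
-- remaining coordinates complete it to a bijection in (n - b)! of n^(n - b) ways.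
coef : ℕ → ℕ → ℕ
coef n b = n ^ b * (n ∸ b) !

Q-1S : {n : ℕ} (B : Subset n) (x : Pt n) → Q B 1S x ℚ.* ℕtoℚ (n ^ n) ≡ ℕtoℚ (𝟙 (injOn ∅ B x) * coef n ∣ B ∣)
Q-1S {n} B x = begin
  Q B 1S x ℚ.* ℕtoℚ (n ^ n)
    ≡⟨ cong (λ l → Q B 1S x ℚ.* ℕtoℚ l) (sym (trans (List.length-map _ (allPts n)) (length-allPts n))) ⟩
  avg qs ℚ.* ℕtoℚ (length qs)
    ≡⟨ avg-length qs ⟩
  sumℚ qs
    ≡⟨ sym (ℚ.*-identityʳ _) ⟩
  sumℚ qs ℚ.* ℚ.1ℚ
    ≡⟨ sumℚ-scaleℕ ℚ.1ℚ (λ y → 1S (mix B x y)) (λ y → 𝟙 (inj? ∅ (mixₖ B x y))) (allPts n)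
         (λ {y} _ → trans (ℚ.*-identityʳ _) (1S≡ (mix B x y))) ⟩
  ℕtoℚ (∑ (allPts n) (λ y → 𝟙 (inj? ∅ (mixₖ B x y))))
    ≡⟨ cong ℕtoℚ (∑-inj?-mix ∅ B x) ⟩
  ℕtoℚ (𝟙 (injOn ∅ B x) * (n ^ ∣ B ∣ * falling (free# {n} ∅ ∸ ∣ B ∣) (n ∸ ∣ B ∣)))
    ≡⟨ cong (λ u → ℕtoℚ (𝟙 (injOn ∅ B x) * (n ^ ∣ B ∣ * falling (u ∸ ∣ B ∣) (n ∸ ∣ B ∣)))) (free#-∅ {n}) ⟩
  ℕtoℚ (𝟙 (injOn ∅ B x) * (n ^ ∣ B ∣ * falling (n ∸ ∣ B ∣) (n ∸ ∣ B ∣)))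
    ≡⟨ cong (λ u → ℕtoℚ (𝟙 (injOn ∅ B x) * (n ^ ∣ B ∣ * u))) (falling-self (n ∸ ∣ B ∣)) ⟩
  ℕtoℚ (𝟙 (injOn ∅ B x) * coef n ∣ B ∣) ∎
  where
  open ≡-Reasoning
  qs = map (λ y → 1S (mix B x y)) (allPts n)

els : {k : ℕ} → Subset k → List (Fin k)
els [] = []
els (true ∷ A) = zero ∷ map suc (els A)
els (false ∷ A) = map suc (els A)

-- For the word vs of the values of x on A, this is the alternating sum of f(|B|) over those B ⊆ A
-- on which x is injective and avoids F. A letter is either taken, which blocks its value and shifts
-- f, or skipped, which costs a sign.
G : {n : ℕ} → List (Fin n) → (Fin n → Bool) → (ℕ → ℤ) → ℤ
G [] F f = f 0
G (v ∷ vs) F f = (if F v then ℤ.0ℤ else G vs (v ▸ F) (f ∘ suc)) ℤ.- G vs F f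

sgn : ℕ → ℤ
sgn zero = ℤ.1ℤ
sgn (suc k) = ℤ.- sgn k

sign≡ι-sgn : ∀ k → sign k ≡ ι (sgn k)
sign≡ι-sgn zero = refl
sign≡ι-sgn (suc k) = trans (cong ℚ.-_ (sign≡ι-sgn k)) (ι-neg (sgn k))

∑ℤ-cong : {A : Set} {f g : A → ℤ} (xs : List A) → (∀ x → f x ≡ g x) → ∑ℤ xs f ≡ ∑ℤ xs g
∑ℤ-cong [] e = refl
∑ℤ-cong (x ∷ xs) e = cong₂ ℤ._+_ (e x) (∑ℤ-cong xs e)

∑ℤ-0 : {A : Set} (xs : List A) → ∑ℤ xs (λ _ → ℤ.0ℤ) ≡ ℤ.0ℤ
∑ℤ-0 [] = refl
∑ℤ-0 (x ∷ xs) = trans (ℤ.+-identityˡ _) (∑ℤ-0 xs)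

∑ℤ-neg : {A : Set} (f : A → ℤ) (xs : List A) → ∑ℤ xs (λ x → ℤ.- f x) ≡ ℤ.- ∑ℤ xs f
∑ℤ-neg f [] = refl
∑ℤ-neg f (x ∷ xs) = trans (cong (λ u → ℤ.- f x ℤ.+ u) (∑ℤ-neg f xs)) (sym (ℤ.neg-distrib-+ (f x) _))

∑ℤ-⊆? : {k : ℕ} (A : Subset k) (h : Subset k → ℤ) (Bs : List (Subset k)) →
  ∑ℤ (filter (_⊆? A) Bs) h ≡ ∑ℤ Bs (λ B → if does (B ⊆? A) then h B else ℤ.0ℤ)
∑ℤ-⊆? A h [] = refl
∑ℤ-⊆? A h (B ∷ Bs) with does (B ⊆? A)
... | true = cong (λ u → h B ℤ.+ u) (∑ℤ-⊆? A h Bs)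
... | false = trans (∑ℤ-⊆? A h Bs) (sym (ℤ.+-identityˡ _))

∑ℤ-allSubsets-suc : {k : ℕ} (h : Subset (suc k) → ℤ) →
  ∑ℤ (allSubsets (suc k)) h ≡ ∑ℤ (allSubsets k) (λ s → h (true ∷ s)) ℤ.+ ∑ℤ (allSubsets k) (λ s → h (false ∷ s))
∑ℤ-allSubsets-suc {k} h = go (allSubsets k)
  where
  interchange : ∀ a b c d → a ℤ.+ (b ℤ.+ (c ℤ.+ d)) ≡ (a ℤ.+ c) ℤ.+ (b ℤ.+ d)
  interchange = ℤR.solve-∀
  go : (ss : List (Subset k)) → ∑ℤ (concatMap (λ s → (true ∷ s) ∷ (false ∷ s) ∷ []) ss) h
    ≡ ∑ℤ ss (λ s → h (true ∷ s)) ℤ.+ ∑ℤ ss (λ s → h (false ∷ s))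
  go [] = refl
  go (s ∷ ss) rewrite go ss =
    interchange (h (true ∷ s)) (h (false ∷ s)) (∑ℤ ss (λ s → h (true ∷ s))) (∑ℤ ss (λ s → h (false ∷ s)))

term : {n k : ℕ} → Subset k → (Fin n → Bool) → (Fin k → Fin n) → (ℕ → ℤ) → Subset k → ℤ
term A F x f B = sgn (∣ A ∣ ∸ ∣ B ∣) ℤ.* (if injOn F B x then f ∣ B ∣ else ℤ.0ℤ)

guarded : {n k : ℕ} → Subset k → (Fin n → Bool) → (Fin k → Fin n) → (ℕ → ℤ) → Subset k → ℤ
guarded A F x f B = if does (B ⊆? A) then term A F x f B else ℤ.0ℤ

∑-guarded : {n k : ℕ} (A : Subset k) (F : Fin n → Bool) (x : Fin k → Fin n) (f : ℕ → ℤ) →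
  ∑ℤ (allSubsets k) (guarded A F x f) ≡ G (map x (els A)) F f
∑-guarded [] F x f = trans (ℤ.+-identityʳ _) (ℤ.*-identityˡ (f 0))
∑-guarded {k = suc k} (false ∷ A) F x f = begin
  ∑ℤ (allSubsets (suc k)) (guarded (false ∷ A) F x f)
    ≡⟨ ∑ℤ-allSubsets-suc (guarded (false ∷ A) F x f) ⟩
  ∑ℤ (allSubsets k) (λ _ → ℤ.0ℤ) ℤ.+ ∑ℤ (allSubsets k) (λ s → guarded (false ∷ A) F x f (false ∷ s))
    ≡⟨ cong₂ ℤ._+_ (∑ℤ-0 (allSubsets k)) refl ⟩
  ℤ.0ℤ ℤ.+ ∑ℤ (allSubsets k) (guarded A F (x ∘ suc) f)
    ≡⟨ ℤ.+-identityˡ _ ⟩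
  ∑ℤ (allSubsets k) (guarded A F (x ∘ suc) f)
    ≡⟨ ∑-guarded A F (x ∘ suc) f ⟩
  G (map (x ∘ suc) (els A)) F f
    ≡⟨ cong (λ vs → G vs F f) (List.map-∘ (els A)) ⟩
  G (map x (map suc (els A))) F f ∎
  where open ≡-Reasoning
∑-guarded {k = suc k} (true ∷ A) F x f = begin
  ∑ℤ (allSubsets (suc k)) (guarded (true ∷ A) F x f)
    ≡⟨ ∑ℤ-allSubsets-suc (guarded (true ∷ A) F x f) ⟩
  ∑ℤ (allSubsets k) (λ s → guarded (true ∷ A) F x f (true ∷ s)) ℤ.+ ∑ℤ (allSubsets k) (λ s → guarded (true ∷ A) F x f (false ∷ s))
    ≡⟨ cong₂ ℤ._+_ taken skipped ⟩
  (if F (x zero) then ℤ.0ℤ else G (map (x ∘ suc) (els A)) (x zero ▸ F) (f ∘ suc)) ℤ.- G (map (x ∘ suc) (els A)) F f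
    ≡⟨ cong (λ vs → (if F (x zero) then ℤ.0ℤ else G vs (x zero ▸ F) (f ∘ suc)) ℤ.- G vs F f) (List.map-∘ (els A)) ⟩
  G (map x (els (true ∷ A))) F f ∎
  where
  open ≡-Reasoning
  taken : ∑ℤ (allSubsets k) (λ s → guarded (true ∷ A) F x f (true ∷ s))
    ≡ (if F (x zero) then ℤ.0ℤ else G (map (x ∘ suc) (els A)) (x zero ▸ F) (f ∘ suc))
  taken with F (x zero)
  ... | true = trans (∑ℤ-cong (allSubsets k) vanish) (∑ℤ-0 (allSubsets k))
    where
    vanish : ∀ s → (if does (s ⊆? A) then sgn (∣ A ∣ ∸ ∣ s ∣) ℤ.* ℤ.0ℤ else ℤ.0ℤ) ≡ ℤ.0ℤ
    vanish s with does (s ⊆? A)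
    ... | true = ℤ.*-zeroʳ (sgn (∣ A ∣ ∸ ∣ s ∣))
    ... | false = refl
  ... | false = ∑-guarded A (x zero ▸ F) (x ∘ suc) (f ∘ suc)
  -- Truncated subtraction gains exactly one sign here because `s ⊆ A` bounds the size of s by that
  -- of A.
  flip : ∀ s → guarded (true ∷ A) F x f (false ∷ s) ≡ ℤ.- guarded A F (x ∘ suc) f s
  flip s with s ⊆? A
  ... | no _ = refl
  ... | yes s⊆A rewrite ℕ.+-∸-assoc 1 (p⊆q⇒∣p∣≤∣q∣ s⊆A) = sym (ℤ.neg-distribˡ-* (sgn (∣ A ∣ ∸ ∣ s ∣)) _)
  skipped : ∑ℤ (allSubsets k) (λ s → guarded (true ∷ A) F x f (false ∷ s)) ≡ ℤ.- G (map (x ∘ suc) (els A)) F f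
  skipped = trans (∑ℤ-cong (allSubsets k) flip)
    (trans (∑ℤ-neg _ (allSubsets k)) (cong ℤ.-_ (∑-guarded A F (x ∘ suc) f)))

P-1S : {n : ℕ} (A : Subset n) (x : Pt n) → P A 1S x ℚ.* ℕtoℚ (n ^ n) ≡ ι (G (map x (els A)) ∅ (pos ∘ coef n))
P-1S {n} A x = begin
  P A 1S x ℚ.* ℕtoℚ (n ^ n)
    ≡⟨ sumℚ-scale (ℕtoℚ (n ^ n)) _ (term A ∅ x (pos ∘ coef n)) (filter (_⊆? A) (allSubsets n)) (λ {B} _ → one-term B) ⟩
  ι (∑ℤ (filter (_⊆? A) (allSubsets n)) (term A ∅ x (pos ∘ coef n)))
    ≡⟨ cong ι (trans (∑ℤ-⊆? A _ (allSubsets n)) (∑-guarded A ∅ x (pos ∘ coef n))) ⟩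
  ι (G (map x (els A)) ∅ (pos ∘ coef n)) ∎
  where
  open ≡-Reasoning
  indicator : ∀ b c → pos (𝟙 b * c) ≡ (if b then pos c else ℤ.0ℤ)
  indicator true c = cong pos (ℕ.+-identityʳ c)
  indicator false c = refl
  one-term : ∀ B → (sign (∣ A ∣ ∸ ∣ B ∣) ℚ.* Q B 1S x) ℚ.* ℕtoℚ (n ^ n) ≡ ι (term A ∅ x (pos ∘ coef n) B)
  one-term B = begin
    (sign (∣ A ∣ ∸ ∣ B ∣) ℚ.* Q B 1S x) ℚ.* ℕtoℚ (n ^ n)
      ≡⟨ ℚ.*-assoc (sign (∣ A ∣ ∸ ∣ B ∣)) _ _ ⟩
    sign (∣ A ∣ ∸ ∣ B ∣) ℚ.* (Q B 1S x ℚ.* ℕtoℚ (n ^ n))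
      ≡⟨ cong₂ ℚ._*_ (sign≡ι-sgn (∣ A ∣ ∸ ∣ B ∣)) (Q-1S B x) ⟩
    ι (sgn (∣ A ∣ ∸ ∣ B ∣)) ℚ.* ι (pos (𝟙 (injOn ∅ B x) * coef n ∣ B ∣))
      ≡⟨ ι-* (sgn (∣ A ∣ ∸ ∣ B ∣)) _ ⟩
    ι (sgn (∣ A ∣ ∸ ∣ B ∣) ℤ.* pos (𝟙 (injOn ∅ B x) * coef n ∣ B ∣))
      ≡⟨ cong (λ u → ι (sgn (∣ A ∣ ∸ ∣ B ∣) ℤ.* u)) (indicator (injOn ∅ B x) (coef n ∣ B ∣)) ⟩
    ι (term A ∅ x (pos ∘ coef n) B) ∎

g : {n : ℕ} → Subset n → Pt n → ℕ
g {n} A x = ℤ.∣ G (map x (els A)) ∅ (pos ∘ coef n) ∣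

absP-1S : {n : ℕ} (A : Subset n) (x : Pt n) → absF (P A 1S) x ℚ.* ℕtoℚ (n ^ n) ≡ ℕtoℚ (g A x)
absP-1S {n} A x = begin
  ℚ.∣ P A 1S x ∣ ℚ.* ℕtoℚ (n ^ n)           ≡⟨ cong (ℚ.∣ P A 1S x ∣ ℚ.*_) (sym (ι-∣∣ (pos (n ^ n)))) ⟩
  ℚ.∣ P A 1S x ∣ ℚ.* ℚ.∣ ℕtoℚ (n ^ n) ∣     ≡⟨ sym (ℚ.∣p*q∣≡∣p∣*∣q∣ (P A 1S x) (ℕtoℚ (n ^ n))) ⟩
  ℚ.∣ P A 1S x ℚ.* ℕtoℚ (n ^ n) ∣           ≡⟨ cong ℚ.∣_∣ (P-1S A x) ⟩
  ℚ.∣ ι (G (map x (els A)) ∅ (pos ∘ coef n)) ∣ ≡⟨ ι-∣∣ (G (map x (els A)) ∅ (pos ∘ coef n)) ⟩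
  ℕtoℚ (g A x)                               ∎
  where open ≡-Reasoning

g³ : {n : ℕ} → Subset n → Pt n × Pt n × Pt n → ℕ
g³ A (x , y , z) = g A x * g A y * g A z

Λ-g³ : {n : ℕ} (ℒ : LatinSquare n) (A : Subset n) →
  Λ ℒ (absF (P A 1S)) (absF (P A 1S)) (absF (P A 1S)) ℚ.* (ℕtoℚ (length (Ln ℒ)) ℚ.* (ℕtoℚ (n ^ n) ℚ.* (ℕtoℚ (n ^ n) ℚ.* ℕtoℚ (n ^ n))))
    ≡ ℕtoℚ (∑ (Ln ℒ) (g³ A))
Λ-g³ {n} ℒ A = begin
  Λ ℒ f f f ℚ.* (ℕtoℚ (length (Ln ℒ)) ℚ.* N³)           ≡⟨ sym (ℚ.*-assoc (Λ ℒ f f f) _ _) ⟩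
  Λ ℒ f f f ℚ.* ℕtoℚ (length (Ln ℒ)) ℚ.* N³             ≡⟨ cong (λ l → Λ ℒ f f f ℚ.* ℕtoℚ l ℚ.* N³) (sym (List.length-map _ (Ln ℒ))) ⟩
  Λ ℒ f f f ℚ.* ℕtoℚ (length (map _ (Ln ℒ))) ℚ.* N³     ≡⟨ cong (ℚ._* N³) (avg-length (map _ (Ln ℒ))) ⟩
  sumℚ (map _ (Ln ℒ)) ℚ.* N³                            ≡⟨ sumℚ-scaleℕ N³ _ (g³ A) (Ln ℒ) (λ { {x , y , z} _ → product x y z }) ⟩
  ℕtoℚ (∑ (Ln ℒ) (g³ A))                                ∎
  where
  open ≡-Reasoning
  f = absF (P A 1S)
  N = ℕtoℚ (n ^ n)
  N³ = N ℚ.* (N ℚ.* N)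
  regroup : ∀ a b c N → (a ℚ.* b ℚ.* c) ℚ.* (N ℚ.* (N ℚ.* N)) ≡ (a ℚ.* N) ℚ.* (b ℚ.* N) ℚ.* (c ℚ.* N)
  regroup = +-*-Solver.solve 4 (λ a b c N → (a :* b :* c) :* (N :* (N :* N)) := (a :* N) :* (b :* N) :* (c :* N)) refl
    where open +-*-Solver
  product : ∀ x y z → (f x ℚ.* f y ℚ.* f z) ℚ.* N³ ≡ ℕtoℚ (g A x * g A y * g A z)
  product x y z = begin
    (f x ℚ.* f y ℚ.* f z) ℚ.* N³                          ≡⟨ regroup (f x) (f y) (f z) N ⟩
    (f x ℚ.* N) ℚ.* (f y ℚ.* N) ℚ.* (f z ℚ.* N)           ≡⟨ cong₂ ℚ._*_ (cong₂ ℚ._*_ (absP-1S A x) (absP-1S A y)) (absP-1S A z) ⟩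
    ℕtoℚ (g A x) ℚ.* ℕtoℚ (g A y) ℚ.* ℕtoℚ (g A z)        ≡⟨ cong (ℚ._* ℕtoℚ (g A z)) (ℕtoℚ-* (g A x) (g A y)) ⟩
    ℕtoℚ (g A x * g A y) ℚ.* ℕtoℚ (g A z)                 ≡⟨ ℕtoℚ-* (g A x * g A y) (g A z) ⟩
    ℕtoℚ (g A x * g A y * g A z)                          ∎

sumA : {n : ℕ} → LatinSquare n → ℕ → ℕ
sumA {n} ℒ m = ∑ (filter (λ A → ∣ A ∣ ℕ.≟ m) (allSubsets n)) (λ A → ∑ (Ln ℒ) (g³ A))

denom : {n : ℕ} → LatinSquare n → ℕ
denom {n} ℒ = length (Ln ℒ) * (n ^ n * (n ^ n * n ^ n))

LHS-exact : {n : ℕ} (ℒ : LatinSquare n) (m : ℕ) → LHS ℒ m ℚ.* ℕtoℚ (denom ℒ) ≡ ℕtoℚ (sumA ℒ m)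
LHS-exact {n} ℒ m = sumℚ-scaleℕ (ℕtoℚ (denom ℒ)) _ _ (filter (λ A → ∣ A ∣ ℕ.≟ m) (allSubsets n)) (λ {A} _ →
  trans (cong (Λ ℒ (absF (P A 1S)) (absF (P A 1S)) (absF (P A 1S)) ℚ.*_) split) (Λ-g³ ℒ A))
  where
  split : ℕtoℚ (denom ℒ) ≡ ℕtoℚ (length (Ln ℒ)) ℚ.* (ℕtoℚ (n ^ n) ℚ.* (ℕtoℚ (n ^ n) ℚ.* ℕtoℚ (n ^ n)))
  split = sym (trans (cong (λ u → ℕtoℚ (length (Ln ℒ)) ℚ.* u) (trans (cong (ℕtoℚ (n ^ n) ℚ.*_) (ℕtoℚ-* (n ^ n) (n ^ n))) (ℕtoℚ-* (n ^ n) (n ^ n * n ^ n))))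
    (ℕtoℚ-* (length (Ln ℒ)) _))

-- Pointwise bound on P_A 1_S

Δ : (ℕ → ℤ) → ℕ → ℤ
Δ f b = f (suc b) ℤ.- f b

Δ^ : ℕ → (ℕ → ℤ) → ℕ → ℤ
Δ^ zero f = f
Δ^ (suc s) f = Δ^ s (Δ f)

Δ^-shift : ∀ s f r → Δ^ s (f ∘ suc) r ≡ Δ^ s f (suc r)
Δ^-shift zero f r = refl
Δ^-shift (suc s) f r = Δ^-shift s (Δ f) r

Δ^-suc : ∀ s f r → Δ^ (suc s) f r ≡ Δ^ s f (suc r) ℤ.- Δ^ s f r
Δ^-suc zero f r = refl
Δ^-suc (suc s) f r = Δ^-suc s (Δ f) r

G-cong : {n : ℕ} {F F′ : Fin n → Bool} {f : ℕ → ℤ} (vs : List (Fin n)) →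
  (∀ {v} → v ∈ vs → F v ≡ F′ v) → G vs F f ≡ G vs F′ f
G-cong [] e = refl
G-cong {F = F} {F′} {f} (v ∷ vs) e rewrite e (here refl) =
  cong₂ (λ a b → (if F′ v then ℤ.0ℤ else a) ℤ.- b)
    (G-cong vs (λ {w} i → cong (does (w ≟ v) ∨_) (e (there i)))) (G-cong vs (e ∘ there))

-- `G` is linear in f. For a letter that occurs nowhere else, taking and skipping differ only by the
-- shift of f, so such a letter merely replaces f by `Δ f`.
G-Δ : {n : ℕ} (vs : List (Fin n)) (F : Fin n → Bool) (f : ℕ → ℤ) →
  G vs F (f ∘ suc) ℤ.- G vs F f ≡ G vs F (Δ f)
G-Δ [] F f = refl
G-Δ (v ∷ vs) F f rewrite sym (G-Δ vs F f) | sym (G-Δ vs (v ▸ F) (f ∘ suc)) with F v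
... | true = interchange₁ (G vs F (f ∘ suc)) (G vs F f)
  where
  interchange₁ : ∀ b d → (ℤ.0ℤ ℤ.- b) ℤ.- (ℤ.0ℤ ℤ.- d) ≡ ℤ.0ℤ ℤ.- (b ℤ.- d)
  interchange₁ = ℤR.solve-∀
... | false = interchange₂ (G vs (v ▸ F) (λ b → f (suc (suc b)))) (G vs F (f ∘ suc)) (G vs (v ▸ F) (f ∘ suc)) (G vs F f)
  where
  interchange₂ : ∀ a b c d → (a ℤ.- b) ℤ.- (c ℤ.- d) ≡ (a ℤ.- c) ℤ.- (b ℤ.- d)
  interchange₂ = ℤR.solve-∀

cnt : {n : ℕ} → Fin n → List (Fin n) → ℕ
cnt v vs = ∑ vs (λ w → 𝟙 (does (w ≟ v)))

cnt≡0 : {n : ℕ} {v w : Fin n} {vs : List (Fin n)} → cnt v vs ≡ 0 → w ∈ vs → w ≢ v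
cnt≡0 {v = v} {vs = vs} c i refl = case subst (1 ≤_) c (ℕ.≤-trans self (∑-∈ i)) of λ ()
  where
  self : 1 ≤ 𝟙 (does (v ≟ v))
  self rewrite dec-true (v ≟ v) refl = s≤s z≤n

cnt-head : {n : ℕ} (v : Fin n) (vs : List (Fin n)) → cnt v (v ∷ vs) ≡ suc (cnt v vs)
cnt-head v vs rewrite dec-true (v ≟ v) refl = refl

▸-other : {n : ℕ} {v w : Fin n} (F : Fin n → Bool) → w ≢ v → (v ▸ F) w ≡ F w
▸-other {v = v} {w} F ne rewrite dec-false (w ≟ v) ne = refl

-- The predicate R marks the values that occur repeatedly in the whole word: an unmarked letter
-- turns f into Δ f, a marked one splits the sum in two.
G-bound : {n : ℕ} (R : Fin n → Bool) (vs : List (Fin n)) (F : Fin n → Bool) (f : ℕ → ℤ) (c M : ℕ) →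
  (∀ v → R v ≡ false → cnt v vs + 𝟙 (F v) ≤ 1) →
  (∀ r → r ≤ ∑ vs (𝟙 ∘ R) → c * ℤ.∣ Δ^ (∑ vs (𝟙 ∘ not ∘ R)) f r ∣ ≤ M) →
  c * ℤ.∣ G vs F f ∣ ≤ 2 ^ ∑ vs (𝟙 ∘ R) * M
G-bound R [] F f c M inv h = subst (c * ℤ.∣ f 0 ∣ ≤_) (sym (ℕ.+-identityʳ M)) (h 0 z≤n)
G-bound R (v ∷ vs) F f c M inv h with R v in Rv
-- The letter v itself exhausts the bound 1 of the invariant, so it is neither blocked by F nor
-- present in vs, and blocking it has no effect on vs.
... | false with F v | subst (λ k → k + 𝟙 (F v) ≤ 1) (cnt-head v vs) (inv v Rv)
...   | true | s≤s p = contradiction (ℕ.≤-trans (ℕ.m≤n+m 1 (cnt v vs)) p) λ ()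
...   | false | s≤s p = subst (λ z → c * ℤ.∣ z ∣ ≤ 2 ^ ∑ vs (𝟙 ∘ R) * M) (sym step)
    (G-bound R vs F (Δ f) c M inv′ h)
  where
  v∉vs : cnt v vs ≡ 0
  v∉vs = ℕ.n≤0⇒n≡0 (ℕ.≤-trans (ℕ.m≤m+n _ 0) p)
  step : G vs (v ▸ F) (f ∘ suc) ℤ.- G vs F f ≡ G vs F (Δ f)
  step = trans (cong (λ z → z ℤ.- G vs F f) (G-cong vs (λ i → ▸-other F (cnt≡0 {vs = vs} v∉vs i)))) (G-Δ vs F f)
  inv′ : ∀ w → R w ≡ false → cnt w vs + 𝟙 (F w) ≤ 1
  inv′ w Rw = ℕ.≤-trans (ℕ.+-monoˡ-≤ (𝟙 (F w)) (ℕ.m≤n+m (cnt w vs) _)) (inv w Rw)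
G-bound R (v ∷ vs) F f c M inv h | true = begin
  c * ℤ.∣ taken ℤ.- G vs F f ∣                     ≤⟨ ℕ.*-monoʳ-≤ c (ℤ.∣i-j∣≤∣i∣+∣j∣ taken (G vs F f)) ⟩
  c * (ℤ.∣ taken ∣ + ℤ.∣ G vs F f ∣)               ≡⟨ ℕ.*-distribˡ-+ c ℤ.∣ taken ∣ _ ⟩
  c * ℤ.∣ taken ∣ + c * ℤ.∣ G vs F f ∣             ≤⟨ ℕ.+-mono-≤ takenBound (G-bound R vs F f c M inv′ (λ r r≤ → h r (ℕ.m≤n⇒m≤1+n r≤))) ⟩
  2 ^ u * M + 2 ^ u * M                            ≡⟨ double (2 ^ u) M ⟩
  2 * 2 ^ u * M                                    ∎
  where
  open ℕ.≤-Reasoning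
  u = ∑ vs (𝟙 ∘ R)
  taken = if F v then ℤ.0ℤ else G vs (v ▸ F) (f ∘ suc)
  double : ∀ a b → a * b + a * b ≡ 2 * a * b
  double = solve-∀
  inv′ : ∀ w → R w ≡ false → cnt w vs + 𝟙 (F w) ≤ 1
  inv′ w Rw = ℕ.≤-trans (ℕ.+-monoˡ-≤ (𝟙 (F w)) (ℕ.m≤n+m (cnt w vs) _)) (inv w Rw)
  inv″ : ∀ w → R w ≡ false → cnt w vs + 𝟙 ((v ▸ F) w) ≤ 1
  inv″ w Rw = subst (λ b → cnt w vs + 𝟙 b ≤ 1) (sym (▸-other F w≢v)) (inv′ w Rw)
    where
    w≢v : w ≢ v
    w≢v refl = case trans (sym Rv) Rw of λ ()
  takenBound : c * ℤ.∣ taken ∣ ≤ 2 ^ u * M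
  takenBound with F v
  ... | true = subst (_≤ 2 ^ u * M) (sym (ℕ.*-zeroʳ c)) z≤n
  -- Taking a marked letter shifts f by one; the variable r in the hypothesis counts the marked
  -- letters taken.
  ... | false = G-bound R vs (v ▸ F) (f ∘ suc) c M inv″
    (λ r r≤ → subst (λ z → c * ℤ.∣ z ∣ ≤ M) (sym (Δ^-shift (∑ vs (𝟙 ∘ not ∘ R)) f r)) (h (suc r) (s≤s r≤)))

-- This is (n - r) a(r+1) = n a(r) for a = `coef n`, a form of (n - r)! = (n - r) (n - r - 1)!, with
-- the subtraction moved to the other side.
coef-rec : ∀ n r → r < n → n * coef n r + r * coef n (suc r) ≡ n * coef n (suc r)
coef-rec n r r<n = begin
  n * (n ^ r * (n ∸ r) !) + r * (n * n ^ r * q !)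
    ≡⟨ cong (λ k → n * (n ^ r * k !) + r * (n * n ^ r * q !)) n∸r ⟩
  n * (n ^ r * (suc q * q !)) + r * (n * n ^ r * q !)
    ≡⟨ collect n (n ^ r) q (q !) r ⟩
  (suc q + r) * (n * n ^ r * q !)
    ≡⟨ cong (_* (n * n ^ r * q !)) (trans (cong (_+ r) (sym n∸r)) (ℕ.m∸n+n≡m (ℕ.<⇒≤ r<n))) ⟩
  n * coef n (suc r) ∎
  where
  open ≡-Reasoning
  q = n ∸ suc r
  n∸r : n ∸ r ≡ suc q
  n∸r = ℕ.+-∸-assoc 1 r<n
  collect : ∀ n p q f r → n * (p * (suc q * f)) + r * (n * p * f) ≡ (suc q + r) * (n * p * f)
  collect = solve-∀

module _ (n : ℕ) where

  private
    a : ℕ → ℤ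
    a = pos ∘ coef n

    d : ℕ → ℕ → ℤ
    d s r = Δ^ s a r

  -- For s = 0 this is `coef-rec`. Taking the difference of the instances at r + 1 and r, the factor
  -- r obeys the Leibniz rule and leaves one extra d(s, r+2), which raises the coefficient s by one.
  -- At s = 0 the truncated index has coefficient 0.
  d-rec : ∀ s r → r + s < n → pos n ℤ.* d (suc s) r ≡ pos r ℤ.* d s (suc r) ℤ.+ pos s ℤ.* d (s ∸ 1) (suc (suc r))
  d-rec zero r r<n = begin
    pos n ℤ.* (a (suc r) ℤ.- a r)                                          ≡⟨ isolate (pos n) (a (suc r)) (a r) (pos r) ⟩
    pos n ℤ.* a (suc r) ℤ.- (pos n ℤ.* a r ℤ.+ pos r ℤ.* a (suc r)) ℤ.+ pos r ℤ.* a (suc r)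
      ≡⟨ cong (λ z → pos n ℤ.* a (suc r) ℤ.- z ℤ.+ pos r ℤ.* a (suc r)) base ⟩
    pos n ℤ.* a (suc r) ℤ.- pos n ℤ.* a (suc r) ℤ.+ pos r ℤ.* a (suc r)    ≡⟨ cancel (pos n ℤ.* a (suc r)) (pos r) (a (suc r)) (a (suc (suc r))) ⟩
    pos r ℤ.* a (suc r) ℤ.+ pos 0 ℤ.* a (suc (suc r))                      ∎
    where
    open ≡-Reasoning
    isolate : ∀ n x y r → n ℤ.* (x ℤ.- y) ≡ n ℤ.* x ℤ.- (n ℤ.* y ℤ.+ r ℤ.* x) ℤ.+ r ℤ.* x
    isolate = ℤR.solve-∀
    cancel : ∀ p r x y → p ℤ.- p ℤ.+ r ℤ.* x ≡ r ℤ.* x ℤ.+ ℤ.0ℤ ℤ.* y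
    cancel = ℤR.solve-∀
    base : pos n ℤ.* a r ℤ.+ pos r ℤ.* a (suc r) ≡ pos n ℤ.* a (suc r)
    base = begin
      pos n ℤ.* a r ℤ.+ pos r ℤ.* a (suc r)
        ≡⟨ sym (cong₂ ℤ._+_ (ℤ.pos-* n (coef n r)) (ℤ.pos-* r (coef n (suc r)))) ⟩
      pos (n * coef n r + r * coef n (suc r))
        ≡⟨ cong pos (coef-rec n r (subst (_< n) (ℕ.+-identityʳ r) r<n)) ⟩
      pos (n * coef n (suc r))
        ≡⟨ ℤ.pos-* n (coef n (suc r)) ⟩
      pos n ℤ.* a (suc r) ∎
  d-rec (suc s) r r+s<n = begin
    pos n ℤ.* d (suc (suc s)) r
      ≡⟨ cong (λ z → pos n ℤ.* z) (Δ^-suc (suc s) a r) ⟩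
    pos n ℤ.* (d (suc s) (suc r) ℤ.- d (suc s) r)
      ≡⟨ distrib (pos n) (d (suc s) (suc r)) (d (suc s) r) ⟩
    pos n ℤ.* d (suc s) (suc r) ℤ.- pos n ℤ.* d (suc s) r
      ≡⟨ cong₂ ℤ._-_ (d-rec s (suc r) (subst (_< n) (ℕ.+-suc r s) r+s<n)) (d-rec s r (ℕ.<-trans (ℕ.+-monoʳ-< r (ℕ.n<1+n s)) r+s<n)) ⟩
    (pos (suc r) ℤ.* d s (2 + r) ℤ.+ pos s ℤ.* d (s ∸ 1) (3 + r)) ℤ.- (pos r ℤ.* d s (1 + r) ℤ.+ pos s ℤ.* d (s ∸ 1) (2 + r))
      ≡⟨ regroup (pos r) (pos s) (d s (2 + r)) (d (s ∸ 1) (3 + r)) (d s (1 + r)) (d (s ∸ 1) (2 + r)) ⟩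
    pos r ℤ.* (d s (2 + r) ℤ.- d s (1 + r)) ℤ.+ (d s (2 + r) ℤ.+ pos s ℤ.* (d (s ∸ 1) (3 + r) ℤ.- d (s ∸ 1) (2 + r)))
      ≡⟨ cong₂ (λ z w → pos r ℤ.* z ℤ.+ (d s (2 + r) ℤ.+ w)) (sym (Δ^-suc s a (suc r))) (lower s) ⟩
    pos r ℤ.* d (suc s) (suc r) ℤ.+ (d s (2 + r) ℤ.+ pos s ℤ.* d s (2 + r))
      ≡⟨ cong (λ z → pos r ℤ.* d (suc s) (suc r) ℤ.+ z) (sym (ℤ.suc-* (pos s) (d s (2 + r)))) ⟩
    pos r ℤ.* d (suc s) (suc r) ℤ.+ pos (suc s) ℤ.* d s (2 + r) ∎
    where
    open ≡-Reasoning
    distrib : ∀ n x y → n ℤ.* (x ℤ.- y) ≡ n ℤ.* x ℤ.- n ℤ.* y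
    distrib = ℤR.solve-∀
    regroup : ∀ r s x y z w → ((pos 1 ℤ.+ r) ℤ.* x ℤ.+ s ℤ.* y) ℤ.- (r ℤ.* z ℤ.+ s ℤ.* w)
      ≡ r ℤ.* (x ℤ.- z) ℤ.+ (x ℤ.+ s ℤ.* (y ℤ.- w))
    regroup = ℤR.solve-∀
    lower : ∀ s → pos s ℤ.* (d (s ∸ 1) (3 + r) ℤ.- d (s ∸ 1) (2 + r)) ≡ pos s ℤ.* d s (2 + r)
    lower zero = refl
    lower (suc s) = cong (λ z → pos (suc s) ℤ.* z) (sym (Δ^-suc s a (2 + r)))

  d-rec-abs : ∀ s r → r + s < n → n * ℤ.∣ d (suc s) r ∣ ≤ r * ℤ.∣ d s (suc r) ∣ + s * ℤ.∣ d (s ∸ 1) (2 + r) ∣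
  d-rec-abs s r r+s<n = begin
    n * ℤ.∣ d (suc s) r ∣                             ≡⟨ sym (ℤ.abs-* (pos n) (d (suc s) r)) ⟩
    ℤ.∣ pos n ℤ.* d (suc s) r ∣                       ≡⟨ cong ℤ.∣_∣ (d-rec s r r+s<n) ⟩
    ℤ.∣ x ℤ.+ y ∣                                     ≤⟨ ℤ.∣i+j∣≤∣i∣+∣j∣ x y ⟩
    ℤ.∣ x ∣ + ℤ.∣ y ∣                                 ≡⟨ cong₂ _+_ (ℤ.abs-* (pos r) (d s (suc r))) (ℤ.abs-* (pos s) (d (s ∸ 1) (2 + r))) ⟩
    r * ℤ.∣ d s (suc r) ∣ + s * ℤ.∣ d (s ∸ 1) (2 + r) ∣ ∎
    where
    open ℕ.≤-Reasoning
    x = pos r ℤ.* d s (suc r)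
    y = pos s ℤ.* d (s ∸ 1) (2 + r)

  -- By `coef-rec` the ratio of consecutive values is n / (n - r), which is at most 2 while 2r ≤ n;
  -- the first value is n!.
  coef-bound : ∀ r → 2 * r ≤ n → coef n r ≤ n ! * 2 ^ r
  coef-bound zero _ = ℕ.≤-reflexive (trans (ℕ.+-identityʳ (n !)) (sym (ℕ.*-identityʳ (n !))))
  coef-bound (suc r) 2r≤n = begin
    c′                  ≤⟨ ℕ.*-cancelˡ-≤ n {{ℕ.>-nonZero (ℕ.≤-<-trans z≤n r<n)}} nc′≤ ⟩
    2 * c               ≤⟨ ℕ.*-monoʳ-≤ 2 (coef-bound r (ℕ.≤-trans (ℕ.*-monoʳ-≤ 2 (ℕ.n≤1+n r)) 2r≤n)) ⟩
    2 * (n ! * 2 ^ r)   ≡⟨ swap-mul 2 (n !) (2 ^ r) ⟩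
    n ! * 2 ^ suc r     ∎
    where
    open ℕ.≤-Reasoning
    c = coef n r
    c′ = coef n (suc r)
    swap-mul : ∀ a b c → a * (b * c) ≡ b * (a * c)
    swap-mul = solve-∀
    r<n : r < n
    r<n = ℕ.≤-trans (ℕ.m≤n*m (suc r) 2) 2r≤n
    2nc′ : n * c′ + n * c′ ≤ n * (2 * c) + n * c′
    2nc′ = begin
      n * c′ + n * c′                              ≡⟨ cong (λ z → z + z) (sym (coef-rec n r r<n)) ⟩
      n * c + r * c′ + (n * c + r * c′)            ≡⟨ double n c r c′ ⟩
      n * (2 * c) + 2 * r * c′                     ≤⟨ ℕ.+-monoʳ-≤ (n * (2 * c)) (ℕ.*-monoˡ-≤ c′ (ℕ.≤-trans (ℕ.*-monoʳ-≤ 2 (ℕ.n≤1+n r)) 2r≤n)) ⟩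
      n * (2 * c) + n * c′                         ∎
      where
      double : ∀ n c r c′ → n * c + r * c′ + (n * c + r * c′) ≡ n * (2 * c) + 2 * r * c′
      double = solve-∀
    nc′≤ : n * c′ ≤ n * (2 * c)
    nc′≤ = ℕ.+-cancelʳ-≤ (n * c′) (n * c′) (n * (2 * c)) 2nc′

  -- With θ = t / n the claim is |d(s, r)| ≤ n! 2^(r+s) θˢ. The three index pairs in the recurrence
  -- have the same sum, so the power of 2 is common to all terms, and the induction needs θ m/n +
  -- m/n ≤ θ², which is the hypothesis H. The step to s = 1 has no second term and needs m/n ≤ θ.
  d-bound : ∀ {m t} → 2 * m ≤ n → m ≤ t → m * t + m * n ≤ t * t →
    ∀ s r → r + s ≤ m → n ^ s * ℤ.∣ d s r ∣ ≤ n ! * 2 ^ (r + s) * t ^ s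
  d-bound {m} {t} 2m≤n m≤t H zero r r≤m = begin
    coef n r + 0               ≡⟨ ℕ.+-identityʳ _ ⟩
    coef n r                   ≤⟨ coef-bound r (ℕ.≤-trans (ℕ.*-monoʳ-≤ 2 (ℕ.m+n≤o⇒m≤o r r≤m)) 2m≤n) ⟩
    n ! * 2 ^ r                ≡⟨ cong (λ k → n ! * 2 ^ k) (sym (ℕ.+-identityʳ r)) ⟩
    n ! * 2 ^ (r + 0)          ≡⟨ sym (ℕ.*-identityʳ _) ⟩
    n ! * 2 ^ (r + 0) * 1      ∎
    where open ℕ.≤-Reasoning
  d-bound {m} {t} 2m≤n m≤t H (suc s) r r+s≤m = begin
    n * n ^ s * D                                           ≡⟨ assoc′ n (n ^ s) D ⟩
    n ^ s * (n * D)                                         ≤⟨ ℕ.*-monoʳ-≤ (n ^ s) (d-rec-abs s r r+s<n) ⟩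
    n ^ s * (r * D₁ + s * D₂)                               ≡⟨ split (n ^ s) r D₁ s D₂ ⟩
    r * (n ^ s * D₁) + s * n ^ s * D₂                       ≤⟨ ℕ.+-mono-≤ (ℕ.*-mono-≤ (ℕ.m+n≤o⇒m≤o r r+s≤m) (d-bound 2m≤n m≤t H s (suc r) 1+r+s≤m)) (second s r+s≤m) ⟩
    m * (n ! * 2 ^ (suc r + s) * t ^ s) + rest s            ≤⟨ combine s ⟩
    n ! * 2 ^ (suc r + s) * t ^ suc s                       ≡⟨ cong (λ k → n ! * 2 ^ k * t ^ suc s) (sym (ℕ.+-suc r s)) ⟩
    n ! * 2 ^ (r + suc s) * t ^ suc s                       ∎
    where
    open ℕ.≤-Reasoning
    D = ℤ.∣ d (suc s) r ∣
    D₁ = ℤ.∣ d s (suc r) ∣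
    D₂ = ℤ.∣ d (s ∸ 1) (2 + r) ∣
    1+r+s≤m : suc r + s ≤ m
    1+r+s≤m = subst (_≤ m) (ℕ.+-suc r s) r+s≤m
    r+s<n : r + s < n
    r+s<n = ℕ.≤-trans 1+r+s≤m (ℕ.≤-trans (ℕ.m≤n*m m 2) 2m≤n)
    -- The case distinction keeps the induction hypothesis away from the truncated index s - 1 at s
    -- = 0.
    rest : ℕ → ℕ
    rest zero = 0
    rest (suc s) = m * (n * (n ! * 2 ^ (2 + r + s) * t ^ s))
    assoc′ : ∀ a b c → a * b * c ≡ b * (a * c)
    assoc′ = solve-∀
    split : ∀ p r x s y → p * (r * x + s * y) ≡ r * (p * x) + s * p * y
    split = solve-∀
    second : ∀ s → r + suc s ≤ m → s * n ^ s * ℤ.∣ d (s ∸ 1) (2 + r) ∣ ≤ rest s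
    second zero _ = z≤n
    second (suc s) r+2+s≤m = begin
      suc s * (n * n ^ s) * D′                          ≡⟨ assoc″ (suc s) n (n ^ s) D′ ⟩
      suc s * (n * (n ^ s * D′))                        ≤⟨ ℕ.*-mono-≤ (ℕ.≤-trans (ℕ.n≤1+n (suc s)) (ℕ.m+n≤o⇒n≤o r r+2+s≤m))
                                                            (ℕ.*-monoʳ-≤ n (d-bound 2m≤n m≤t H s (2 + r) (subst (_≤ m) (move r s) r+2+s≤m))) ⟩
      m * (n * (n ! * 2 ^ (2 + r + s) * t ^ s))         ∎
      where
      D′ = ℤ.∣ d s (2 + r) ∣
      assoc″ : ∀ a b c e → a * (b * c) * e ≡ a * (b * (c * e))
      assoc″ = solve-∀
      move : ∀ r s → r + suc (suc s) ≡ 2 + r + s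
      move = solve-∀
    combine : ∀ s → m * (n ! * 2 ^ (suc r + s) * t ^ s) + rest s ≤ n ! * 2 ^ (suc r + s) * t ^ suc s
    combine zero = begin
      m * (N * 1) + 0   ≡⟨ simp m N ⟩
      N * m             ≤⟨ ℕ.*-monoʳ-≤ N m≤t ⟩
      N * t             ≡⟨ cong (N *_) (sym (ℕ.*-identityʳ t)) ⟩
      N * (t * 1)       ∎
      where
      N = n ! * 2 ^ (suc r + 0)
      simp : ∀ m N → m * (N * 1) + 0 ≡ N * m
      simp = solve-∀
    combine (suc s) = begin
      m * (n ! * 2 ^ (suc r + suc s) * (t * t ^ s)) + m * (n * (n ! * 2 ^ (2 + r + s) * t ^ s))
        ≡⟨ cong (λ k → m * (n ! * 2 ^ suc k * (t * t ^ s)) + m * (n * (n ! * 2 ^ (2 + r + s) * t ^ s))) (ℕ.+-suc r s) ⟩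
      m * (N * (t * t ^ s)) + m * (n * (N * t ^ s))   ≡⟨ factor m N t (t ^ s) n ⟩
      N * ((m * t + m * n) * t ^ s)                   ≤⟨ ℕ.*-monoʳ-≤ N (ℕ.*-monoˡ-≤ (t ^ s) H) ⟩
      N * (t * t * t ^ s)                             ≡⟨ cong (N *_) (ℕ.*-assoc t t (t ^ s)) ⟩
      N * (t * (t * t ^ s))
        ≡⟨ cong (λ k → n ! * 2 ^ suc k * (t * (t * t ^ s))) (sym (ℕ.+-suc r s)) ⟩
      n ! * 2 ^ (suc r + suc s) * (t * (t * t ^ s))   ∎
      where
      N = n ! * 2 ^ (2 + r + s)
      factor : ∀ m N t p n → m * (N * (t * p)) + m * (n * (N * p)) ≡ N * ((m * t + m * n) * p)
      factor = solve-∀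

-- Coincidences in a tuple of cells, and codes for tuples

rep : {n : ℕ} → List (Fin n) → Fin n → Bool
rep vs v = does (2 ≤? cnt v vs)

repeats : {n : ℕ} → List (Fin n) → ℕ
repeats vs = ∑ vs (𝟙 ∘ rep vs)

-- The increase of `repeats` when a letter that already occurs c times is added.
δ : ℕ → ℕ
δ 0 = 0
δ 1 = 2
δ (suc (suc _)) = 1

δ≤2 : ∀ c → δ c ≤ 2
δ≤2 0 = z≤n
δ≤2 1 = ℕ.≤-refl
δ≤2 (suc (suc _)) = s≤s z≤n

𝟙≤1 : ∀ b → 𝟙 b ≤ 1
𝟙≤1 true = ℕ.≤-refl
𝟙≤1 false = z≤n

-- A second occurrence makes the earlier copy repeated as well, which explains the value 2; from the
-- third on, only the new letter is added.
repeats-∷ : {n : ℕ} (v : Fin n) (vs : List (Fin n)) → repeats (v ∷ vs) ≤ δ (cnt v vs) + repeats vs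
repeats-∷ v vs with cnt v vs in eq
... | zero rewrite dec-true (v ≟ v) refl = ∑-mono∈ vs stays
  where
  stays : ∀ {w} → w ∈ vs → 𝟙 (rep (v ∷ vs) w) ≤ 𝟙 (rep vs w)
  stays {w} i rewrite dec-false (v ≟ w) (λ q → cnt≡0 {vs = vs} eq i (sym q)) = ℕ.≤-refl
... | suc zero = ℕ.+-mono-≤ (𝟙≤1 _) (begin
  ∑ vs (𝟙 ∘ rep (v ∷ vs))                           ≤⟨ ∑-mono vs grows ⟩
  ∑ vs (λ w → 𝟙 (does (w ≟ v)) + 𝟙 (rep vs w))      ≡⟨ ∑-+ vs ⟩
  cnt v vs + repeats vs                             ≡⟨ cong (_+ repeats vs) eq ⟩
  1 + repeats vs                                    ∎)
  where
  open ℕ.≤-Reasoning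
  grows : ∀ w → 𝟙 (rep (v ∷ vs) w) ≤ 𝟙 (does (w ≟ v)) + 𝟙 (rep vs w)
  grows w with w ≟ v
  ... | yes _ = ℕ.≤-trans (𝟙≤1 (rep (v ∷ vs) w)) (ℕ.m≤m+n 1 _)
  ... | no ne rewrite dec-false (v ≟ w) (ne ∘ sym) = ℕ.≤-refl
... | suc (suc c) = ℕ.+-mono-≤ (𝟙≤1 _) (∑-mono vs stays)
  where
  stays : ∀ w → 𝟙 (rep (v ∷ vs) w) ≤ 𝟙 (rep vs w)
  stays w with v ≟ w
  ... | yes refl rewrite eq = 𝟙≤1 _
  ... | no _ = ℕ.≤-refl

∑-↭ : {A : Set} {f : A → ℕ} {xs ys : List A} → xs ↭ ys → ∑ xs f ≡ ∑ ys f
∑-↭ Perm.refl = refl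
∑-↭ {f = f} (prep x p) = cong (f x +_) (∑-↭ p)
∑-↭ {f = f} (swap {xs} {ys} x y p) rewrite ∑-↭ {f = f} p = swap-add (f x) (f y) (∑ ys f)
  where
  swap-add : ∀ a b c → a + (b + c) ≡ b + (a + c)
  swap-add = solve-∀
∑-↭ (Perm.trans p q) = trans (∑-↭ p) (∑-↭ q)

repeats-↭ : {n : ℕ} {vs ws : List (Fin n)} → vs ↭ ws → repeats vs ≡ repeats ws
repeats-↭ {vs = vs} {ws} p =
  trans (∑-cong vs (λ w → cong (λ k → 𝟙 (does (2 ≤? k))) (∑-↭ p))) (∑-↭ p)

cnt⇒∈ : {n : ℕ} (v : Fin n) (vs : List (Fin n)) → 1 ≤ cnt v vs → v ∈ vs
cnt⇒∈ v (w ∷ vs) h with w ≟ v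
... | yes refl = here refl
... | no _ = there (cnt⇒∈ v vs h)

∈-↭-head : {A : Set} {x : A} {xs : List A} → x ∈ xs → Σ (List A) λ ys → xs ↭ x ∷ ys
∈-↭-head {x = x} i with ys , zs , refl ← ∈-∃++ i = ys ++ zs , Perm.shift x ys zs

Tri : ℕ → Set
Tri n = Fin n × Fin n × Fin n

data Dir : Set where
  X Y Z : Dir

nxt : Dir → Dir
nxt X = Y
nxt Y = Z
nxt Z = X

co : {n : ℕ} → Dir → Tri n → Fin n
co X (x , y , z) = x
co Y (x , y , z) = y
co Z (x , y , z) = z

-- A symbol tells how to find a cell of the latin square from the cells at other positions:
-- `one d j v` takes its d-coordinate from position j, `two d j k` takes the two coordinates
-- other than d from positions j and k, and `same j` copies position j.
data Sym (n : ℕ) : Set where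
  free : (a b : Fin n) → Sym n
  one  : (d : Dir) (j v : Fin n) → Sym n
  two  : (d : Dir) (j k : Fin n) → Sym n
  same : (j : Fin n) → Sym n

-- The credit 2 for a coincidence stands for a factor θ⁻² = n / m; copying a cell is worth
-- two coincidences, and a further n / m because it uses a single pointer.
κ : {n : ℕ} → Sym n → ℕ
κ (free _ _) = 0
κ (one _ _ _) = 2
κ (two _ _ _) = 4
κ (same _) = 6

-- With pts = `els A` a pointer has m possible targets instead of n. This saving m/n pays for the
-- factor θ⁻² that a coincidence carries.
PtrsIn : {n : ℕ} → List (Fin n) → Sym n → Set
PtrsIn pts (free _ _) = 0 ≡ 0
PtrsIn pts (one _ j _) = j ∈ pts
PtrsIn pts (two _ j k) = j ∈ pts × k ∈ pts
PtrsIn pts (same j) = j ∈ pts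

module Code {n : ℕ} (ℒ : LatinSquare n) (o : Tri n) where
  open LatinSquare ℒ

  -- The two given coordinates are those following d in the cyclic order, so that one formula serves
  -- all three directions.
  complete : Dir → Fin n → Fin n → Tri n
  complete Z a b = a , b , proj₁ (xy a b)
  complete X a b = proj₁ (yz a b) , a , b
  complete Y a b = b , proj₁ (zx a b) , a

  InL : Tri n → Set
  InL t = L (co X t) (co Y t) (co Z t) ≡ true

  complete-InL : ∀ d {t} → InL t → complete d (co (nxt d) t) (co (nxt (nxt d)) t) ≡ t
  complete-InL X {x , y , z} l = cong (λ u → u , y , z) (sym (proj₂ (proj₂ (yz y z)) x l))
  complete-InL Y {x , y , z} l = cong (λ u → x , u , z) (sym (proj₂ (proj₂ (zx z x)) y l))
  complete-InL Z {x , y , z} l = cong (λ u → x , y , u) (sym (proj₂ (proj₂ (xy x y)) z l))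

  eval : Sym n → (Fin n → Tri n) → Tri n
  eval (free a b) σ = complete Z a b
  -- The stored v has direction `nxt (nxt d)` and the copied coordinate has direction d; these are
  -- the two directions that follow `nxt d`.
  eval (one d j v) σ = complete (nxt d) v (co d (σ j))
  eval (two d j k) σ = complete d (co (nxt d) (σ j)) (co (nxt (nxt d)) (σ k))
  eval (same j) σ = σ j

  -- The order in which the positions were encoded is not recorded and hence adds nothing to the
  -- number of codes: decoding follows the pointers, and r bounds the depth. The cell o is a dummy
  -- returned when r is exhausted.
  decode : (Fin n → Sym n) → ℕ → Fin n → Tri n
  decode c zero i = o
  decode c (suc r) i = eval (c i) (decode c r)

  module _ (w : Fin n → Tri n) (inL : ∀ i → InL (w i)) (pts : List (Fin n)) where

    -- `decodes` speaks of every c that agrees with `code` on U. Thus decoding in U does not depend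
    -- on symbols outside U, which are still to be chosen.
    record Coded (U : List (Fin n)) (K : ℕ) : Set where
      field
        code    : Fin n → Sym n
        pointers : ∀ {i} → i ∈ U → PtrsIn pts (code i)
        decodes : ∀ c → (∀ {i} → i ∈ U → c i ≡ code i) → ∀ r → length U ≤ r → ∀ {i} → i ∈ U → decode c r i ≡ w i
        credit  : ∑ U (κ ∘ code) ≡ K
    open Coded

    coded-[] : Coded [] 0
    coded-[] .code i = free (co X o) (co X o)
    coded-[] .pointers ()
    coded-[] .decodes c e r l ()
    coded-[] .credit = refl

    coded-↭ : ∀ {U V K} → U ↭ V → Coded U K → Coded V K
    coded-↭ p C .code = C .code
    coded-↭ p C .pointers i = C .pointers (Perm.∈-resp-↭ (↭-sym p) i)
    coded-↭ p C .decodes c e r l i =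
      C .decodes c (λ j → e (Perm.∈-resp-↭ p j)) r (subst (_≤ r) (sym (Perm.↭-length p)) l) (Perm.∈-resp-↭ (↭-sym p) i)
    coded-↭ p C .credit = trans (∑-↭ (↭-sym p)) (C .credit)

    -- The new symbol points to positions of U, which are decoded correctly with one unit of depth
    -- less. It suffices that it evaluates to the cell at i under any assignment that is correct on
    -- U.
    extend : ∀ {U K i} → Coded U K → i ∉ U → (s : Sym n) → PtrsIn pts s →
      (∀ σ → (∀ {j} → j ∈ U → σ j ≡ w j) → eval s σ ≡ w i) → Coded (i ∷ U) (κ s + K)
    extend {U} {K} {i} C i∉U s ps ev = record
      { code = c′ ; pointers = ptrs ; decodes = dec ; credit = cong₂ _+_ (cong κ c′i) (trans (credits U i∉U) (C .credit)) }
      where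
      c′ : Fin n → Sym n
      c′ j = if does (j ≟ i) then s else C .code j
      c′i : c′ i ≡ s
      c′i rewrite dec-true (i ≟ i) refl = refl
      c′j : ∀ {j} → j ≢ i → c′ j ≡ C .code j
      c′j {j} ne rewrite dec-false (j ≟ i) ne = refl
      ∈U⇒≢ : ∀ {j} → j ∈ U → j ≢ i
      ∈U⇒≢ j∈U refl = i∉U j∈U
      ptrs : ∀ {j} → j ∈ i ∷ U → PtrsIn pts (c′ j)
      ptrs (here refl) = subst (PtrsIn pts) (sym c′i) ps
      ptrs (there j) = subst (PtrsIn pts) (sym (c′j (∈U⇒≢ j))) (C .pointers j)
      dec : ∀ c → (∀ {j} → j ∈ i ∷ U → c j ≡ c′ j) → ∀ r → length (i ∷ U) ≤ r → ∀ {j} → j ∈ i ∷ U → decode c r j ≡ w j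
      dec c e (suc r) (s≤s l) (here refl) rewrite trans (e (here refl)) c′i =
        ev (decode c r) (λ j → C .decodes c (λ k → trans (e (there k)) (c′j (∈U⇒≢ k))) r l j)
      dec c e r l (there j) =
        C .decodes c (λ k → trans (e (there k)) (c′j (∈U⇒≢ k))) r (ℕ.≤-trans (ℕ.n≤1+n _) l) j
      credits : ∀ V → i ∉ V → ∑ V (κ ∘ c′) ≡ ∑ V (κ ∘ C .code)
      credits [] _ = refl
      credits (j ∷ V) i∉ = cong₂ _+_ (cong κ (c′j (λ q → i∉ (here (sym q))))) (credits V (i∉ ∘ there))

    vals : Dir → List (Fin n) → List (Fin n)
    vals d U = map (λ i → co d (w i)) U

    occ : Dir → Fin n → List (Fin n) → ℕ
    occ d i U = cnt (co d (w i)) (vals d U)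

    partner : ∀ d i U → 1 ≤ occ d i U → Σ (Fin n) λ j → j ∈ U × co d (w j) ≡ co d (w i)
    partner d i U h with j , j∈U , e ← ∈-map⁻ (λ i → co d (w i)) (cnt⇒∈ (co d (w i)) (vals d U) h) = j , j∈U , sym e

    occ-self : ∀ d i j U → co d (w j) ≡ co d (w i) → occ d i (j ∷ U) ≡ suc (occ d j U)
    occ-self d i j U e rewrite e = cnt-head (co d (w i)) (vals d U)

    occ-↭ : ∀ d i {U V} → U ↭ V → occ d i U ≡ occ d i V
    occ-↭ d i p = ∑-↭ (Perm.map⁺ _ p)

    nonsingle : List (Fin n) → ℕ
    nonsingle U = repeats (vals X U) + repeats (vals Y U) + repeats (vals Z U)

    increase : Fin n → List (Fin n) → ℕ
    increase i U = δ (occ X i U) + δ (occ Y i U) + δ (occ Z i U)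

    nonsingle-∷ : ∀ i U → nonsingle (i ∷ U) ≤ increase i U + nonsingle U
    nonsingle-∷ i U = begin
      nonsingle (i ∷ U)
        ≤⟨ ℕ.+-mono-≤ (ℕ.+-mono-≤ (repeats-∷ (co X (w i)) (vals X U)) (repeats-∷ (co Y (w i)) (vals Y U))) (repeats-∷ (co Z (w i)) (vals Z U)) ⟩
      δ (occ X i U) + repeats (vals X U) + (δ (occ Y i U) + repeats (vals Y U)) + (δ (occ Z i U) + repeats (vals Z U))
        ≡⟨ regroup (δ (occ X i U)) _ (δ (occ Y i U)) _ (δ (occ Z i U)) _ ⟩
      increase i U + nonsingle U ∎
      where
      open ℕ.≤-Reasoning
      regroup : ∀ a b c d e f → a + b + (c + d) + (e + f) ≡ a + c + e + (b + d + f)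
      regroup = solve-∀

    nonsingle-↭ : ∀ {U V} → U ↭ V → nonsingle U ≡ nonsingle V
    nonsingle-↭ p = cong₂ _+_ (cong₂ _+_ (repeats-↭ (Perm.map⁺ _ p)) (repeats-↭ (Perm.map⁺ _ p))) (repeats-↭ (Perm.map⁺ _ p))

    increase-rotate : ∀ d i U → increase i U ≡ δ (occ d i U) + (δ (occ (nxt d) i U) + δ (occ (nxt (nxt d)) i U))
    increase-rotate X i U = ℕ.+-assoc (δ (occ X i U)) _ _
    increase-rotate Y i U = rotate (δ (occ X i U)) _ _
      where
      rotate : ∀ a b c → a + b + c ≡ b + (c + a)
      rotate = solve-∀
    increase-rotate Z i U = ℕ.+-comm (δ (occ X i U) + δ (occ Y i U)) _

    increase≤6 : ∀ i U → increase i U ≤ 6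
    increase≤6 i U = ℕ.+-mono-≤ (ℕ.+-mono-≤ (δ≤2 (occ X i U)) (δ≤2 (occ Y i U))) (δ≤2 (occ Z i U))

    Within : List (Fin n) → Set
    Within U = ∀ {j} → j ∈ U → j ∈ pts

    nxt³ : ∀ d → nxt (nxt (nxt d)) ≡ d
    nxt³ X = refl
    nxt³ Y = refl
    nxt³ Z = refl

    coded-free : ∀ {U K i} → Coded U K → i ∉ U → Coded (i ∷ U) K
    coded-free {i = i} C i∉U = extend C i∉U (free (co X (w i)) (co Y (w i))) refl (λ σ _ → complete-InL Z (inL i))

    coded-one : ∀ {U K i} d → Within U → Coded U K → i ∉ U → 1 ≤ occ d i U → Coded (i ∷ U) (2 + K)
    coded-one {U} {i = i} d wi C i∉U h with j , j∈U , e ← partner d i U h =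
      extend C i∉U (one d j (co (nxt (nxt d)) (w i))) (wi j∈U) ev
      where
      ev : ∀ (σ : Fin n → Tri n) → (∀ {j} → j ∈ U → σ j ≡ w j) → complete (nxt d) (co (nxt (nxt d)) (w i)) (co d (σ j)) ≡ w i
      ev σ agree = trans
        (cong (complete (nxt d) (co (nxt (nxt d)) (w i)))
          (trans (cong (co d) (agree j∈U)) (trans e (cong (λ d′ → co d′ (w i)) (sym (nxt³ d))))))
        (complete-InL (nxt d) (inL i))

    coded-two : ∀ {U K i} d → Within U → Coded U K → i ∉ U → 1 ≤ occ (nxt d) i U → 1 ≤ occ (nxt (nxt d)) i U → Coded (i ∷ U) (4 + K)
    coded-two {U} {i = i} d wi C i∉U h h′
      with j , j∈U , e ← partner (nxt d) i U h | k , k∈U , e′ ← partner (nxt (nxt d)) i U h′ =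
      extend C i∉U (two d j k) (wi j∈U , wi k∈U) ev
      where
      ev : ∀ (σ : Fin n → Tri n) → (∀ {j} → j ∈ U → σ j ≡ w j) → complete d (co (nxt d) (σ j)) (co (nxt (nxt d)) (σ k)) ≡ w i
      ev σ agree = trans
        (cong₂ (complete d) (trans (cong (co (nxt d)) (agree j∈U)) e) (trans (cong (co (nxt (nxt d))) (agree k∈U)) e′))
        (complete-InL d (inL i))

    coded-same : ∀ {U K i j} → Within U → Coded U K → i ∉ U → j ∈ U → w j ≡ w i → Coded (i ∷ U) (6 + K)
    coded-same wi C i∉U j∈U e = extend C i∉U (same _) (wi j∈U) (λ σ agree → trans (agree j∈U) e)

    -- The excess e of u over the credit is measured in quarters, so that the allowance 3/4 of a
    -- position becomes 3.
    Balanced : List (Fin n) → ℕ → Set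
    Balanced U e = Σ ℕ λ K → Coded U K × 4 * nonsingle U ≤ 4 * K + e

    -- Here k is the credit of the symbol at i, and a is the part of the increase of u that it
    -- leaves uncovered.
    grow : ∀ {U K e} {i : Fin n} k a → Coded (i ∷ U) (k + K) → 4 * nonsingle U ≤ 4 * K + e →
      increase i U ≤ k + a → Balanced (i ∷ U) (4 * a + e)
    grow {U} {K} {e} {i} k a C b h = k + K , C , (begin
      4 * nonsingle (i ∷ U)                ≤⟨ ℕ.*-monoʳ-≤ 4 (ℕ.≤-trans (nonsingle-∷ i U) (ℕ.+-monoˡ-≤ (nonsingle U) h)) ⟩
      4 * (k + a + nonsingle U)            ≡⟨ ℕ.*-distribˡ-+ 4 (k + a) _ ⟩
      4 * (k + a) + 4 * nonsingle U        ≤⟨ ℕ.+-monoʳ-≤ (4 * (k + a)) b ⟩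
      4 * (k + a) + (4 * K + e)            ≡⟨ regroup k a K e ⟩
      4 * (k + K) + (4 * a + e)            ∎)
      where
      open ℕ.≤-Reasoning
      regroup : ∀ k a K e → 4 * (k + a) + (4 * K + e) ≡ 4 * (k + K) + (4 * a + e)
      regroup = solve-∀

    -- If one direction has no coincidence, at most two coordinates of i coincide with others, and a
    -- symbol can use them all: each adds at most 2 to u and is credited with 2.
    grow-zero : ∀ {U e i} d → Within U → i ∉ U → occ d i U ≡ 0 → Balanced U e → Balanced (i ∷ U) e
    grow-zero {U} {e} {i} d wi i∉U z (K , C , b)
      with occ (nxt d) i U in eq | occ (nxt (nxt d)) i U in eq′ | increase-rotate d i U
    ... | zero | zero | r rewrite z = grow 0 0 (coded-free C i∉U) b (ℕ.≤-reflexive r)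
    ... | zero | suc c | r rewrite z = grow 2 0 (coded-one (nxt (nxt d)) wi C i∉U (subst (1 ≤_) (sym eq′) (s≤s z≤n))) b
      (subst (_≤ 2) (sym r) (δ≤2 (suc c)))
    ... | suc c | zero | r rewrite z = grow 2 0 (coded-one (nxt d) wi C i∉U (subst (1 ≤_) (sym eq) (s≤s z≤n))) b
      (subst (_≤ 2) (sym (trans r (ℕ.+-identityʳ _))) (δ≤2 (suc c)))
    ... | suc c | suc c′ | r rewrite z =
      grow 4 0 (coded-two d wi C i∉U (subst (1 ≤_) (sym eq) (s≤s z≤n)) (subst (1 ≤_) (sym eq′) (s≤s z≤n))) b
        (subst (_≤ 4) (sym r) (ℕ.+-mono-≤ (δ≤2 (suc c)) (δ≤2 (suc c′))))

    two-agree : ∀ d {s t} → InL s → InL t → co d s ≡ co d t → co (nxt d) s ≡ co (nxt d) t → s ≡ t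
    two-agree d {s} {t} ls lt e e′ = begin
      s                                                ≡⟨ sym (complete-InL d″ ls) ⟩
      complete d″ (co (nxt d″) s) (co (nxt (nxt d″)) s) ≡⟨ cong₂ (complete d″) (agree d (nxt³ d) e) (agree (nxt d) (cong nxt (nxt³ d)) e′) ⟩
      complete d″ (co (nxt d″) t) (co (nxt (nxt d″)) t) ≡⟨ complete-InL d″ lt ⟩
      t                                                ∎
      where
      open ≡-Reasoning
      d″ = nxt (nxt d)
      agree : ∀ d₁ {d₂} → d₂ ≡ d₁ → co d₁ s ≡ co d₁ t → co d₂ s ≡ co d₂ t
      agree d₁ refl q = q

    -- As `δ` takes the value 2 only at 1, an increase above 4 requires three positive counts, two
    -- of them equal to 1. Any two directions are adjacent in the cyclic order.
    data Situation (a : Dir → ℕ) : Set where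
      someZero : ∀ d → a d ≡ 0 → Situation a
      twoOnes  : ∀ d → a d ≡ 1 → a (nxt d) ≡ 1 → 1 ≤ a (nxt (nxt d)) → Situation a
      few      : (∀ d → 1 ≤ a d) → δ (a X) + δ (a Y) + δ (a Z) ≤ 4 → Situation a

    situation : ∀ a → Situation a
    situation a = go (a X) (a Y) (a Z) refl refl refl
      where
      positive : ∀ {d k} → a d ≡ suc k → 1 ≤ a d
      positive e = subst (1 ≤_) (sym e) (s≤s z≤n)
      all-few : ∀ {x y z} → a X ≡ suc x → a Y ≡ suc y → a Z ≡ suc z → δ (suc x) + δ (suc y) + δ (suc z) ≤ 4 → Situation a
      all-few {x} {y} {z} eX eY eZ h =
        few (λ { X → positive {X} eX ; Y → positive {Y} eY ; Z → positive {Z} eZ })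
          (subst (_≤ 4) (sym (cong₂ _+_ (cong₂ _+_ (cong δ eX) (cong δ eY)) (cong δ eZ))) h)
      go : ∀ x y z → a X ≡ x → a Y ≡ y → a Z ≡ z → Situation a
      go 0 _ _ eX eY eZ = someZero X eX
      go (suc _) 0 _ eX eY eZ = someZero Y eY
      go (suc _) (suc _) 0 eX eY eZ = someZero Z eZ
      go 1 1 (suc _) eX eY eZ = twoOnes X eX eY (positive {Z} eZ)
      go (suc (suc _)) 1 1 eX eY eZ = twoOnes Y eY eZ (positive {X} eX)
      go 1 (suc (suc _)) 1 eX eY eZ = twoOnes Z eZ eX (positive {Y} eY)
      go 1 (suc (suc _)) (suc (suc _)) eX eY eZ = all-few eX eY eZ ℕ.≤-refl
      go (suc (suc _)) 1 (suc (suc _)) eX eY eZ = all-few eX eY eZ ℕ.≤-refl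
      go (suc (suc _)) (suc (suc _)) 1 eX eY eZ = all-few eX eY eZ ℕ.≤-refl
      go (suc (suc _)) (suc (suc _)) (suc (suc _)) eX eY eZ = all-few eX eY eZ (ℕ.n≤1+n 3)

    weaken : ∀ {U e e′} → e ≤ e′ → Balanced U e → Balanced U e′
    weaken h (K , C , b) = K , C , ℕ.≤-trans b (ℕ.+-monoʳ-≤ (4 * K) h)

    balanced-↭ : ∀ {U V e} → U ↭ V → Balanced U e → Balanced V e
    balanced-↭ {e = e} p (K , C , b) = K , coded-↭ p C , subst (λ s → 4 * s ≤ 4 * K + e) (nonsingle-↭ p) b

    unique-head : ∀ {i : Fin n} {U} → Unique (i ∷ U) → i ∉ U
    unique-head (fresh ∷ _) i∈U = All.lookup fresh i∈U refl

    unique-tail : ∀ {i : Fin n} {U} → Unique (i ∷ U) → Unique U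
    unique-tail (_ ∷ u) = u

    unique-↭ : ∀ {U V : List (Fin n)} → U ↭ V → Unique U → Unique V
    unique-↭ p = PermSetoid.Unique-resp-↭ (setoid _) (Perm.↭⇒↭ₛ p)

    -- Here j is the only position of U that shares the d-coordinate of i. With i already set aside,
    -- nothing in V shares that coordinate with j.
    occ-removed : ∀ d i j {U V} → U ↭ j ∷ V → co d (w j) ≡ co d (w i) → occ d i U ≡ 1 → occ d j V ≡ 0
    occ-removed d i j {V = V} p e o =
      ℕ.suc-injective (trans (sym (occ-self d i j V e)) (trans (sym (occ-↭ d i p)) o))

    -- Positions are decoded one after another, so a position lying in three coincidences can use only
    -- two of them.  Each position has an allowance of 3/4.  If i loses more because two of its coincidences
    -- are pairs {i , j} and {i , k} with j ≢ k, then removing i frees j and then k, whose allowances pay for i.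
    balance : ∀ N U → length U ≤ N → Unique U → Within U → Balanced U (3 * length U)
    balance N [] _ _ _ = 0 , coded-[] , z≤n
    balance (suc N) (i ∷ U) (s≤s l) u wi = step (situation (λ d → occ d i U))
      where
      i∉U = unique-head u
      wiU : Within U
      wiU = wi ∘ there
      rest : Balanced U (3 * length U)
      rest = balance N U l (unique-tail u) wiU
      slack : 3 * length U ≤ 3 * length (i ∷ U)
      slack = ℕ.*-monoʳ-≤ 3 (ℕ.n≤1+n (length U))
      step : Situation (λ d → occ d i U) → Balanced (i ∷ U) (3 * length (i ∷ U))
      step (someZero d z) = weaken slack (grow-zero d wiU i∉U z rest)
      step (few ones h) with rest
      ... | K , C , b = weaken slack (grow 4 0 (coded-two Z wiU C i∉U (ones X) (ones Y)) b h)
      step (twoOnes d e₁ e₂ _)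
        with partner d i U (ℕ.≤-reflexive (sym e₁)) | partner (nxt d) i U (ℕ.≤-reflexive (sym e₂))
      ... | j , j∈U , ej | k , k∈U , ek with j ≟ k
      -- A common partner shares two coordinates with i, hence the whole cell; copying it is
      -- credited with 6, the largest possible increase.
      ...   | yes refl with rest
      ...     | K , C , b =
        weaken slack (grow 6 0 (coded-same wiU C i∉U j∈U (two-agree d (inL j) (inL i) ej ek)) b (increase≤6 i U))
      step (twoOnes d e₁ e₂ _) | j , j∈U , ej | k , k∈U , ek | no j≢k
        with V , p ← ∈-↭-head j∈U with Perm.∈-resp-↭ p k∈U
      ... | here k≡j = contradiction (sym k≡j) j≢k
      ... | there k∈V with W , q ← ∈-↭-head k∈V = three
        where
        U↭ : U ↭ j ∷ k ∷ W
        U↭ = Perm.trans p (prep j q)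
        uW : Unique (j ∷ k ∷ W)
        uW = unique-↭ U↭ (unique-tail u)
        wiW : Within (j ∷ k ∷ W)
        wiW m = wiU (Perm.∈-resp-↭ (↭-sym U↭) m)
        |U| : length U ≡ 2 + length W
        |U| = Perm.↭-length U↭
        balW : Balanced W (3 * length W)
        balW = balance N W (ℕ.≤-trans (ℕ.m≤n+m _ 2) (subst (_≤ N) |U| l)) (unique-tail (unique-tail uW)) (wiW ∘ there ∘ there)
        -- The lemma gives that no position of j ∷ W shares this coordinate with k, in particular
        -- none of W.
        k-zero : occ (nxt d) k W ≡ 0
        k-zero = ℕ.m+n≡0⇒n≡0 _ (occ-removed (nxt d) i k (Perm.trans U↭ (swap j k Perm.refl)) ek e₂)
        balU : Balanced U (3 * length W)
        balU = balanced-↭ (↭-sym U↭)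
          (grow-zero d (wiW ∘ there) (unique-head uW) (occ-removed d i j U↭ ej e₁)
            (grow-zero (nxt d) (wiW ∘ there ∘ there) (unique-head (unique-tail uW)) k-zero balW))
        occ-d : 1 ≤ occ (nxt (nxt (nxt d))) i U
        occ-d = subst (λ d′ → 1 ≤ occ d′ i U) (sym (nxt³ d)) (ℕ.≤-reflexive (sym e₁))
        occ-nxt : 1 ≤ occ (nxt (nxt (nxt (nxt d)))) i U
        occ-nxt = subst (λ d′ → 1 ≤ occ (nxt d′) i U) (sym (nxt³ d)) (ℕ.≤-reflexive (sym e₂))
        -- Adding i increases u by at most 6 against a credit of 4, a loss of eight quarters. The
        -- positions i, j and k together have an allowance of nine, none of which is spent on j and
        -- k.
        allowance : 4 * 2 + 3 * length W ≤ 3 * length (i ∷ U)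
        allowance = subst (λ l → 8 + 3 * length W ≤ 3 * suc l) (sym |U|)
          (ℕ.≤-trans (ℕ.n≤1+n _) (ℕ.≤-reflexive (nine (length W))))
          where
          nine : ∀ l → 9 + 3 * l ≡ 3 * (3 + l)
          nine = solve-∀
        three : Balanced (i ∷ U) (3 * length (i ∷ U))
        three with K , C , b ← balU =
          weaken allowance (grow 4 2 (coded-two (nxt (nxt d)) wiU C i∉U occ-d occ-nxt) b (increase≤6 i U))

-- Summing over codes

∑-≤-const : {A : Set} {f : A → ℕ} (c : ℕ) (xs : List A) → (∀ {x} → x ∈ xs → f x ≤ c) → ∑ xs f ≤ length xs * c
∑-≤-const c xs h = ℕ.≤-trans (∑-mono∈ xs h) (ℕ.≤-reflexive (∑-const c xs))

concatMap-∈ : {B C : Set} (h : B → List C) {b : B} {c : C} {bs : List B} → b ∈ bs → c ∈ h b → c ∈ concatMap h bs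
concatMap-∈ h (here refl) q = ∈-++⁺ˡ q
concatMap-∈ h (there {b} p) q = ∈-++⁺ʳ (h b) (concatMap-∈ h p q)

∑³ : {n : ℕ} → (Pt n → Pt n → Pt n → ℕ) → ℕ
∑³ {n} f = ∑ (allPts n) (λ x → ∑ (allPts n) (λ y → ∑ (allPts n) (λ z → f x y z)))

∑³-cong : {n : ℕ} {f g : Pt n → Pt n → Pt n → ℕ} → (∀ x y z → f x y z ≡ g x y z) → ∑³ f ≡ ∑³ g
∑³-cong h = ∑-cong (allPts _) (λ x → ∑-cong (allPts _) (λ y → ∑-cong (allPts _) (h x y)))

∑³-mono : {n : ℕ} {f g : Pt n → Pt n → Pt n → ℕ} → (∀ x y z → f x y z ≤ g x y z) → ∑³ f ≤ ∑³ g
∑³-mono h = ∑-mono (allPts _) (λ x → ∑-mono (allPts _) (λ y → ∑-mono (allPts _) (h x y)))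

∑³-*ˡ : {n : ℕ} (c : ℕ) (f : Pt n → Pt n → Pt n → ℕ) → ∑³ (λ x y z → c * f x y z) ≡ c * ∑³ f
∑³-*ˡ {n} c f =
  trans (∑-cong (allPts n) (λ x → trans (∑-cong (allPts n) (λ y → ∑-*ˡ c (allPts n))) (∑-*ˡ c (allPts n))))
    (∑-*ˡ c (allPts n))

∑³-swap : {n : ℕ} {A : Set} (cs : List A) (f : Pt n → Pt n → Pt n → A → ℕ) →
  ∑³ (λ x y z → ∑ cs (f x y z)) ≡ ∑ cs (λ c → ∑³ (λ x y z → f x y z c))
∑³-swap {n} cs f =
  trans (∑-cong (allPts n) (λ x → trans (∑-cong (allPts n) (λ y → ∑-swap (allPts n) cs)) (∑-swap (allPts n) cs)))
    (∑-swap (allPts n) cs)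

∑-Ln : {n : ℕ} (ℒ : LatinSquare n) (h : Pt n × Pt n × Pt n → ℕ) →
  ∑ (Ln ℒ) h ≡ ∑³ (λ x y z → if inLn ℒ x y z then h (x , y , z) else 0)
∑-Ln {n} ℒ h =
  trans (∑-concatMap _ (allPts n)) (∑-cong (allPts n) (λ x →
  trans (∑-concatMap _ (allPts n)) (∑-cong (allPts n) (λ y →
  trans (∑-concatMap _ (allPts n)) (∑-cong (allPts n) (λ z → entry x y z))))))
  where
  entry : ∀ x y z → ∑ (if inLn ℒ x y z then (x , y , z) ∷ [] else []) h ≡ (if inLn ℒ x y z then h (x , y , z) else 0)
  entry x y z with inLn ℒ x y z
  ... | true = ℕ.+-identityʳ _
  ... | false = refl

eqF : {n k : ℕ} → (Fin k → Fin n) → (Fin k → Fin n) → Bool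
eqF {k = zero} f g = true
eqF {k = suc k} f g = does (f zero ≟ g zero) ∧ eqF (f ∘ suc) (g ∘ suc)

eqF-≗ : {n k : ℕ} {f g : Fin k → Fin n} → f ≗ g → eqF f g ≡ true
eqF-≗ {k = zero} e = refl
eqF-≗ {k = suc k} {f} {g} e rewrite dec-true (f zero ≟ g zero) (e zero) = eqF-≗ (e ∘ suc)

eqF-congˡ : {n k : ℕ} {f f′ : Fin k → Fin n} (g : Fin k → Fin n) → f ≗ f′ → eqF f g ≡ eqF f′ g
eqF-congˡ {k = zero} g e = refl
eqF-congˡ {k = suc k} g e = cong₂ (λ a b → does (a ≟ g zero) ∧ b) (e zero) (eqF-congˡ (g ∘ suc) (e ∘ suc))

∑-eqF : {n k : ℕ} (g : Fin k → Fin n) → ∑ (allFuns (allFin n) k) (λ f → 𝟙 (eqF f g)) ≡ 1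
∑-eqF {k = zero} g = refl
∑-eqF {n} {suc k} g = begin
  ∑ (allFuns (allFin n) (suc k)) (λ f → 𝟙 (eqF f g))
    ≡⟨ ∑-allFuns (allFin n) k _ (λ f f′ e → cong 𝟙 (eqF-congˡ g e)) ⟩
  ∑ (allFin n) (λ a → ∑ (allFuns (allFin n) k) (λ f → 𝟙 (does (a ≟ g zero) ∧ eqF f (g ∘ suc))))
    ≡⟨ ∑-cong (allFin n) (λ a → trans (∑-cong (allFuns (allFin n) k) (λ f → 𝟙-∧ (does (a ≟ g zero)) (eqF f (g ∘ suc))))
         (trans (∑-*ˡ (𝟙 (does (a ≟ g zero))) (allFuns (allFin n) k)) (cong (𝟙 (does (a ≟ g zero)) *_) (∑-eqF (g ∘ suc))))) ⟩
  ∑ (allFin n) (λ a → 𝟙 (does (a ≟ g zero)) * 1)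
    ≡⟨ ∑-point (g zero) (λ _ → 1) ⟩
  1 ∎
  where open ≡-Reasoning

match : {n : ℕ} → Pt n → Pt n → Pt n → (Fin n → Tri n) → Bool
match x y z v = eqF x (co X ∘ v) ∧ (eqF y (co Y ∘ v) ∧ eqF z (co Z ∘ v))

-- A code decodes to a single triple of points, and up to pointwise equality each triple is listed
-- once. Charging every point of Lⁿ to a code that decodes to it thus bounds a sum over points by a
-- sum over codes.
∑³-match : {n : ℕ} (v : Fin n → Tri n) → ∑³ (λ x y z → 𝟙 (match x y z v)) ≡ 1
∑³-match {n} v = begin
  ∑³ (λ x y z → 𝟙 (match x y z v))
    ≡⟨ ∑³-cong (λ x y z → trans (𝟙-∧ (eqF x (co X ∘ v)) _) (cong (𝟙 (eqF x (co X ∘ v)) *_) (𝟙-∧ (eqF y (co Y ∘ v)) _))) ⟩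
  ∑³ (λ x y z → 𝟙 (eqF x (co X ∘ v)) * (𝟙 (eqF y (co Y ∘ v)) * 𝟙 (eqF z (co Z ∘ v))))
    ≡⟨ ∑-cong (allPts n) (λ x → trans
         (∑-cong (allPts n) (λ y → trans (∑-*ˡ (𝟙 (eqF x (co X ∘ v))) (allPts n))
           (cong (𝟙 (eqF x (co X ∘ v)) *_) (trans (∑-*ˡ (𝟙 (eqF y (co Y ∘ v))) (allPts n))
             (trans (cong (𝟙 (eqF y (co Y ∘ v)) *_) (∑-eqF (co Z ∘ v))) (ℕ.*-identityʳ _))))))
         (trans (∑-*ˡ (𝟙 (eqF x (co X ∘ v))) (allPts n))
           (trans (cong (𝟙 (eqF x (co X ∘ v)) *_) (∑-eqF (co Y ∘ v))) (ℕ.*-identityʳ _)))) ⟩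
  ∑ (allPts n) (λ x → 𝟙 (eqF x (co X ∘ v)))
    ≡⟨ ∑-eqF (co X ∘ v) ⟩
  1 ∎
  where open ≡-Reasoning

^-distrib-* : ∀ a b k → (a * b) ^ k ≡ a ^ k * b ^ k
^-distrib-* a b zero = refl
^-distrib-* a b (suc k) rewrite ^-distrib-* a b k = interchange a b (a ^ k) (b ^ k)
  where
  interchange : ∀ a b c d → a * b * (c * d) ≡ a * c * (b * d)
  interchange = solve-∀

-- Since θ = t / n ≤ 1, among monomials of equal degree those with a larger share of n are larger.
pow-shift : ∀ {t n a b a′ b′} → t ≤ n → a + b ≡ a′ + b′ → b ≤ b′ → t ^ a * n ^ b ≤ t ^ a′ * n ^ b′
pow-shift {t} {n} {a} {b} {a′} {b′} t≤n e b≤b′ with ℕ.m≤n⇒∃[o]m+o≡n b≤b′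
... | o , refl = begin
  t ^ a * n ^ b              ≡⟨ cong (λ k → t ^ k * n ^ b) a≡ ⟩
  t ^ (a′ + o) * n ^ b       ≡⟨ cong (_* n ^ b) (ℕ.^-distribˡ-+-* t a′ o) ⟩
  t ^ a′ * t ^ o * n ^ b     ≡⟨ regroup (t ^ a′) (t ^ o) (n ^ b) ⟩
  t ^ a′ * (n ^ b * t ^ o)   ≤⟨ ℕ.*-monoʳ-≤ (t ^ a′) (ℕ.*-monoʳ-≤ (n ^ b) (ℕ.^-monoˡ-≤ o t≤n)) ⟩
  t ^ a′ * (n ^ b * n ^ o)   ≡⟨ cong (t ^ a′ *_) (sym (ℕ.^-distribˡ-+-* n b o)) ⟩
  t ^ a′ * n ^ (b + o)       ∎
  where
  open ℕ.≤-Reasoning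
  regroup : ∀ p q r → p * q * r ≡ p * (r * q)
  regroup = solve-∀
  swap-add : ∀ a b o → a + (b + o) ≡ a + o + b
  swap-add = solve-∀
  a≡ : a ≡ a′ + o
  a≡ = ℕ.+-cancelʳ-≡ b a (a′ + o) (trans e (swap-add a′ b o))

lookup : {k : ℕ} → Subset k → Fin k → Bool
lookup (b ∷ A) zero = b
lookup (b ∷ A) (suc i) = lookup A i

els⁺ : {k : ℕ} (A : Subset k) (i : Fin k) → lookup A i ≡ true → i ∈ els A
els⁺ (true ∷ A) zero e = here refl
els⁺ (true ∷ A) (suc i) e = there (∈-map⁺ suc (els⁺ A i e))
els⁺ (false ∷ A) (suc i) e = ∈-map⁺ suc (els⁺ A i e)

els⁻ : {k : ℕ} (A : Subset k) {i : Fin k} → i ∈ els A → lookup A i ≡ true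
els⁻ (true ∷ A) (here refl) = refl
els⁻ (true ∷ A) (there p) with j , j∈ , refl ← ∈-map⁻ suc p = els⁻ A j∈
els⁻ (false ∷ A) p with j , j∈ , refl ← ∈-map⁻ suc p = els⁻ A j∈

els-unique : {k : ℕ} (A : Subset k) → Unique (els A)
els-unique [] = []
els-unique (true ∷ A) = All.tabulate (λ { p refl → zero∉ p }) ∷ Unique.map⁺ Fin.suc-injective (els-unique A)
  where
  zero∉ : zero ∉ map suc (els A)
  zero∉ p with j , _ , () ← ∈-map⁻ suc p
els-unique (false ∷ A) = Unique.map⁺ Fin.suc-injective (els-unique A)

length-els : {k : ℕ} (A : Subset k) → length (els A) ≡ ∣ A ∣
length-els [] = refl
length-els (true ∷ A) = cong suc (trans (List.length-map suc (els A)) (length-els A))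
length-els (false ∷ A) = trans (List.length-map suc (els A)) (length-els A)

singles : {n : ℕ} → List (Fin n) → ℕ
singles vs = ∑ vs (𝟙 ∘ not ∘ rep vs)

singles+repeats : {n : ℕ} (vs : List (Fin n)) → singles vs + repeats vs ≡ length vs
singles+repeats vs = trans (sym (∑-+ vs)) (trans (∑-cong vs (λ v → either (rep vs v))) (length-∑ vs))
  where
  either : ∀ b → 𝟙 (not b) + 𝟙 b ≡ 1
  either true = refl
  either false = refl

-- The weighted count of the points of Lⁿ for a fixed set A

module Weights {n : ℕ} (ℒ : LatinSquare n) (o : Tri n) (A : Subset n) (t : ℕ)
  (t≤n : t ≤ n) (2m≤n : 2 * ∣ A ∣ ≤ n) (m≤t : ∣ A ∣ ≤ t) (H : ∣ A ∣ * t + ∣ A ∣ * n ≤ t * t) where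

  open Code ℒ o

  m : ℕ
  m = ∣ A ∣

  B : ℕ
  B = n ! * 4 ^ m

  pts : List (Fin n)
  pts = els A

  length-vals : (x : Pt n) → length (map x pts) ≡ m
  length-vals x = trans (List.length-map x pts) (length-els A)

  -- After division by nᵐ the last factor is θˢ. Of the 4ᵐ, one 2ᵐ comes from splitting the sum at
  -- repeated letters and the other from `d-bound`.
  g-bound : (x : Pt n) → n ^ m * g A x ≤ n ! * 4 ^ m * (t ^ singles (map x pts) * n ^ repeats (map x pts))
  g-bound x = begin
    n ^ m * g A x                             ≡⟨ cong (λ k → n ^ k * g A x) (sym s+u) ⟩
    n ^ (s + u) * g A x                       ≡⟨ cong (_* g A x) (ℕ.^-distribˡ-+-* n s u) ⟩
    n ^ s * n ^ u * g A x                     ≡⟨ regroup (n ^ s) (n ^ u) (g A x) ⟩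
    n ^ u * (n ^ s * g A x)                   ≤⟨ ℕ.*-monoʳ-≤ (n ^ u) (G-bound (rep vs) vs ∅ (pos ∘ coef n) (n ^ s) M inv diff) ⟩
    n ^ u * (2 ^ u * M)                       ≤⟨ ℕ.*-monoʳ-≤ (n ^ u) (ℕ.*-monoˡ-≤ M (ℕ.^-monoʳ-≤ 2 u≤m)) ⟩
    n ^ u * (2 ^ m * (n ! * 2 ^ m * t ^ s))   ≡⟨ collect (n ^ u) (2 ^ m) (n !) (t ^ s) ⟩
    n ! * (2 ^ m * 2 ^ m) * (t ^ s * n ^ u)   ≡⟨ cong (λ k → n ! * k * (t ^ s * n ^ u)) (sym (^-distrib-* 2 2 m)) ⟩
    n ! * 4 ^ m * (t ^ s * n ^ u)             ∎
    where
    open ℕ.≤-Reasoning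
    vs = map x pts
    s = singles vs
    u = repeats vs
    M = n ! * 2 ^ m * t ^ s
    s+u : s + u ≡ m
    s+u = trans (singles+repeats vs) (length-vals x)
    u≤m : u ≤ m
    u≤m = ℕ.m+n≤o⇒n≤o s (ℕ.≤-reflexive s+u)
    regroup : ∀ a b c → a * b * c ≡ b * (a * c)
    regroup = solve-∀
    collect : ∀ a b c d → a * (b * (c * b * d)) ≡ c * (b * b) * (d * a)
    collect = solve-∀
    inv : ∀ v → rep vs v ≡ false → cnt v vs + 0 ≤ 1
    inv v e = ℕ.≤-trans (ℕ.≤-reflexive (ℕ.+-identityʳ (cnt v vs)))
      (ℕ.≤-pred (ℕ.≰⇒> (λ 2≤ → case trans (sym e) (dec-true (2 ≤? cnt v vs) 2≤) of λ ())))
    diff : ∀ r → r ≤ u → n ^ s * ℤ.∣ Δ^ s (pos ∘ coef n) r ∣ ≤ M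
    diff r r≤u = ℕ.≤-trans (d-bound n {m} {t} 2m≤n m≤t H s r r+s≤m)
      (ℕ.*-monoˡ-≤ (t ^ s) (ℕ.*-monoʳ-≤ (n !) (ℕ.^-monoʳ-≤ 2 r+s≤m)))
      where
      r+s≤m : r + s ≤ m
      r+s≤m = ℕ.≤-trans (ℕ.+-monoˡ-≤ s r≤u) (ℕ.≤-reflexive (trans (ℕ.+-comm u s) s+u))

  frees ones twos sames : List (Sym n)
  frees = concatMap (λ a → map (free a) (allFin n)) (allFin n)
  ones = concatMap (λ d → concatMap (λ j → map (one d j) (allFin n)) pts) (X ∷ Y ∷ Z ∷ [])
  twos = concatMap (λ d → concatMap (λ j → map (two d j) pts) pts) (X ∷ Y ∷ Z ∷ [])
  sames = map same pts

  syms : Bool → List (Sym n)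
  syms false = frees
  syms true = frees ++ (ones ++ (twos ++ sames))

  -- In A this is θ^(-κ) multiplied by t⁶, which makes it integral since 6 is the largest credit.
  -- Positions outside A carry no weight.
  wt : Bool → Sym n → ℕ
  wt false s = 1
  wt true s = t ^ (6 ∸ κ s) * n ^ κ s

  ∑-pairs : {B C : Set} (h : B → C → Sym n) (f : Sym n → ℕ) (c : ℕ) (bs : List B) (cs : List C) →
    (∀ b e → f (h b e) ≡ c) → ∑ (concatMap (λ b → map (h b) cs) bs) f ≡ length bs * (length cs * c)
  ∑-pairs h f c bs cs e = trans (∑-concatMap _ bs)
    (trans (∑-cong bs (λ b → trans (∑-map (h b) cs) (trans (∑-cong cs (e b)) (∑-const c cs)))) (∑-const _ bs))

  total : Bool → ℕ
  total b = ∑ (syms b) (wt b)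

  total-false : total false ≡ n * n
  total-false = trans (∑-pairs free (λ _ → 1) 1 (allFin n) (allFin n) (λ _ _ → refl))
    (trans (cong₂ (λ a b → a * (b * 1)) (length-allFin n) (length-allFin n)) (cong (n *_) (ℕ.*-identityʳ n)))

  total-true : total true ≡ n * (n * (t ^ 6 * 1)) + (3 * (m * (n * (t ^ 4 * n ^ 2))) + (3 * (m * (m * (t ^ 2 * n ^ 4))) + m * (1 * n ^ 6)))
  total-true = trans (∑-++ frees _) (cong₂ _+_ frees-total (trans (∑-++ ones _) (cong₂ _+_ ones-total (trans (∑-++ twos _) (cong₂ _+_ twos-total sames-total)))))
    where
    ∑-dirs : (h : Dir → List (Sym n)) (c : ℕ) → (∀ d → ∑ (h d) (wt true) ≡ c) →
      ∑ (concatMap h (X ∷ Y ∷ Z ∷ [])) (wt true) ≡ 3 * c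
    ∑-dirs h c e = trans (∑-concatMap h (X ∷ Y ∷ Z ∷ [])) (trans (∑-cong (X ∷ Y ∷ Z ∷ []) e) (∑-const c (X ∷ Y ∷ Z ∷ [])))
    frees-total : ∑ frees (wt true) ≡ n * (n * (t ^ 6 * 1))
    frees-total = trans (∑-pairs free (wt true) (t ^ 6 * 1) (allFin n) (allFin n) (λ _ _ → refl))
      (cong₂ (λ a b → a * (b * (t ^ 6 * 1))) (length-allFin n) (length-allFin n))
    ones-total : ∑ ones (wt true) ≡ 3 * (m * (n * (t ^ 4 * n ^ 2)))
    ones-total = ∑-dirs (λ d → concatMap (λ j → map (one d j) (allFin n)) pts) (m * (n * (t ^ 4 * n ^ 2))) (λ d →
      trans (∑-pairs (one d) (wt true) (t ^ 4 * n ^ 2) pts (allFin n) (λ _ _ → refl))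
        (cong₂ (λ a b → a * (b * (t ^ 4 * n ^ 2))) (length-els A) (length-allFin n)))
    twos-total : ∑ twos (wt true) ≡ 3 * (m * (m * (t ^ 2 * n ^ 4)))
    twos-total = ∑-dirs (λ d → concatMap (λ j → map (two d j) pts) pts) (m * (m * (t ^ 2 * n ^ 4))) (λ d →
      trans (∑-pairs (two d) (wt true) (t ^ 2 * n ^ 4) pts pts (λ _ _ → refl))
        (cong₂ (λ a b → a * (b * (t ^ 2 * n ^ 4))) (length-els A) (length-els A)))
    sames-total : ∑ sames (wt true) ≡ m * (1 * n ^ 6)
    sames-total = trans (∑-map same pts) (trans (∑-const (1 * n ^ 6) pts) (cong (_* (1 * n ^ 6)) (length-els A)))

  codes : {k : ℕ} → Subset k → List (Fin k → Sym n)
  codes [] = (λ ()) ∷ []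
  codes (b ∷ B) = concatMap (λ s → map (s ∷ᶠ_) (codes B)) (syms b)

  weight : {k : ℕ} → Subset k → (Fin k → Sym n) → ℕ
  weight [] c = 1
  weight (b ∷ B) c = wt b (c zero) * weight B (c ∘ suc)

  -- The weight is a product over the positions, so the sum factorises: n² for a position outside B,
  -- `total true` for one inside. The factor on the left avoids the exponent k - |B|.
  ∑-codes : {k : ℕ} (B : Subset k) → ∑ (codes B) (weight B) * (n * n) ^ ∣ B ∣ ≡ (n * n) ^ k * total true ^ ∣ B ∣
  ∑-codes [] = refl
  ∑-codes {suc k} (b ∷ B) = trans (cong (_* (n * n) ^ ∣ b ∷ B ∣) factor) (finish b)
    where
    factor : ∑ (codes (b ∷ B)) (weight (b ∷ B)) ≡ total b * ∑ (codes B) (weight B)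
    factor = trans (∑-concatMap _ (syms b)) (trans
      (∑-cong (syms b) (λ s → trans (∑-map (s ∷ᶠ_) (codes B)) (∑-*ˡ (wt b s) (codes B))))
      (∑-*ʳ _ (syms b)))
    Σcodes = ∑ (codes B) (weight B)
    finish : ∀ b → total b * Σcodes * (n * n) ^ ∣ b ∷ B ∣ ≡ (n * n) ^ suc k * total true ^ ∣ b ∷ B ∣
    finish true = trans (regroup (total true) Σcodes (n * n) ((n * n) ^ ∣ B ∣))
      (trans (cong (λ z → n * n * total true * z) (∑-codes B)) (regroup′ (n * n) (total true) ((n * n) ^ k) (total true ^ ∣ B ∣)))
      where
      regroup : ∀ a b c d → a * b * (c * d) ≡ c * a * (b * d)
      regroup = solve-∀
      regroup′ : ∀ a b c d → a * b * (c * d) ≡ a * c * (b * d)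
      regroup′ = solve-∀
    finish false = trans (cong (λ z → z * Σcodes * (n * n) ^ ∣ B ∣) total-false)
      (trans (ℕ.*-assoc (n * n) Σcodes _) (trans (cong (n * n *_) (∑-codes B)) (sym (ℕ.*-assoc (n * n) _ _))))

  free-∈ : ∀ b a e → free a e ∈ syms b
  free-∈ false a e = concatMap-∈ (λ a → map (free a) (allFin n)) (∈-allFin a) (∈-map⁺ (free a) (∈-allFin e))
  free-∈ true a e = ∈-++⁺ˡ (free-∈ false a e)

  dir-∈ : ∀ d → d ∈ X ∷ Y ∷ Z ∷ []
  dir-∈ X = here refl
  dir-∈ Y = there (here refl)
  dir-∈ Z = there (there (here refl))

  sym-∈ : ∀ s → PtrsIn pts s → s ∈ syms true
  sym-∈ (free a b) _ = free-∈ true a b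
  sym-∈ (one d j v) p = ∈-++⁺ʳ frees (∈-++⁺ˡ (concatMap-∈ (λ d → concatMap (λ j → map (one d j) (allFin n)) pts) (dir-∈ d) (concatMap-∈ (λ j → map (one d j) (allFin n)) p (∈-map⁺ (one d j) (∈-allFin v)))))
  sym-∈ (two d j k) (p , p′) = ∈-++⁺ʳ frees (∈-++⁺ʳ ones (∈-++⁺ˡ (concatMap-∈ (λ d → concatMap (λ j → map (two d j) pts) pts) (dir-∈ d) (concatMap-∈ (λ j → map (two d j) pts) p (∈-map⁺ (two d j) p′)))))
  sym-∈ (same j) p = ∈-++⁺ʳ frees (∈-++⁺ʳ ones (∈-++⁺ʳ twos (∈-map⁺ same p)))

  code-∈ : ∀ {k} (B : Subset k) (c : Fin k → Sym n) → (∀ i → c i ∈ syms (lookup B i)) →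
    Σ (Fin k → Sym n) λ c′ → c′ ∈ codes B × c′ ≗ c
  code-∈ [] c _ = (λ ()) , here refl , λ ()
  code-∈ (b ∷ B) c h with code-∈ B (c ∘ suc) (h ∘ suc)
  ... | c′ , c′∈ , e = c zero ∷ᶠ c′ , concatMap-∈ (λ s → map (s ∷ᶠ_) (codes B)) (h zero) (∈-map⁺ (c zero ∷ᶠ_) c′∈) , λ { zero → refl ; (suc i) → e i }

  weight-els : ∀ {k} (B : Subset k) (c : Fin k → Sym n) →
    weight B c ≡ t ^ ∑ (els B) (λ i → 6 ∸ κ (c i)) * n ^ ∑ (els B) (κ ∘ c)
  weight-els [] c = refl
  weight-els (false ∷ B) c = trans (ℕ.+-identityʳ _) (trans (weight-els B (c ∘ suc))
    (cong₂ (λ a b → t ^ a * n ^ b) (sym (∑-map suc (els B))) (sym (∑-map suc (els B)))))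
  weight-els (true ∷ B) c = begin
    t ^ a * n ^ b * weight B (c ∘ suc)                ≡⟨ cong (t ^ a * n ^ b *_) (weight-els B (c ∘ suc)) ⟩
    t ^ a * n ^ b * (t ^ a′ * n ^ b′)                 ≡⟨ interchange (t ^ a) (n ^ b) (t ^ a′) (n ^ b′) ⟩
    t ^ a * t ^ a′ * (n ^ b * n ^ b′)                 ≡⟨ sym (cong₂ _*_ (ℕ.^-distribˡ-+-* t a a′) (ℕ.^-distribˡ-+-* n b b′)) ⟩
    t ^ (a + a′) * n ^ (b + b′)                       ≡⟨ cong₂ (λ u v → t ^ (a + u) * n ^ (b + v)) (sym (∑-map suc (els B))) (sym (∑-map suc (els B))) ⟩
    t ^ ∑ (els (true ∷ B)) (λ i → 6 ∸ κ (c i)) * n ^ ∑ (els (true ∷ B)) (κ ∘ c) ∎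
    where
    open ≡-Reasoning
    a = 6 ∸ κ (c zero)
    b = κ (c zero)
    a′ = ∑ (els B) (λ i → 6 ∸ κ (c (suc i)))
    b′ = ∑ (els B) (λ i → κ (c (suc i)))
    interchange : ∀ a b c d → a * b * (c * d) ≡ a * c * (b * d)
    interchange = solve-∀

  κ-complement : (c : Fin n → Sym n) → ∑ pts (λ i → 6 ∸ κ (c i)) + ∑ pts (κ ∘ c) ≡ 6 * m
  κ-complement c = trans (sym (∑-+ pts)) (trans (∑-cong pts (λ i → six (c i)))
    (trans (∑-const 6 pts) (trans (ℕ.*-comm (length pts) 6) (cong (6 *_) (length-els A)))))
    where
    six : ∀ s → 6 ∸ κ s + κ s ≡ 6
    six (free _ _) = refl
    six (one _ _ _) = refl
    six (two _ _ _) = refl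
    six (same _) = refl

  -- The loss K fails to cover is an integer, so three quarters of m may be rounded down.
  q : ℕ
  q = 3 * m ℕ./ 4

  q≤m : q ≤ m
  q≤m = ℕ.≤-trans (ℕ./-monoˡ-≤ 4 (ℕ.*-monoˡ-≤ m (ℕ.n≤1+n 3))) (ℕ.≤-reflexive (trans (cong (ℕ._/ 4) (ℕ.*-comm 4 m)) (ℕ.m*n/n≡m m 4)))

  within-q : ∀ {U K} → 4 * U ≤ 4 * K + 3 * m → U ≤ K + q
  within-q {U} {K} h = ℕ.≤-trans (ℕ.m≤n+m∸n U K) (ℕ.+-monoʳ-≤ K (begin
    U ∸ K                      ≡⟨ sym (ℕ.m*n/n≡m (U ∸ K) 4) ⟩
    (U ∸ K) * 4 ℕ./ 4          ≤⟨ ℕ./-monoˡ-≤ 4 (ℕ.≤-trans (ℕ.≤-reflexive (trans (ℕ.*-comm (U ∸ K) 4) (ℕ.*-distribˡ-∸ 4 U K))) (ℕ.m≤n+o⇒m∸n≤o (4 * U) (4 * K) h)) ⟩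
    q                          ∎))
    where open ℕ.≤-Reasoning

  S U : Pt n → Pt n → Pt n → ℕ
  S x y z = singles (map x pts) + singles (map y pts) + singles (map z pts)
  U x y z = repeats (map x pts) + repeats (map y pts) + repeats (map z pts)

  S+U : ∀ x y z → S x y z + U x y z ≡ 3 * m
  S+U x y z = trans (regroup (singles (map x pts)) _ _ (repeats (map x pts)) _ _)
    (trans (cong₂ _+_ (cong₂ _+_ (one-list x) (one-list y)) (one-list z)) (triple m))
    where
    regroup : ∀ a b c d e f → a + b + c + (d + e + f) ≡ a + d + (b + e) + (c + f)
    regroup = solve-∀
    triple : ∀ m → m + m + m ≡ 3 * m
    triple = solve-∀
    one-list : ∀ v → singles (map v pts) + repeats (map v pts) ≡ m
    one-list v = trans (singles+repeats (map v pts)) (length-vals v)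

  -- As S + U = 3m and the weight has degree 6m, the factor t^(4m) gives both sides the degree 7m.
  -- Divided by t^(7m), the inequality reads θ^(-u) ≤ θ^(-q) θ^(-K), with K the credit of the code.
  encode : 1 ≤ n → ∀ x y z → inLn ℒ x y z ≡ true →
    Σ (Fin n → Sym n) λ c → c ∈ codes A × match x y z (decode c n) ≡ true ×
      t ^ (4 * m) * (t ^ S x y z * n ^ U x y z) ≤ t ^ (m ∸ q) * n ^ q * weight A c
  encode 1≤n x y z inl = c′ , c′∈ , matches , bound
    where
    w : Fin n → Tri n
    w i = x i , y i , z i
    inL : ∀ i → InL (w i)
    inL i = foldr-∧⇒ (λ i → LatinSquare.L ℒ (x i) (y i) (z i)) (allFin n) inl (∈-allFin i)
    bal : Balanced w inL pts pts (3 * length pts)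
    bal = balance w inL pts (length pts) pts ℕ.≤-refl (els-unique A) id
    K = proj₁ bal
    C = proj₁ (proj₂ bal)
    open Coded C
    c₀ : Fin n → Sym n
    c₀ i = if lookup A i then code i else free (x i) (y i)
    c₀-∈ : ∀ i → c₀ i ∈ syms (lookup A i)
    c₀-∈ i with lookup A i in e
    ... | true = sym-∈ (code i) (pointers (els⁺ A i e))
    ... | false = free-∈ false (x i) (y i)
    listed = code-∈ A c₀ c₀-∈
    c′ = proj₁ listed
    c′∈ = proj₁ (proj₂ listed)
    c′≗ = proj₂ (proj₂ listed)
    c′-on : ∀ {i} → i ∈ pts → c′ i ≡ code i
    c′-on {i} i∈ = trans (c′≗ i) (cong (λ b → if b then code i else free (x i) (y i)) (els⁻ A i∈))
    |pts|≤n : length pts ≤ n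
    |pts|≤n = ℕ.≤-trans (ℕ.≤-reflexive (length-els A)) (ℕ.≤-trans (ℕ.m≤n*m m 2) 2m≤n)
    decoded : ∀ i → decode c′ n i ≡ w i
    decoded i with lookup A i in e
    ... | true = decodes c′ c′-on n |pts|≤n (els⁺ A i e)
    -- Outside A the cell is stored in a free symbol, which has no pointers and is decoded at any
    -- depth r ≥ 1.
    ... | false = off 1≤n
      where
      off : ∀ {r} → 1 ≤ r → decode c′ r i ≡ w i
      off {suc r} _ = trans (cong (λ s → eval s (decode c′ r)) (trans (c′≗ i) (cong (λ b → if b then code i else free (x i) (y i)) e)))
        (complete-InL Z (inL i))
    matches : match x y z (decode c′ n) ≡ true
    matches = cong₂ _∧_ (eqF-≗ (λ i → sym (cong (co X) (decoded i))))
      (cong₂ _∧_ (eqF-≗ (λ i → sym (cong (co Y) (decoded i)))) (eqF-≗ (λ i → sym (cong (co Z) (decoded i)))))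
    ∑-on : ∀ V → (∀ {i} → i ∈ V → i ∈ pts) → ∑ V (κ ∘ c′) ≡ ∑ V (κ ∘ code)
    ∑-on [] _ = refl
    ∑-on (i ∷ V) h = cong₂ _+_ (cong κ (c′-on (h (here refl)))) (∑-on V (h ∘ there))
    K≡ : ∑ pts (κ ∘ c′) ≡ K
    K≡ = trans (∑-on pts id) credit
    K′ = ∑ pts (λ i → 6 ∸ κ (c′ i))
    U≤ : U x y z ≤ K + q
    U≤ = within-q (subst (λ l → 4 * U x y z ≤ 4 * K + 3 * l) (length-els A) (proj₂ (proj₂ bal)))
    exponents : 4 * m + S x y z + U x y z ≡ (m ∸ q + K′) + (K + q)
    exponents = trans (ℕ.+-assoc (4 * m) (S x y z) _) (trans (cong (λ k → 4 * m + k) (S+U x y z))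
      (sym (trans (regroup (m ∸ q) K′ K q) (trans (cong₂ _+_ (ℕ.m∸n+n≡m q≤m) (trans (cong (K′ +_) (sym K≡)) (κ-complement c′))) (seven m)))))
      where
      regroup : ∀ a b c d → (a + b) + (c + d) ≡ (a + d) + (b + c)
      regroup = solve-∀
      seven : ∀ m → m + 6 * m ≡ 4 * m + 3 * m
      seven = solve-∀
    bound : t ^ (4 * m) * (t ^ S x y z * n ^ U x y z) ≤ t ^ (m ∸ q) * n ^ q * weight A c′
    bound = begin
      t ^ (4 * m) * (t ^ S x y z * n ^ U x y z)       ≡⟨ sym (ℕ.*-assoc (t ^ (4 * m)) _ _) ⟩
      t ^ (4 * m) * t ^ S x y z * n ^ U x y z         ≡⟨ cong (_* n ^ U x y z) (sym (ℕ.^-distribˡ-+-* t (4 * m) (S x y z))) ⟩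
      t ^ (4 * m + S x y z) * n ^ U x y z             ≤⟨ pow-shift {t} {n} {4 * m + S x y z} {U x y z} {m ∸ q + K′} {K + q} t≤n exponents U≤ ⟩
      t ^ (m ∸ q + K′) * n ^ (K + q)                  ≡⟨ cong₂ _*_ (ℕ.^-distribˡ-+-* t (m ∸ q) K′) (ℕ.^-distribˡ-+-* n K q) ⟩
      t ^ (m ∸ q) * t ^ K′ * (n ^ K * n ^ q)          ≡⟨ regroup (t ^ (m ∸ q)) (t ^ K′) (n ^ K) (n ^ q) ⟩
      t ^ (m ∸ q) * n ^ q * (t ^ K′ * n ^ K)          ≡⟨ cong (λ k → t ^ (m ∸ q) * n ^ q * (t ^ K′ * n ^ k)) (sym K≡) ⟩
      t ^ (m ∸ q) * n ^ q * (t ^ K′ * n ^ ∑ pts (κ ∘ c′)) ≡⟨ cong (t ^ (m ∸ q) * n ^ q *_) (sym (weight-els A c′)) ⟩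
      t ^ (m ∸ q) * n ^ q * weight A c′               ∎
      where
      open ℕ.≤-Reasoning
      regroup : ∀ a b c d → a * b * (c * d) ≡ a * d * (b * c)
      regroup = solve-∀

  ∑-encoded : 1 ≤ n →
    t ^ (4 * m) * ∑³ (λ x y z → if inLn ℒ x y z then t ^ S x y z * n ^ U x y z else 0)
      ≤ t ^ (m ∸ q) * n ^ q * ∑ (codes A) (weight A)
  ∑-encoded 1≤n = begin
    t ^ (4 * m) * ∑³ h                                                       ≡⟨ sym (∑³-*ˡ (t ^ (4 * m)) h) ⟩
    ∑³ (λ x y z → t ^ (4 * m) * h x y z)                                     ≤⟨ ∑³-mono pointwise ⟩
    ∑³ (λ x y z → ∑ (codes A) (λ c → D * weight A c * 𝟙 (match x y z (decode c n)))) ≡⟨ ∑³-swap {n} (codes A) (λ x y z c → D * weight A c * 𝟙 (match x y z (decode c n))) ⟩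
    ∑ (codes A) (λ c → ∑³ (λ x y z → D * weight A c * 𝟙 (match x y z (decode c n))))
      ≡⟨ ∑-cong (codes A) (λ c → trans (∑³-*ˡ (D * weight A c) (λ x y z → 𝟙 (match x y z (decode c n))))
           (trans (cong (D * weight A c *_) (∑³-match (decode c n))) (ℕ.*-identityʳ _))) ⟩
    ∑ (codes A) (λ c → D * weight A c)                                       ≡⟨ ∑-*ˡ D (codes A) ⟩
    D * ∑ (codes A) (weight A)                                               ∎
    where
    open ℕ.≤-Reasoning
    D = t ^ (m ∸ q) * n ^ q
    h : Pt n → Pt n → Pt n → ℕ
    h x y z = if inLn ℒ x y z then t ^ S x y z * n ^ U x y z else 0
    pointwise : ∀ x y z → t ^ (4 * m) * h x y z ≤ ∑ (codes A) (λ c → D * weight A c * 𝟙 (match x y z (decode c n)))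
    pointwise x y z with inLn ℒ x y z in inl
    ... | false = ℕ.≤-trans (ℕ.≤-reflexive (ℕ.*-zeroʳ (t ^ (4 * m)))) z≤n
    ... | true with encode 1≤n x y z inl
    ...   | c , c∈ , matches , bound = ℕ.≤-trans bound (ℕ.≤-trans (ℕ.≤-reflexive
      (trans (sym (ℕ.*-identityʳ _)) (cong (λ b → D * weight A c * 𝟙 b) (sym matches)))) (∑-∈ c∈))

  ∑-g³ : n ^ m * n ^ m * n ^ m * ∑ (Ln ℒ) (g³ A)
    ≤ B * B * B * ∑³ (λ x y z → if inLn ℒ x y z then t ^ S x y z * n ^ U x y z else 0)
  ∑-g³ = begin
    n ^ m * n ^ m * n ^ m * ∑ (Ln ℒ) (g³ A)                             ≡⟨ cong (n ^ m * n ^ m * n ^ m *_) (∑-Ln ℒ (g³ A)) ⟩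
    n ^ m * n ^ m * n ^ m * ∑³ f                                     ≡⟨ sym (∑³-*ˡ (n ^ m * n ^ m * n ^ m) f) ⟩
    ∑³ (λ x y z → n ^ m * n ^ m * n ^ m * f x y z)                   ≤⟨ ∑³-mono pointwise ⟩
    ∑³ (λ x y z → B * B * B * h x y z)                               ≡⟨ ∑³-*ˡ (B * B * B) h ⟩
    B * B * B * ∑³ h                                                 ∎
    where
    open ℕ.≤-Reasoning
    f h : Pt n → Pt n → Pt n → ℕ
    f x y z = if inLn ℒ x y z then g A x * g A y * g A z else 0
    h x y z = if inLn ℒ x y z then t ^ S x y z * n ^ U x y z else 0
    pointwise : ∀ x y z → n ^ m * n ^ m * n ^ m * f x y z ≤ B * B * B * h x y z
    pointwise x y z with inLn ℒ x y z
    ... | false = ℕ.≤-trans (ℕ.≤-reflexive (ℕ.*-zeroʳ (n ^ m * n ^ m * n ^ m))) z≤n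
    ... | true = begin
      N * N * N * (g A x * g A y * g A z)           ≡⟨ regroup N (g A x) (g A y) (g A z) ⟩
      N * g A x * (N * g A y) * (N * g A z)         ≤⟨ ℕ.*-mono-≤ (ℕ.*-mono-≤ (g-bound x) (g-bound y)) (g-bound z) ⟩
      B * (t ^ s x * n ^ u x) * (B * (t ^ s y * n ^ u y)) * (B * (t ^ s z * n ^ u z))
        ≡⟨ collect B (t ^ s x) (n ^ u x) (t ^ s y) (n ^ u y) (t ^ s z) (n ^ u z) ⟩
      B * B * B * (t ^ s x * t ^ s y * t ^ s z * (n ^ u x * n ^ u y * n ^ u z))
        ≡⟨ cong (B * B * B *_) (sym (cong₂ _*_ (power t (s x) (s y) (s z)) (power n (u x) (u y) (u z)))) ⟩
      B * B * B * (t ^ S x y z * n ^ U x y z)       ∎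
      where
      N = n ^ m
      s u : Pt n → ℕ
      s v = singles (map v pts)
      u v = repeats (map v pts)
      regroup : ∀ N a b c → N * N * N * (a * b * c) ≡ N * a * (N * b) * (N * c)
      regroup = solve-∀
      collect : ∀ B a a′ b b′ c c′ → B * (a * a′) * (B * (b * b′)) * (B * (c * c′)) ≡ B * B * B * (a * b * c * (a′ * b′ * c′))
      collect = solve-∀
      power : ∀ k a b c → k ^ (a + b + c) ≡ k ^ a * k ^ b * k ^ c
      power k a b c = trans (ℕ.^-distribˡ-+-* k (a + b) c) (cong (_* k ^ c) (ℕ.^-distribˡ-+-* k a b))

  Λ-bound : 1 ≤ n → t ^ (4 * m) * (n ^ m * n ^ m * n ^ m * ∑ (Ln ℒ) (g³ A)) * (n * n) ^ m
    ≤ B * B * B * (t ^ (m ∸ q) * n ^ q * ((n * n) ^ n * total true ^ m))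
  Λ-bound 1≤n = begin
    T * (n ^ m * n ^ m * n ^ m * ∑ (Ln ℒ) (g³ A)) * (n * n) ^ m    ≤⟨ ℕ.*-monoˡ-≤ ((n * n) ^ m) (ℕ.*-monoʳ-≤ T ∑-g³) ⟩
    T * (B * B * B * Σh) * (n * n) ^ m                          ≡⟨ regroup T (B * B * B) Σh ((n * n) ^ m) ⟩
    B * B * B * (T * Σh * (n * n) ^ m)                          ≤⟨ ℕ.*-monoʳ-≤ (B * B * B) (ℕ.*-monoˡ-≤ ((n * n) ^ m) (∑-encoded 1≤n)) ⟩
    B * B * B * (D * ∑ (codes A) (weight A) * (n * n) ^ m)      ≡⟨ cong (B * B * B *_) (trans (ℕ.*-assoc D _ _) (cong (D *_) (∑-codes A))) ⟩
    B * B * B * (D * ((n * n) ^ n * total true ^ m))            ∎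
    where
    open ℕ.≤-Reasoning
    T = t ^ (4 * m)
    D = t ^ (m ∸ q) * n ^ q
    Σh = ∑³ (λ x y z → if inLn ℒ x y z then t ^ S x y z * n ^ U x y z else 0)
    regroup : ∀ T b s c → T * (b * s) * c ≡ b * (T * s * c)
    regroup = solve-∀

-- Elementary estimates

-- Any x and y extend to a point of Lⁿ. The length enters the estimate as a denominator, so it has
-- to be bounded from below.
length-Ln : {n : ℕ} (ℒ : LatinSquare n) → n ^ n * n ^ n ≤ length (Ln ℒ)
length-Ln {n} ℒ = begin
  n ^ n * n ^ n                                    ≡⟨ sym (cong₂ _*_ (length-allPts n) (length-allPts n)) ⟩
  length (allPts n) * length (allPts n)            ≡⟨ sym (∑-const (length (allPts n)) (allPts n)) ⟩
  ∑ (allPts n) (λ _ → length (allPts n))           ≡⟨ ∑-cong (allPts n) (λ _ → sym (length-∑ (allPts n))) ⟩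
  ∑ (allPts n) (λ x → ∑ (allPts n) (λ y → 1))      ≤⟨ ∑-mono (allPts n) (λ x → ∑-mono (allPts n) (third x)) ⟩
  ∑³ (λ x y z → if inLn ℒ x y z then 1 else 0)     ≡⟨ sym (∑-Ln ℒ (λ _ → 1)) ⟩
  ∑ (Ln ℒ) (λ _ → 1)                               ≡⟨ length-∑ (Ln ℒ) ⟩
  length (Ln ℒ)                                    ∎
  where
  open ℕ.≤-Reasoning
  pt-∈ : ∀ {k} (f : Fin k → Fin n) → Σ (Fin k → Fin n) λ f′ → f′ ∈ allFuns (allFin n) k × f′ ≗ f
  pt-∈ {zero} f = _ , here refl , λ ()
  pt-∈ {suc k} f with pt-∈ (f ∘ suc)
  ... | f′ , f′∈ , e = _ , concatMap-∈ _ (∈-allFin (f zero)) (∈-map⁺ _ f′∈) , λ { zero → refl ; (suc i) → e i }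
  third : ∀ x y → 1 ≤ ∑ (allPts n) (λ z → if inLn ℒ x y z then 1 else 0)
  third x y with pt-∈ (λ i → proj₁ (LatinSquare.xy ℒ (x i) (y i)))
  ... | z , z∈ , e = ℕ.≤-trans (ℕ.≤-reflexive (cong (λ b → if b then 1 else 0) (sym inl))) (∑-∈ z∈)
    where
    inl : inLn ℒ x y z ≡ true
    inl = foldr-∧⇐ (λ i → LatinSquare.L ℒ (x i) (y i) (z i)) (allFin n) (λ {i} _ →
      subst (λ v → LatinSquare.L ℒ (x i) (y i) v ≡ true) (sym (e i)) (proj₁ (proj₂ (LatinSquare.xy ℒ (x i) (y i)))))

-- The binomial coefficient (k choose j).
subsets# : ℕ → ℕ → ℕ
subsets# k j = ∑ (allSubsets k) (λ A → 𝟙 (does (∣ A ∣ ℕ.≟ j)))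

length-filter-size : {k : ℕ} (j : ℕ) (As : List (Subset k)) →
  length (filter (λ A → ∣ A ∣ ℕ.≟ j) As) ≡ ∑ As (λ A → 𝟙 (does (∣ A ∣ ℕ.≟ j)))
length-filter-size j [] = refl
length-filter-size j (A ∷ As) with does (∣ A ∣ ℕ.≟ j)
... | true = cong suc (length-filter-size j As)
... | false = length-filter-size j As

∑-allSubsets-suc : {k : ℕ} (h : Subset (suc k) → ℕ) →
  ∑ (allSubsets (suc k)) h ≡ ∑ (allSubsets k) (λ s → h (true ∷ s)) + ∑ (allSubsets k) (λ s → h (false ∷ s))
∑-allSubsets-suc {k} h = trans (∑-concatMap _ (allSubsets k)) (trans
  (∑-cong (allSubsets k) (λ s → cong (h (true ∷ s) +_) (ℕ.+-identityʳ _))) (∑-+ (allSubsets k)))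

bernoulli : ∀ k j → suc j * k ^ j + k ^ suc j ≤ suc k ^ suc j
bernoulli k zero = ℕ.≤-reflexive (base k)
  where
  base : ∀ k → 1 * 1 + k * 1 ≡ suc k * 1
  base = solve-∀
bernoulli k (suc j) = begin
  suc (suc j) * (k * k ^ j) + k * (k * k ^ j)     ≡⟨ regroup j k (k ^ j) ⟩
  k * (suc j * k ^ j + k * k ^ j) + k * k ^ j     ≤⟨ ℕ.+-mono-≤ (ℕ.*-monoʳ-≤ k (bernoulli k j)) (ℕ.^-monoˡ-≤ (suc j) (ℕ.n≤1+n k)) ⟩
  k * suc k ^ suc j + suc k ^ suc j               ≡⟨ ℕ.+-comm _ (suc k ^ suc j) ⟩
  suc k ^ suc (suc j)                             ∎
  where
  open ℕ.≤-Reasoning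
  regroup : ∀ j k p → suc (suc j) * (k * p) + k * (k * p) ≡ k * (suc j * p + k * p) + k * p
  regroup = solve-∀

subsets#-bound : ∀ k j → subsets# k j * j ! ≤ k ^ j
subsets#-bound zero zero = ℕ.≤-refl
subsets#-bound zero (suc j) = z≤n
subsets#-bound (suc k) zero rewrite ∑-allSubsets-suc {k} (λ A → 𝟙 (does (∣ A ∣ ℕ.≟ 0))) | ∑-0 (allSubsets k) = subsets#-bound k zero
subsets#-bound (suc k) (suc j) rewrite ∑-allSubsets-suc {k} (λ A → 𝟙 (does (∣ A ∣ ℕ.≟ suc j))) = begin
  (subsets# k j + subsets# k (suc j)) * (suc j * j !)                     ≡⟨ regroup (subsets# k j) (subsets# k (suc j)) j (j !) ⟩
  suc j * (subsets# k j * j !) + subsets# k (suc j) * (suc j * j !)       ≤⟨ ℕ.+-mono-≤ (ℕ.*-monoʳ-≤ (suc j) (subsets#-bound k j)) (subsets#-bound k (suc j)) ⟩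
  suc j * k ^ j + k ^ suc j                                               ≤⟨ bernoulli k j ⟩
  suc k ^ suc j                                                           ∎
  where
  open ℕ.≤-Reasoning
  regroup : ∀ a b j f → (a + b) * (suc j * f) ≡ suc j * (a * f) + b * (suc j * f)
  regroup = solve-∀

rising : ℕ → ℕ → ℕ
rising a zero = 1
rising a (suc m) = suc a * rising (suc a) m

^≤rising : ∀ a m → a ^ m ≤ rising a m
^≤rising a zero = ℕ.≤-refl
^≤rising a (suc m) = ℕ.*-mono-≤ (ℕ.n≤1+n a) (ℕ.≤-trans (ℕ.^-monoˡ-≤ m (ℕ.n≤1+n a)) (^≤rising (suc a) m))

rising-snoc : ∀ a m → rising a (suc m) ≡ rising a m * (suc a + m)
rising-snoc a zero = base a
  where
  base : ∀ a → suc a * 1 ≡ 1 * (suc a + 0)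
  base = solve-∀
rising-snoc a (suc m) = trans (cong (suc a *_) (rising-snoc (suc a) m)) (regroup a (rising (suc a) m) m)
  where
  regroup : ∀ a r m → suc a * (r * (suc (suc a) + m)) ≡ suc a * r * (suc a + suc m)
  regroup = solve-∀

-- The quotient of `rising a m` by m! is the binomial coefficient (a + m choose m), and Pascal's
-- rule bounds it by 2^(a+m). At a = m this gives mᵐ ≤ m! 4ᵐ, which takes the place of Stirling's
-- formula in the bound for the number of sets A.
rising-bound : ∀ a m → rising a m ≤ m ! * 2 ^ (a + m)
rising-bound a zero = ℕ.≤-trans (ℕ.m^n>0 2 (a + 0)) (ℕ.≤-reflexive (sym (ℕ.*-identityˡ _)))
rising-bound zero (suc m) = ℕ.≤-trans (ℕ.≤-reflexive (rising-zero (suc m))) (ℕ.m≤m*n (suc m !) (2 ^ suc m) {{ℕ.m^n≢0 2 (suc m)}})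
  where
  rising-zero : ∀ m → rising 0 m ≡ m !
  rising-zero zero = refl
  rising-zero (suc m) = trans (rising-snoc 0 m) (trans (cong (_* suc m) (rising-zero m)) (ℕ.*-comm (m !) (suc m)))
rising-bound (suc a) (suc m) = begin
  rising (suc a) (suc m)                                         ≡⟨ rising-snoc (suc a) m ⟩
  rising (suc a) m * (suc (suc a) + m)                           ≡⟨ pascal a (rising (suc a) m) m ⟩
  rising a (suc m) + suc m * rising (suc a) m                    ≤⟨ ℕ.+-mono-≤ (rising-bound a (suc m)) (ℕ.*-monoʳ-≤ (suc m) (rising-bound (suc a) m)) ⟩
  suc m ! * 2 ^ (a + suc m) + suc m * (m ! * 2 ^ (suc a + m))    ≡⟨ cong (λ k → suc m ! * 2 ^ (a + suc m) + suc m * (m ! * 2 ^ k)) (sym (ℕ.+-suc a m)) ⟩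
  suc m ! * 2 ^ (a + suc m) + suc m * (m ! * 2 ^ (a + suc m))    ≡⟨ double (suc m) (m !) (2 ^ (a + suc m)) ⟩
  suc m ! * 2 ^ (suc a + suc m)                                  ∎
  where
  open ℕ.≤-Reasoning
  pascal : ∀ a r m → r * (suc (suc a) + m) ≡ suc a * r + suc m * r
  pascal = solve-∀
  double : ∀ k f p → k * f * p + k * (f * p) ≡ k * f * (2 * p)
  double = solve-∀

subsets#-^ : ∀ n m → subsets# n m * m ^ m ≤ n ^ m * 4 ^ m
subsets#-^ n m = begin
  subsets# n m * m ^ m                  ≤⟨ ℕ.*-monoʳ-≤ (subsets# n m) (ℕ.≤-trans (^≤rising m m) (rising-bound m m)) ⟩
  subsets# n m * (m ! * 2 ^ (m + m))    ≡⟨ sym (ℕ.*-assoc (subsets# n m) (m !) _) ⟩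
  subsets# n m * m ! * 2 ^ (m + m)      ≤⟨ ℕ.*-monoˡ-≤ (2 ^ (m + m)) (subsets#-bound n m) ⟩
  n ^ m * 2 ^ (m + m)                   ≡⟨ cong (n ^ m *_) (trans (ℕ.^-distribˡ-+-* 2 m m) (sym (^-distrib-* 2 2 m))) ⟩
  n ^ m * 4 ^ m                         ∎
  where open ℕ.≤-Reasoning

-- With r = ⌊ b / a ⌋, this is 1 + b / a ≤ 2 + r ≤ 2 ^ (1 + r) raised to the power a.
[a+b]^a : ∀ a b .{{_ : NonZero a}} → (a + b) ^ a ≤ a ^ a * 2 ^ (a + b)
[a+b]^a a b = begin
  (a + b) ^ a                ≤⟨ ℕ.^-monoˡ-≤ a a+b≤ ⟩
  (a * 2 ^ suc r) ^ a        ≡⟨ ^-distrib-* a (2 ^ suc r) a ⟩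
  a ^ a * (2 ^ suc r) ^ a    ≡⟨ cong (a ^ a *_) (ℕ.^-*-assoc 2 (suc r) a) ⟩
  a ^ a * 2 ^ (suc r * a)    ≤⟨ ℕ.*-monoʳ-≤ (a ^ a) (ℕ.^-monoʳ-≤ 2 (ℕ.+-monoʳ-≤ a (ℕ.m/n*n≤m b a))) ⟩
  a ^ a * 2 ^ (a + b)        ∎
  where
  open ℕ.≤-Reasoning
  r = b ℕ./ a
  2+r≤ : ∀ r → 2 + r ≤ 2 ^ suc r
  2+r≤ zero = ℕ.≤-refl
  2+r≤ (suc r) = ℕ.≤-trans (ℕ.+-mono-≤ (ℕ.m^n>0 2 (suc r)) (2+r≤ r)) (ℕ.≤-reflexive (double (2 ^ suc r)))
    where
    double : ∀ p → p + p ≡ 2 * p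
    double = solve-∀
  regroup : ∀ a r → a + (a + r * a) ≡ a * (2 + r)
  regroup = solve-∀
  a+b≤ : a + b ≤ a * 2 ^ suc r
  a+b≤ = begin
    a + b                    ≡⟨ cong (λ k → a + k) (ℕ.m≡m%n+[m/n]*n b a) ⟩
    a + (b ℕ.% a + r * a)    ≤⟨ ℕ.+-monoʳ-≤ a (ℕ.+-monoˡ-≤ (r * a) (ℕ.<⇒≤ (ℕ.m%n<n b a))) ⟩
    a + (a + r * a)          ≡⟨ regroup a r ⟩
    a * (2 + r)              ≤⟨ ℕ.*-monoʳ-≤ a (2+r≤ r) ⟩
    a * 2 ^ suc r            ∎

isqrt : ∀ N → Σ ℕ λ s → s * s ≤ N × N < suc s * suc s
isqrt zero = 0 , z≤n , s≤s z≤n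
isqrt (suc N) with isqrt N
... | s , lo , hi with suc s * suc s ≤? suc N
...   | yes le = suc s , le , ℕ.≤-<-trans hi (ℕ.*-mono-< (ℕ.n<1+n (suc s)) (ℕ.n<1+n (suc s)))
...   | no gt = s , ℕ.m≤n⇒m≤1+n lo , ℕ.≰⇒> gt

square-cancel : ∀ {a b} → a * a ≤ b * b → a ≤ b
square-cancel {a} {b} h with a ≤? b
... | yes le = le
... | no gt = contradiction h (ℕ.<⇒≱ (ℕ.*-mono-< (ℕ.≰⇒> gt) (ℕ.≰⇒> gt)))

-- Here t lies between 2√N and 4√N. For N = mn the lower bound leaves room for the term m t in H,
-- and the upper one keeps t comparable to nθ. In the witness, 1 + s is the integer part of √N.
root : ∀ N → 1 ≤ N → Σ ℕ λ t → 4 * N ≤ t * t × t * t ≤ 16 * N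
root N 1≤N with isqrt N
... | zero , lo , hi = contradiction hi (ℕ.≤⇒≯ 1≤N)
... | suc s , lo , hi = 2 * (2 + s) ,
  ℕ.≤-trans (ℕ.*-monoʳ-≤ 4 (ℕ.<⇒≤ hi)) (ℕ.≤-reflexive (four s)) ,
  ℕ.≤-trans (ℕ.≤-trans (ℕ.m≤m+n _ (12 * s * s + 16 * s)) (ℕ.≤-reflexive (sixteen s))) (ℕ.*-monoʳ-≤ 16 lo)
  where
  four : ∀ s → 4 * (suc (suc s) * suc (suc s)) ≡ 2 * (2 + s) * (2 * (2 + s))
  four = solve-∀
  sixteen : ∀ s → 2 * (2 + s) * (2 * (2 + s)) + (12 * s * s + 16 * s) ≡ 16 * (suc s * suc s)
  sixteen = solve-∀

-- Assembling the bound

-- Kept abstract because Agda unfolds a product with a literal on the left in unary.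
abstract
  4⁸ 14⁸ 16⁹ C₀ C₀⁸ : ℕ
  4⁸ = 4 ^ 8
  14⁸ = 14 ^ 8
  16⁹ = 16 ^ 9
  -- One 4 comes from the binomial coefficient, 4³ from the three pointwise bounds, 14 from
  -- `R-bound`, and 16² exceeds the eighth root of 16⁹, which stems from t¹⁸.
  C₀ = 4 * 4 ^ 3 * 16 ^ 2 * 14
  C₀⁸ = C₀ ^ 8

  4⁸≡ : 4 ^ 8 ≡ 4⁸
  4⁸≡ = refl

  14⁸≡ : 14 ^ 8 ≡ 14⁸
  14⁸≡ = refl

  16⁹≡ : 16 ^ 9 ≡ 16⁹
  16⁹≡ = refl

  C₀⁸≡ : C₀ ^ 8 ≡ C₀⁸
  C₀⁸≡ = refl

  2≤C₀ : 2 ≤ C₀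
  2≤C₀ = ℕ.≤ᵇ⇒≤ 2 C₀ _

  constants≤C₀⁸ : 4⁸ * (4⁸ * 4⁸ * 4⁸) * 14⁸ * 16⁹ ≤ C₀⁸
  constants≤C₀⁸ = ℕ.≤ᵇ⇒≤ (4⁸ * (4⁸ * 4⁸ * 4⁸) * 14⁸ * 16⁹) C₀⁸ _

distrib-by : ∀ {a a′} b k → a ^ k ≡ a′ → (a * b) ^ k ≡ a′ * b ^ k
distrib-by {a} b k e = trans (^-distrib-* a b k) (cong (_* b ^ k) e)

symbolTotal : (n m t : ℕ) → ℕ
symbolTotal n m t = n * (n * (t ^ 6 * 1)) + (3 * (m * (n * (t ^ 4 * n ^ 2))) + (3 * (m * (m * (t ^ 2 * n ^ 4))) + m * (1 * n ^ 6)))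

-- By mn ≤ t² the free symbols, the three directions of `one` and the three of `two` each weigh at
-- most n² t⁶, which gives the 7. The copies `same` weigh m n⁶, at most n² t⁶ times n/m²; this is
-- where the summand n arises.
symbolTotal-bound : ∀ n m t → m * n ≤ t * t → m * m * symbolTotal n m t ≤ n * n * t ^ 6 * (7 * (m * m + n))
symbolTotal-bound n m t h = begin
  m * m * symbolTotal n m t
    ≡⟨ expand n m t ⟩
  n * n * (m * m) * (p * p * p + 3 * (r * (p * p)) + 3 * (r * (r * p))) + n * n * n * (r * (r * r))
    ≤⟨ ℕ.+-mono-≤ (ℕ.*-monoʳ-≤ (n * n * (m * m)) (ℕ.+-mono-≤ (ℕ.+-monoʳ-≤ (p * p * p) (ℕ.*-monoʳ-≤ 3 (ℕ.*-monoˡ-≤ (p * p) h)))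
         (ℕ.*-monoʳ-≤ 3 (ℕ.*-mono-≤ h (ℕ.*-monoˡ-≤ p h)))))
         (ℕ.*-monoʳ-≤ (n * n * n) (ℕ.*-mono-≤ h (ℕ.*-mono-≤ h h))) ⟩
  n * n * (m * m) * (p * p * p + 3 * (p * (p * p)) + 3 * (p * (p * p))) + n * n * n * (p * (p * p))
    ≤⟨ ℕ.m≤m+n _ (6 * (n * n * n * (p * (p * p)))) ⟩
  n * n * (m * m) * (p * p * p + 3 * (p * (p * p)) + 3 * (p * (p * p))) + n * n * n * (p * (p * p)) + 6 * (n * n * n * (p * (p * p)))
    ≡⟨ collect n m t ⟩
  n * n * t ^ 6 * (7 * (m * m + n)) ∎
  where
  open ℕ.≤-Reasoning
  p = t * t
  r = m * n
  expand : ∀ n m t → m * m * (n * (n * ((t * (t * (t * (t * (t * (t * 1)))))) * 1)) + (3 * (m * (n * ((t * (t * (t * (t * 1)))) * (n * (n * 1))))) + (3 * (m * (m * ((t * (t * 1)) * (n * (n * (n * (n * 1))))))) + m * (1 * (n * (n * (n * (n * (n * (n * 1))))))))))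
    ≡ n * n * (m * m) * (t * t * (t * t) * (t * t) + 3 * (m * n * (t * t * (t * t))) + 3 * (m * n * (m * n * (t * t)))) + n * n * n * (m * n * (m * n * (m * n)))
  expand = solve-∀
  collect : ∀ n m t → n * n * (m * m) * (t * t * (t * t) * (t * t) + 3 * (t * t * (t * t * (t * t))) + 3 * (t * t * (t * t * (t * t)))) + n * n * n * (t * t * (t * t * (t * t))) + 6 * (n * n * n * (t * t * (t * t * (t * t))))
    ≡ n * n * (t * (t * (t * (t * (t * (t * 1)))))) * (7 * (m * m + n))
  collect = solve-∀

module Main {n : ℕ} (ℒ : LatinSquare n) (m t : ℕ) (1≤m : 1 ≤ m) (2m≤n : 2 * m ≤ n) (t≤n : t ≤ n) (m≤t : m ≤ t)
  (H : m * t + m * n ≤ t * t) (t²≤ : t * t ≤ 16 * (m * n)) where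

  private
    1≤n : 1 ≤ n
    1≤n = ℕ.≤-trans 1≤m (ℕ.≤-trans m≤t t≤n)
    1≤t : 1 ≤ t
    1≤t = ℕ.≤-trans 1≤m m≤t
    instance
      n≢0 : NonZero n
      n≢0 = ℕ.>-nonZero 1≤n
      m≢0 : NonZero m
      m≢0 = ℕ.>-nonZero 1≤m
      t≢0 : NonZero t
      t≢0 = ℕ.>-nonZero 1≤t

    o : Tri n
    o = v , v , v
      where
      v : Fin n
      v = fromℕ< 1≤n

    q = 3 * m ℕ./ 4
    T = t ^ (4 * m)
    B³ = n ! * 4 ^ m * (n ! * 4 ^ m) * (n ! * 4 ^ m)
    V = t ^ (m ∸ q) * n ^ q
    nᵐ = n ^ m
    N = subsets# n m
    E = 8 * m
    M = m * m

  per-set : ∀ A → ∣ A ∣ ≡ m →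
    T * (nᵐ * nᵐ * nᵐ * ∑ (Ln ℒ) (g³ A)) * (n * n) ^ m ≤ B³ * (V * ((n * n) ^ n * symbolTotal n m t ^ m))
  per-set A refl = ℕ.≤-trans (Λ-bound 1≤n)
    (ℕ.≤-reflexive (cong (λ z → B³ * (V * ((n * n) ^ n * z ^ m))) total-true))
    where open Weights ℒ o A t t≤n 2m≤n m≤t H using (Λ-bound; total-true)

  all-sets : T * (nᵐ * nᵐ * nᵐ * sumA ℒ m) * (n * n) ^ m ≤ N * (B³ * (V * ((n * n) ^ n * symbolTotal n m t ^ m)))
  all-sets = begin
    T * (nᵐ * nᵐ * nᵐ * sumA ℒ m) * (n * n) ^ m
      ≡⟨ regroup T (nᵐ * nᵐ * nᵐ) (sumA ℒ m) ((n * n) ^ m) ⟩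
    T * (nᵐ * nᵐ * nᵐ) * (n * n) ^ m * sumA ℒ m
      ≡⟨ sym (∑-*ˡ (T * (nᵐ * nᵐ * nᵐ) * (n * n) ^ m) As) ⟩
    ∑ As (λ A → T * (nᵐ * nᵐ * nᵐ) * (n * n) ^ m * ∑ (Ln ℒ) (g³ A))
      ≤⟨ ∑-≤-const c As (λ {A} A∈ → ℕ.≤-trans
           (ℕ.≤-reflexive (sym (regroup T (nᵐ * nᵐ * nᵐ) (∑ (Ln ℒ) (g³ A)) ((n * n) ^ m))))
           (per-set A (proj₂ (∈-filter⁻ (λ A → ∣ A ∣ ℕ.≟ m) {xs = allSubsets n} A∈)))) ⟩
    length As * c
      ≡⟨ cong (_* c) (length-filter-size m (allSubsets n)) ⟩
    N * c ∎
    where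
    open ℕ.≤-Reasoning
    As = filter (λ A → ∣ A ∣ ℕ.≟ m) (allSubsets n)
    c = B³ * (V * ((n * n) ^ n * symbolTotal n m t ^ m))
    regroup : ∀ T a s b → T * (a * s) * b ≡ T * a * b * s
    regroup = solve-∀

  -- Of the three factors mᵐ, one turns the binomial coefficient into (4n)ᵐ and two supply the m² of
  -- `symbolTotal-bound`.
  base-bound : nᵐ * nᵐ * nᵐ * sumA ℒ m * (m ^ m * m ^ m * m ^ m)
    ≤ (nᵐ * 4 ^ m) * (B³ * (V * ((n * n) ^ n * ((t ^ m * t ^ m) * (7 * (M + n)) ^ m))))
  base-bound = ℕ.*-cancelˡ-≤ (T * (n * n) ^ m) {{ℕ.m*n≢0 T ((n * n) ^ m) {{ℕ.m^n≢0 t (4 * m)}} {{ℕ.m^n≢0 (n * n) m {{ℕ.m*n≢0 n n}}}}}} (begin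
    T * W * (S * (μ * μ * μ))
      ≡⟨ regroup₁ T W S μ ⟩
    T * S * W * (μ * μ * μ)
      ≤⟨ ℕ.*-monoˡ-≤ (μ * μ * μ) all-sets ⟩
    N * (B³ * (V * (G′ * ζ ^ m))) * (μ * μ * μ)
      ≡⟨ regroup₂ N B³ V G′ (ζ ^ m) μ ⟩
    N * μ * (B³ * (V * (G′ * (μ * μ * ζ ^ m))))
      ≡⟨ cong (λ z → N * μ * (B³ * (V * (G′ * z)))) (trans (cong (_* ζ ^ m) (sym (^-distrib-* m m m))) (sym (^-distrib-* (m * m) ζ m))) ⟩
    N * μ * (B³ * (V * (G′ * (m * m * ζ) ^ m)))
      ≤⟨ ℕ.*-mono-≤ (subsets#-^ n m) (ℕ.*-monoʳ-≤ B³ (ℕ.*-monoʳ-≤ V (ℕ.*-monoʳ-≤ G′ (ℕ.^-monoˡ-≤ m (symbolTotal-bound n m t mn≤t²))))) ⟩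
    nᵐ * 4 ^ m * (B³ * (V * (G′ * (n * n * t ^ 6 * (7 * (M + n))) ^ m)))
      ≡⟨ cong (λ z → nᵐ * 4 ^ m * (B³ * (V * (G′ * z)))) split ⟩
    nᵐ * 4 ^ m * (B³ * (V * (G′ * (T * W * (t ^ m * t ^ m * R)))))
      ≡⟨ regroup₃ (T * W) (nᵐ * 4 ^ m) B³ V G′ (t ^ m * t ^ m * R) ⟩
    T * W * ((nᵐ * 4 ^ m) * (B³ * (V * (G′ * (t ^ m * t ^ m * R))))) ∎)
    where
    open ℕ.≤-Reasoning
    W = (n * n) ^ m
    G′ = (n * n) ^ n
    μ = m ^ m
    ζ = symbolTotal n m t
    S = nᵐ * nᵐ * nᵐ * sumA ℒ m
    R = (7 * (M + n)) ^ m
    mn≤t² : m * n ≤ t * t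
    mn≤t² = ℕ.≤-trans (ℕ.m≤n+m (m * n) (m * t)) H
    split : (n * n * t ^ 6 * (7 * (M + n))) ^ m ≡ T * W * (t ^ m * t ^ m * R)
    split = trans (^-distrib-* (n * n * t ^ 6) (7 * (M + n)) m)
      (trans (cong (_* R) (trans (^-distrib-* (n * n) (t ^ 6) m) (cong (W *_) t⁶ᵐ))) (regroup₄ W T (t ^ m) R))
      where
      six : ∀ m → 6 * m ≡ 4 * m + (m + m)
      six = solve-∀
      t⁶ᵐ : (t ^ 6) ^ m ≡ T * (t ^ m * t ^ m)
      t⁶ᵐ = trans (ℕ.^-*-assoc t 6 m) (trans (cong (t ^_) (six m))
        (trans (ℕ.^-distribˡ-+-* t (4 * m) (m + m)) (cong (T *_) (ℕ.^-distribˡ-+-* t m m))))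
      regroup₄ : ∀ W T a R → W * (T * (a * a)) * R ≡ T * W * (a * a * R)
      regroup₄ = solve-∀
    regroup₁ : ∀ T W S μ → T * W * (S * (μ * μ * μ)) ≡ T * S * W * (μ * μ * μ)
    regroup₁ = solve-∀
    regroup₂ : ∀ N B V G ζ μ → N * (B * (V * (G * ζ))) * (μ * μ * μ) ≡ N * μ * (B * (V * (G * (μ * μ * ζ))))
    regroup₂ = solve-∀
    regroup₃ : ∀ T a b c d e → a * (b * (c * (d * (T * e)))) ≡ T * (a * (b * (c * (d * e))))
    regroup₃ = solve-∀

  -- The exponent E = 8m turns every m-th power into an M-th power for M = m², so that finally only
  -- the bases have to be compared.
  pow₈ : ∀ x → (x ^ m) ^ E ≡ (x ^ 8) ^ M
  pow₈ x = trans (ℕ.^-*-assoc x m (8 * m)) (trans (cong (x ^_) (eight m)) (sym (ℕ.^-*-assoc x 8 (m * m))))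
    where
    eight : ∀ m → m * (8 * m) ≡ 8 * (m * m)
    eight = solve-∀

  -- The fourth power removes the rounding in q: it replaces 4q by 3m at the expense of factors t.
  V-bound : V ^ E ≤ (t ^ 2 * n ^ 6) ^ M
  V-bound = begin
    V ^ E                                           ≡⟨ cong (V ^_) (four m) ⟩
    V ^ (4 * (2 * m))                               ≡⟨ sym (ℕ.^-*-assoc V 4 (2 * m)) ⟩
    (V ^ 4) ^ (2 * m)                               ≤⟨ ℕ.^-monoˡ-≤ (2 * m) V⁴ ⟩
    (t ^ m * n ^ (3 * m)) ^ (2 * m)                 ≡⟨ ^-distrib-* (t ^ m) (n ^ (3 * m)) (2 * m) ⟩
    (t ^ m) ^ (2 * m) * (n ^ (3 * m)) ^ (2 * m)     ≡⟨ cong₂ _*_ (exponent t m 2 (two-M m)) (exponent n (3 * m) 6 (six-M m)) ⟩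
    (t ^ 2) ^ M * (n ^ 6) ^ M                       ≡⟨ sym (^-distrib-* (t ^ 2) (n ^ 6) M) ⟩
    (t ^ 2 * n ^ 6) ^ M                             ∎
    where
    open ℕ.≤-Reasoning
    four : ∀ m → 8 * m ≡ 4 * (2 * m)
    four = solve-∀
    two-M : ∀ m → m * (2 * m) ≡ 2 * (m * m)
    two-M = solve-∀
    six-M : ∀ m → 3 * m * (2 * m) ≡ 6 * (m * m)
    six-M = solve-∀
    exponent : ∀ x a k → a * (2 * m) ≡ k * M → (x ^ a) ^ (2 * m) ≡ (x ^ k) ^ M
    exponent x a k e = trans (ℕ.^-*-assoc x a (2 * m)) (trans (cong (x ^_) e) (sym (ℕ.^-*-assoc x k M)))
    q4≤ : q * 4 ≤ 3 * m
    q4≤ = ℕ.m/n*n≤m (3 * m) 4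
    q≤m : q ≤ m
    q≤m = ℕ.*-cancelʳ-≤ q m 4 (ℕ.≤-trans q4≤ (ℕ.≤-trans (ℕ.*-monoˡ-≤ m (ℕ.n≤1+n 3)) (ℕ.≤-reflexive (ℕ.*-comm 4 m))))
    exps : (m ∸ q) * 4 + q * 4 ≡ m + 3 * m
    exps = trans (sym (ℕ.*-distribʳ-+ 4 (m ∸ q) q)) (trans (cong (_* 4) (ℕ.m∸n+n≡m q≤m)) (ℕ.*-comm m 4))
    V⁴ : V ^ 4 ≤ t ^ m * n ^ (3 * m)
    V⁴ = begin
      V ^ 4                                 ≡⟨ ^-distrib-* (t ^ (m ∸ q)) (n ^ q) 4 ⟩
      (t ^ (m ∸ q)) ^ 4 * (n ^ q) ^ 4       ≡⟨ cong₂ _*_ (ℕ.^-*-assoc t (m ∸ q) 4) (ℕ.^-*-assoc n q 4) ⟩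
      t ^ ((m ∸ q) * 4) * n ^ (q * 4)       ≤⟨ pow-shift {t} {n} {(m ∸ q) * 4} {q * 4} {m} {3 * m} t≤n exps q4≤ ⟩
      t ^ m * n ^ (3 * m)                   ∎

  -- The factor 2ⁿ from `[a+b]^a` is the origin of n/m in the exponent of the theorem: its eighth
  -- power becomes 2^(n/m) after the 8m-th root.
  R-bound : ((7 * (M + n)) ^ 8) ^ M ≤ (14⁸ * (m ^ 8 * m ^ 8)) ^ M * (2 ^ 8) ^ n
  R-bound = begin
    ((7 * (M + n)) ^ 8) ^ M                       ≡⟨ swap^ (7 * (M + n)) 8 M ⟩
    ((7 * (M + n)) ^ M) ^ 8                       ≤⟨ ℕ.^-monoˡ-≤ 8 inner ⟩
    ((14 * (m * m)) ^ M * 2 ^ n) ^ 8              ≡⟨ ^-distrib-* ((14 * (m * m)) ^ M) (2 ^ n) 8 ⟩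
    ((14 * (m * m)) ^ M) ^ 8 * (2 ^ n) ^ 8        ≡⟨ cong₂ _*_ (swap^ (14 * (m * m)) M 8) (swap^ 2 n 8) ⟩
    ((14 * (m * m)) ^ 8) ^ M * (2 ^ 8) ^ n        ≡⟨ cong (λ z → z ^ M * (2 ^ 8) ^ n) (trans (distrib-by {14} (m * m) 8 14⁸≡) (cong (14⁸ *_) (^-distrib-* m m 8))) ⟩
    (14⁸ * (m ^ 8 * m ^ 8)) ^ M * (2 ^ 8) ^ n  ∎
    where
    open ℕ.≤-Reasoning
    swap^ : ∀ x a b → (x ^ a) ^ b ≡ (x ^ b) ^ a
    swap^ x a b = trans (ℕ.^-*-assoc x a b) (trans (cong (x ^_) (ℕ.*-comm a b)) (sym (ℕ.^-*-assoc x b a)))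
    inner : (7 * (M + n)) ^ M ≤ (14 * (m * m)) ^ M * 2 ^ n
    inner = begin
      (7 * (M + n)) ^ M                       ≡⟨ ^-distrib-* 7 (M + n) M ⟩
      7 ^ M * (M + n) ^ M                     ≤⟨ ℕ.*-monoʳ-≤ (7 ^ M) ([a+b]^a M n {{ℕ.m*n≢0 m m}}) ⟩
      7 ^ M * (M ^ M * 2 ^ (M + n))           ≡⟨ cong (λ z → 7 ^ M * (M ^ M * z)) (ℕ.^-distribˡ-+-* 2 M n) ⟩
      7 ^ M * (M ^ M * (2 ^ M * 2 ^ n))       ≡⟨ regroup (7 ^ M) (M ^ M) (2 ^ M) (2 ^ n) ⟩
      7 ^ M * 2 ^ M * M ^ M * 2 ^ n           ≡⟨ cong (λ z → z * M ^ M * 2 ^ n) (sym (^-distrib-* 7 2 M)) ⟩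
      14 ^ M * M ^ M * 2 ^ n                  ≡⟨ cong (_* 2 ^ n) (sym (^-distrib-* 14 M M)) ⟩
      (14 * (m * m)) ^ M * 2 ^ n              ∎
      where
      regroup : ∀ a b c d → a * (b * (c * d)) ≡ a * c * b * d
      regroup = solve-∀

  -- Before cancellation each of the M factors has n²⁴ m²⁴ on the left and n²³ m²⁵ on the right. The
  -- surplus m/n, raised to M = m², is the 8m-th power of (m/n)^(m/8).
  power-bound : sumA ℒ m ^ E * n ^ M ≤ (n ! * n ! * n !) ^ E * ((n * n) ^ n) ^ E * (2 ^ 8) ^ n * C₀⁸ ^ M * m ^ M
  power-bound = ℕ.*-cancelˡ-≤ ((n ^ 23) ^ M * (m ^ 24) ^ M) {{ℕ.m*n≢0 _ _ {{ℕ.m^n≢0 (n ^ 23) M {{ℕ.m^n≢0 n 23}}}} {{ℕ.m^n≢0 (m ^ 24) M {{ℕ.m^n≢0 m 24}}}}}} (begin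
    (n ^ 23) ^ M * (m ^ 24) ^ M * (S * n ^ M)
      ≡⟨ left ⟩
    (nᵐ * nᵐ * nᵐ * sumA ℒ m * (m ^ m * m ^ m * m ^ m)) ^ E
      ≤⟨ ℕ.^-monoˡ-≤ E base-bound ⟩
    ((nᵐ * 4 ^ m) * (B³ * (V * ((n * n) ^ n * ((t ^ m * t ^ m) * R))))) ^ E
      ≡⟨ right ⟩
    (n ^ 8) ^ M * a * (F * (a * a * a) * (V ^ E * (G′ * ((t ^ 8) ^ M * (t ^ 8) ^ M * ((7 * (M + n)) ^ 8) ^ M))))
      ≤⟨ ℕ.*-monoʳ-≤ ((n ^ 8) ^ M * a) (ℕ.*-monoʳ-≤ (F * (a * a * a)) (ℕ.*-mono-≤ V-bound (ℕ.*-monoʳ-≤ G′ (ℕ.*-monoʳ-≤ ((t ^ 8) ^ M * (t ^ 8) ^ M) R-bound)))) ⟩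
    (n ^ 8) ^ M * a * (F * (a * a * a) * ((t ^ 2 * n ^ 6) ^ M * (G′ * ((t ^ 8) ^ M * (t ^ 8) ^ M * ((14⁸ * (m ^ 8 * m ^ 8)) ^ M * c)))))
      ≡⟨ gather ⟩
    F * G′ * c * (n ^ 8 * 4⁸ * (4⁸ * 4⁸ * 4⁸) * (t ^ 2 * n ^ 6) * (t ^ 8 * t ^ 8) * (14⁸ * (m ^ 8 * m ^ 8))) ^ M
      ≤⟨ ℕ.*-monoʳ-≤ (F * G′ * c) (ℕ.^-monoˡ-≤ M bracket) ⟩
    F * G′ * c * (C₀⁸ * (n ^ 23 * m ^ 25)) ^ M
      ≡⟨ finish ⟩
    (n ^ 23) ^ M * (m ^ 24) ^ M * (F * G′ * c * C₀⁸ ^ M * m ^ M) ∎)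
    where
    open ℕ.≤-Reasoning
    S = sumA ℒ m ^ E
    R = (7 * (M + n)) ^ m
    F = (n ! * n ! * n !) ^ E
    G′ = ((n * n) ^ n) ^ E
    c = (2 ^ 8) ^ n
    a = (4⁸) ^ M
    pow₈-4 : (4 ^ m) ^ E ≡ a
    pow₈-4 = trans (pow₈ 4) (cong (_^ M) 4⁸≡)
    d₃ : ∀ x y z k → (x * y * z) ^ k ≡ x ^ k * y ^ k * z ^ k
    d₃ x y z k = trans (^-distrib-* (x * y) z k) (cong (_* z ^ k) (^-distrib-* x y k))
    cube₈ : ∀ x → (x ^ m * x ^ m * x ^ m) ^ E ≡ (x ^ 24) ^ M
    cube₈ x = trans (d₃ (x ^ m) (x ^ m) (x ^ m) E) (trans (cong₂ _*_ (cong₂ _*_ (pow₈ x) (pow₈ x)) (pow₈ x))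
      (trans (sym (d₃ (x ^ 8) (x ^ 8) (x ^ 8) M)) (cong (_^ M) (sym (trans (ℕ.^-distribˡ-+-* x 16 8) (cong (_* x ^ 8) (ℕ.^-distribˡ-+-* x 8 8)))))))
    left : (n ^ 23) ^ M * (m ^ 24) ^ M * (S * n ^ M) ≡ (nᵐ * nᵐ * nᵐ * sumA ℒ m * (m ^ m * m ^ m * m ^ m)) ^ E
    left = sym (trans (d₃ (nᵐ * nᵐ * nᵐ) (sumA ℒ m) _ E) (trans (cong₂ (λ u v → u * S * v) (cube₈ n) (cube₈ m))
      (trans (cong (λ u → u * S * (m ^ 24) ^ M) (^-distrib-* n (n ^ 23) M)) (regroup (n ^ M) ((n ^ 23) ^ M) S ((m ^ 24) ^ M)))))
      where
      regroup : ∀ a b s c → a * b * s * c ≡ b * c * (s * a)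
      regroup = solve-∀
    B³-power : B³ ^ E ≡ F * (a * a * a)
    B³-power = trans (cong (_^ E) (regroup (n !) (4 ^ m))) (trans (^-distrib-* (n ! * n ! * n !) _ E)
      (cong (F *_) (trans (d₃ (4 ^ m) (4 ^ m) (4 ^ m) E) (cong₂ _*_ (cong₂ _*_ pow₈-4 pow₈-4) pow₈-4))))
      where
      regroup : ∀ f p → f * p * (f * p) * (f * p) ≡ f * f * f * (p * p * p)
      regroup = solve-∀
    right : ((nᵐ * 4 ^ m) * (B³ * (V * ((n * n) ^ n * ((t ^ m * t ^ m) * R))))) ^ E
      ≡ (n ^ 8) ^ M * a * (F * (a * a * a) * (V ^ E * (G′ * ((t ^ 8) ^ M * (t ^ 8) ^ M * ((7 * (M + n)) ^ 8) ^ M))))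
    right = trans (^-distrib-* (nᵐ * 4 ^ m) _ E) (cong₂ _*_ (two-factors nᵐ (4 ^ m) (pow₈ n) pow₈-4)
      (trans (^-distrib-* B³ _ E) (cong₂ _*_ B³-power
      (trans (^-distrib-* V _ E) (cong (V ^ E *_)
      (trans (^-distrib-* ((n * n) ^ n) _ E) (cong (G′ *_)
      (two-factors (t ^ m * t ^ m) R (two-factors (t ^ m) (t ^ m) (pow₈ t) (pow₈ t)) (pow₈ (7 * (M + n)))))))))))
      where
      two-factors : ∀ x y {x′ y′} → x ^ E ≡ x′ → y ^ E ≡ y′ → (x * y) ^ E ≡ x′ * y′
      two-factors x y e e′ = trans (^-distrib-* x y E) (cong₂ _*_ e e′)
    gather : (n ^ 8) ^ M * a * (F * (a * a * a) * ((t ^ 2 * n ^ 6) ^ M * (G′ * ((t ^ 8) ^ M * (t ^ 8) ^ M * ((14⁸ * (m ^ 8 * m ^ 8)) ^ M * c)))))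
      ≡ F * G′ * c * (n ^ 8 * 4⁸ * (4⁸ * 4⁸ * 4⁸) * (t ^ 2 * n ^ 6) * (t ^ 8 * t ^ 8) * (14⁸ * (m ^ 8 * m ^ 8))) ^ M
    gather = trans (regroup ((n ^ 8) ^ M) a F ((t ^ 2 * n ^ 6) ^ M) G′ ((t ^ 8) ^ M) ((14⁸ * (m ^ 8 * m ^ 8)) ^ M) c)
      (cong (F * G′ * c *_) (sym (merge (n ^ 8) (4⁸) (t ^ 2 * n ^ 6) (t ^ 8) (14⁸ * (m ^ 8 * m ^ 8)))))
      where
      regroup : ∀ n a F v G t r c → n * a * (F * (a * a * a) * (v * (G * (t * t * (r * c))))) ≡ F * G * c * (n * a * (a * a * a) * v * (t * t) * r)
      regroup = solve-∀
      merge : ∀ n a v t r → (n * a * (a * a * a) * v * (t * t) * r) ^ M ≡ n ^ M * a ^ M * (a ^ M * a ^ M * a ^ M) * v ^ M * (t ^ M * t ^ M) * r ^ M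
      merge n a v t r = trans (d₃ (n * a * (a * a * a) * v) (t * t) r M)
        (cong₂ (λ x y → x * y * r ^ M)
          (trans (d₃ (n * a) (a * a * a) v M) (cong₂ (λ x y → x * y * v ^ M) (^-distrib-* n a M) (d₃ a a a M)))
          (^-distrib-* t t M))
    bracket : n ^ 8 * 4⁸ * (4⁸ * 4⁸ * 4⁸) * (t ^ 2 * n ^ 6) * (t ^ 8 * t ^ 8) * (14⁸ * (m ^ 8 * m ^ 8)) ≤ C₀⁸ * (n ^ 23 * m ^ 25)
    bracket = begin
      n ^ 8 * 4⁸ * (4⁸ * 4⁸ * 4⁸) * (t ^ 2 * n ^ 6) * (t ^ 8 * t ^ 8) * (14⁸ * (m ^ 8 * m ^ 8))
        ≡⟨ regroup (n ^ 8) (4⁸) (t ^ 2) (n ^ 6) (t ^ 8) (14⁸) (m ^ 8) ⟩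
      4⁸ * (4⁸ * 4⁸ * 4⁸) * 14⁸ * (t ^ 2 * t ^ 8 * t ^ 8) * (n ^ 8 * n ^ 6 * (m ^ 8 * m ^ 8))
        ≤⟨ ℕ.*-monoˡ-≤ (n ^ 8 * n ^ 6 * (m ^ 8 * m ^ 8)) (ℕ.*-monoʳ-≤ (4⁸ * (4⁸ * 4⁸ * 4⁸) * 14⁸) t¹⁸) ⟩
      4⁸ * (4⁸ * 4⁸ * 4⁸) * 14⁸ * (16⁹ * (m ^ 9 * n ^ 9)) * (n ^ 8 * n ^ 6 * (m ^ 8 * m ^ 8))
        ≡⟨ regroup′ (4⁸ * (4⁸ * 4⁸ * 4⁸) * 14⁸) (16⁹) (m ^ 9) (n ^ 9) (n ^ 8) (n ^ 6) (m ^ 8) ⟩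
      4⁸ * (4⁸ * 4⁸ * 4⁸) * 14⁸ * 16⁹ * (n ^ 9 * n ^ 8 * n ^ 6 * (m ^ 9 * m ^ 8 * m ^ 8))
        ≡⟨ cong (4⁸ * (4⁸ * 4⁸ * 4⁸) * 14⁸ * 16⁹ *_) (cong₂ _*_ (merge n 9 8 6) (merge m 9 8 8)) ⟩
      4⁸ * (4⁸ * 4⁸ * 4⁸) * 14⁸ * 16⁹ * (n ^ 23 * m ^ 25)
        ≤⟨ ℕ.*-monoˡ-≤ (n ^ 23 * m ^ 25) constants≤C₀⁸ ⟩
      C₀⁸ * (n ^ 23 * m ^ 25) ∎
      where
      regroup : ∀ n a v w t r μ → n * a * (a * a * a) * (v * w) * (t * t) * (r * (μ * μ)) ≡ a * (a * a * a) * r * (v * t * t) * (n * w * (μ * μ))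
      regroup = solve-∀
      regroup′ : ∀ k s a b c d e → k * (s * (a * b)) * (c * d * (e * e)) ≡ k * s * (b * c * d * (a * e * e))
      regroup′ = solve-∀
      merge : ∀ x a b c → x ^ a * x ^ b * x ^ c ≡ x ^ (a + b + c)
      merge x a b c = sym (trans (ℕ.^-distribˡ-+-* x (a + b) c) (cong (_* x ^ c) (ℕ.^-distribˡ-+-* x a b)))
      t¹⁸ : t ^ 2 * t ^ 8 * t ^ 8 ≤ 16⁹ * (m ^ 9 * n ^ 9)
      t¹⁸ = begin
        t ^ 2 * t ^ 8 * t ^ 8         ≡⟨ merge t 2 8 8 ⟩
        t ^ 18                        ≡⟨ ℕ.^-distribˡ-+-* t 9 9 ⟩
        t ^ 9 * t ^ 9                 ≡⟨ sym (^-distrib-* t t 9) ⟩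
        (t * t) ^ 9                   ≤⟨ ℕ.^-monoˡ-≤ 9 t²≤ ⟩
        (16 * (m * n)) ^ 9            ≡⟨ trans (distrib-by {16} (m * n) 9 16⁹≡) (cong (16⁹ *_) (^-distrib-* m n 9)) ⟩
        16⁹ * (m ^ 9 * n ^ 9)      ∎
    finish : F * G′ * c * (C₀⁸ * (n ^ 23 * m ^ 25)) ^ M ≡ (n ^ 23) ^ M * (m ^ 24) ^ M * (F * G′ * c * C₀⁸ ^ M * m ^ M)
    finish = trans (cong (F * G′ * c *_) (trans (^-distrib-* C₀⁸ (n ^ 23 * m ^ 25) M)
        (cong (C₀⁸ ^ M *_) (trans (^-distrib-* (n ^ 23) (m ^ 25) M) (cong ((n ^ 23) ^ M *_) (^-distrib-* m (m ^ 24) M))))))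
      (regroup (F * G′ * c) (C₀⁸ ^ M) ((n ^ 23) ^ M) (m ^ M) ((m ^ 24) ^ M))
      where
      regroup : ∀ f k a b d → f * (k * (a * (b * d))) ≡ a * d * (f * k * b)
      regroup = solve-∀

  final-ℕ : sumA ℒ m ^ E * n ^ (24 * n * m + m * m)
    ≤ (n !) ^ (24 * m) * C₀ ^ (8 * m * m + 8 * n) * m ^ (m * m) * denom ℒ ^ E
  final-ℕ = begin
    sumA ℒ m ^ E * n ^ (24 * n * m + m * m)
      ≡⟨ cong (sumA ℒ m ^ E *_) (trans (ℕ.^-distribˡ-+-* n (24 * n * m) M) (ℕ.*-comm (n ^ (24 * n * m)) _)) ⟩
    sumA ℒ m ^ E * (n ^ M * n ^ (24 * n * m))
      ≡⟨ sym (ℕ.*-assoc (sumA ℒ m ^ E) _ _) ⟩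
    sumA ℒ m ^ E * n ^ M * n ^ (24 * n * m)
      ≤⟨ ℕ.*-monoˡ-≤ (n ^ (24 * n * m)) power-bound ⟩
    F * G′ * (2 ^ 8) ^ n * C₀⁸ ^ M * m ^ M * n ^ (24 * n * m)
      ≡⟨ regroup F G′ ((2 ^ 8) ^ n) (C₀⁸ ^ M) (m ^ M) (n ^ (24 * n * m)) ⟩
    F * ((2 ^ 8) ^ n * C₀⁸ ^ M) * m ^ M * (G′ * n ^ (24 * n * m))
      ≤⟨ ℕ.*-mono-≤ (ℕ.*-monoˡ-≤ (m ^ M) (ℕ.*-mono-≤ (ℕ.≤-reflexive factorials) constants)) denominators ⟩
    (n !) ^ (24 * m) * C₀ ^ (8 * m * m + 8 * n) * m ^ (m * m) * denom ℒ ^ E ∎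
    where
    open ℕ.≤-Reasoning
    F = (n ! * n ! * n !) ^ E
    G′ = ((n * n) ^ n) ^ E
    regroup : ∀ f g c k μ ν → f * g * c * k * μ * ν ≡ f * (c * k) * μ * (g * ν)
    regroup = solve-∀
    cube : ∀ x → x * (x * (x * 1)) ≡ x * x * x
    cube = solve-∀
    factorials : F ≡ (n !) ^ (24 * m)
    factorials = trans (cong (_^ E) (sym (cube (n !)))) (trans (ℕ.^-*-assoc (n !) 3 E) (cong ((n !) ^_) (exps m)))
      where
      exps : ∀ m → 3 * (8 * m) ≡ 24 * m
      exps = solve-∀
    constants : (2 ^ 8) ^ n * C₀⁸ ^ M ≤ C₀ ^ (8 * m * m + 8 * n)
    constants = begin
      (2 ^ 8) ^ n * C₀⁸ ^ M             ≤⟨ ℕ.*-monoˡ-≤ (C₀⁸ ^ M) (ℕ.^-monoˡ-≤ n (ℕ.≤-trans (ℕ.^-monoˡ-≤ 8 2≤C₀) (ℕ.≤-reflexive C₀⁸≡))) ⟩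
      C₀⁸ ^ n * C₀⁸ ^ M      ≡⟨ cong₂ _*_ (unfold n) (unfold M) ⟩
      C₀ ^ (8 * n) * C₀ ^ (8 * M)      ≡⟨ sym (ℕ.^-distribˡ-+-* C₀ (8 * n) (8 * M)) ⟩
      C₀ ^ (8 * n + 8 * M)                   ≡⟨ cong (C₀ ^_) (trans (ℕ.+-comm (8 * n) (8 * M)) (cong (_+ 8 * n) (sym (ℕ.*-assoc 8 m m)))) ⟩
      C₀ ^ (8 * m * m + 8 * n)               ∎
      where
      unfold : ∀ k → C₀⁸ ^ k ≡ C₀ ^ (8 * k)
      unfold k = trans (cong (_^ k) (sym C₀⁸≡)) (ℕ.^-*-assoc C₀ 8 k)
    -- The number of codes has left the factor n^(2n) to the power E, which is matched by the lower
    -- bound for the size of Lⁿ.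
    denominators : G′ * n ^ (24 * n * m) ≤ denom ℒ ^ E
    denominators = begin
      G′ * n ^ (24 * n * m)                                          ≡⟨ cong₂ _*_ (cong (_^ E) (^-distrib-* n n n)) n²⁴ ⟩
      (n ^ n * n ^ n) ^ E * (n ^ n * (n ^ n * n ^ n)) ^ E            ≡⟨ sym (^-distrib-* (n ^ n * n ^ n) _ E) ⟩
      (n ^ n * n ^ n * (n ^ n * (n ^ n * n ^ n))) ^ E                ≤⟨ ℕ.^-monoˡ-≤ E (ℕ.*-monoˡ-≤ (n ^ n * (n ^ n * n ^ n)) (length-Ln ℒ)) ⟩
      denom ℒ ^ E                                                    ∎
      where
      exps : ∀ n m → 24 * n * m ≡ (n + (n + n)) * (8 * m)
      exps = solve-∀
      n²⁴ : n ^ (24 * n * m) ≡ (n ^ n * (n ^ n * n ^ n)) ^ E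
      n²⁴ = trans (cong (n ^_) (exps n m)) (trans (sym (ℕ.^-*-assoc n (n + (n + n)) E))
        (cong (_^ E) (trans (ℕ.^-distribˡ-+-* n n (n + n)) (cong (n ^ n *_) (ℕ.^-distribˡ-+-* n n n)))))

  denom>0 : 1 ≤ denom ℒ
  denom>0 = ℕ.*-mono-≤ (ℕ.≤-trans (ℕ.*-mono-≤ nⁿ nⁿ) (length-Ln ℒ)) (ℕ.*-mono-≤ nⁿ (ℕ.*-mono-≤ nⁿ nⁿ))
    where
    nⁿ : 1 ≤ n ^ n
    nⁿ = ℕ.m^n>0 n n

  final-ℚ : ((LHS ℒ m ^ℚ (8 * m)) *ℚ (ℕtoℚ n ^ℚ (24 * n * m + m * m)))
    ≤ℚ (((ℕtoℚ (n !) ^ℚ (24 * m)) *ℚ (ℕtoℚ C₀ ^ℚ (8 * m * m + 8 * n))) *ℚ (ℕtoℚ m ^ℚ (m * m)))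
  final-ℚ = ℚ.*-cancelʳ-≤-pos (ℕtoℚ D) {{ℚ.normalize-pos D 1 {{_}} {{ℕ.>-nonZero (ℕ.m^n>0 (denom ℒ) {{ℕ.>-nonZero denom>0}} E)}}}}
    (subst₂ ℚ._≤_ (sym left) (sym right) (ι-mono (ℤ.+≤+ final-ℕ)))
    where
    open ≡-Reasoning
    D = denom ℒ ^ E
    ν = ℕtoℚ n ^ℚ (24 * n * m + m * m)
    left : (LHS ℒ m ^ℚ E) *ℚ ν *ℚ ℕtoℚ D ≡ ℕtoℚ (sumA ℒ m ^ E * n ^ (24 * n * m + m * m))
    left = begin
      (LHS ℒ m ^ℚ E) *ℚ ν *ℚ ℕtoℚ D
        ≡⟨ ℚ.*-assoc (LHS ℒ m ^ℚ E) ν _ ⟩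
      (LHS ℒ m ^ℚ E) *ℚ (ν *ℚ ℕtoℚ D)
        ≡⟨ cong ((LHS ℒ m ^ℚ E) *ℚ_) (trans (ℚ.*-comm ν _) (cong (_*ℚ ν) (sym (ℕtoℚ-^ (denom ℒ) E)))) ⟩
      (LHS ℒ m ^ℚ E) *ℚ ((ℕtoℚ (denom ℒ) ^ℚ E) *ℚ ν)
        ≡⟨ sym (ℚ.*-assoc (LHS ℒ m ^ℚ E) _ ν) ⟩
      (LHS ℒ m ^ℚ E) *ℚ (ℕtoℚ (denom ℒ) ^ℚ E) *ℚ ν
        ≡⟨ cong (_*ℚ ν) (sym (^ℚ-distrib-* (LHS ℒ m) (ℕtoℚ (denom ℒ)) E)) ⟩
      ((LHS ℒ m *ℚ ℕtoℚ (denom ℒ)) ^ℚ E) *ℚ ν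
        ≡⟨ cong₂ _*ℚ_ (trans (cong (_^ℚ E) (LHS-exact ℒ m)) (ℕtoℚ-^ (sumA ℒ m) E)) (ℕtoℚ-^ n (24 * n * m + m * m)) ⟩
      ℕtoℚ (sumA ℒ m ^ E) *ℚ ℕtoℚ (n ^ (24 * n * m + m * m))
        ≡⟨ ℕtoℚ-* (sumA ℒ m ^ E) _ ⟩
      ℕtoℚ (sumA ℒ m ^ E * n ^ (24 * n * m + m * m)) ∎
    right : ((ℕtoℚ (n !) ^ℚ (24 * m)) *ℚ (ℕtoℚ C₀ ^ℚ (8 * m * m + 8 * n))) *ℚ (ℕtoℚ m ^ℚ (m * m)) *ℚ ℕtoℚ D
      ≡ ℕtoℚ ((n !) ^ (24 * m) * C₀ ^ (8 * m * m + 8 * n) * m ^ (m * m) * D)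
    right = begin
      ((ℕtoℚ (n !) ^ℚ (24 * m)) *ℚ (ℕtoℚ C₀ ^ℚ (8 * m * m + 8 * n))) *ℚ (ℕtoℚ m ^ℚ (m * m)) *ℚ ℕtoℚ D
        ≡⟨ cong (_*ℚ ℕtoℚ D) (cong₂ _*ℚ_ (cong₂ _*ℚ_ (ℕtoℚ-^ (n !) (24 * m)) (ℕtoℚ-^ C₀ (8 * m * m + 8 * n))) (ℕtoℚ-^ m (m * m))) ⟩
      (ℕtoℚ ((n !) ^ (24 * m)) *ℚ ℕtoℚ (C₀ ^ (8 * m * m + 8 * n))) *ℚ ℕtoℚ (m ^ (m * m)) *ℚ ℕtoℚ D
        ≡⟨ cong (λ z → z *ℚ ℕtoℚ (m ^ (m * m)) *ℚ ℕtoℚ D) (ℕtoℚ-* ((n !) ^ (24 * m)) _) ⟩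
      ℕtoℚ ((n !) ^ (24 * m) * C₀ ^ (8 * m * m + 8 * n)) *ℚ ℕtoℚ (m ^ (m * m)) *ℚ ℕtoℚ D
        ≡⟨ cong (_*ℚ ℕtoℚ D) (ℕtoℚ-* ((n !) ^ (24 * m) * C₀ ^ (8 * m * m + 8 * n)) _) ⟩
      ℕtoℚ ((n !) ^ (24 * m) * C₀ ^ (8 * m * m + 8 * n) * m ^ (m * m)) *ℚ ℕtoℚ D
        ≡⟨ ℕtoℚ-* ((n !) ^ (24 * m) * C₀ ^ (8 * m * m + 8 * n) * m ^ (m * m)) D ⟩
      ℕtoℚ ((n !) ^ (24 * m) * C₀ ^ (8 * m * m + 8 * n) * m ^ (m * m) * D) ∎

theorem2p3 : Σ ℕ λ K → Σ ℕ λ C → (1 ≤ K) × (∀ (n : ℕ) (ℒ : LatinSquare n) (m : ℕ) → 1 ≤ m → K * m ≤ n → ((LHS ℒ m ^ℚ (8 * m)) *ℚ (ℕtoℚ n ^ℚ (24 * n * m + m * m))) ≤ℚ (((ℕtoℚ (n !) ^ℚ (24 * m)) *ℚ (ℕtoℚ C ^ℚ (8 * m * m + 8 * n))) *ℚ (ℕtoℚ m ^ℚ (m * m))))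
theorem2p3 = 16 , C₀ , s≤s z≤n , bound
  where
  bound : ∀ (n : ℕ) (ℒ : LatinSquare n) (m : ℕ) → 1 ≤ m → 16 * m ≤ n → ((LHS ℒ m ^ℚ (8 * m)) *ℚ (ℕtoℚ n ^ℚ (24 * n * m + m * m))) ≤ℚ (((ℕtoℚ (n !) ^ℚ (24 * m)) *ℚ (ℕtoℚ C₀ ^ℚ (8 * m * m + 8 * n))) *ℚ (ℕtoℚ m ^ℚ (m * m)))
  bound n ℒ m 1≤m 16m≤n with root (m * n) (ℕ.*-mono-≤ 1≤m (ℕ.≤-trans 1≤m (ℕ.≤-trans (ℕ.m≤n*m m 16) 16m≤n)))
  ... | t , lo , hi = Main.final-ℚ ℒ m t 1≤m 2m≤n t≤n (ℕ.≤-trans (ℕ.m≤n*m m 2) 2m≤t) H hi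
    where
    open ℕ.≤-Reasoning
    m≤n : m ≤ n
    m≤n = ℕ.≤-trans (ℕ.m≤n*m m 16) 16m≤n
    2m≤n : 2 * m ≤ n
    2m≤n = ℕ.≤-trans (ℕ.*-monoˡ-≤ m (ℕ.≤ᵇ⇒≤ 2 16 _)) 16m≤n
    -- This fixes the witness 16: from t² ≤ 16mn and 16m ≤ n follows t² ≤ n².
    t≤n : t ≤ n
    t≤n = square-cancel (ℕ.≤-trans hi (ℕ.≤-trans (ℕ.≤-reflexive (sym (ℕ.*-assoc 16 m n))) (ℕ.*-monoˡ-≤ n 16m≤n)))
    2m≤t : 2 * m ≤ t
    2m≤t = square-cancel (begin
      2 * m * (2 * m)     ≡⟨ four m ⟩
      4 * (m * m)         ≤⟨ ℕ.*-monoʳ-≤ 4 (ℕ.*-monoʳ-≤ m m≤n) ⟩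
      4 * (m * n)         ≤⟨ lo ⟩
      t * t               ∎)
      where
      four : ∀ m → 2 * m * (2 * m) ≡ 4 * (m * m)
      four = solve-∀
    -- From 2m ≤ t and 4mn ≤ t² the two terms are at most one half and one quarter of t².
    H : m * t + m * n ≤ t * t
    H = ℕ.*-cancelˡ-≤ 4 (begin
      4 * (m * t + m * n)                  ≡⟨ split m t n ⟩
      2 * (2 * m * t) + 4 * (m * n)        ≤⟨ ℕ.+-mono-≤ (ℕ.*-monoʳ-≤ 2 (ℕ.*-monoˡ-≤ t 2m≤t)) lo ⟩
      2 * (t * t) + t * t                  ≤⟨ ℕ.m≤m+n _ (t * t) ⟩
      2 * (t * t) + t * t + t * t          ≡⟨ collect (t * t) ⟩
      4 * (t * t)                          ∎)
      where
      split : ∀ m t n → 4 * (m * t + m * n) ≡ 2 * (2 * m * t) + 4 * (m * n)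
      split = solve-∀
      collect : ∀ p → 2 * p + p + p ≡ 4 * p
      collect = solve-∀
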